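{- Consider the Online Interval Selection problem on inputs that are simple chains, in the random order model. The algorithm Revoke-to-the-Left has competitive ratio exactly $2\left(1-\frac{1}{\sqrt{e}}\right)$ on this class of inputs. That is, $2(1-1/\sqrt{e})$ is the largest real number $\rho$ for which there exists a constant $b$ such that, for every simple chain $I$ of $n\ge 1$ intervals, $\mathbb{E}_\sigma\left[\mathrm{ALG}(I,\sigma)\right]\ \ge\ \rho\cdot \mathrm{OPT}(I)-b$, where $\mathrm{ALG}(I,\sigma)$ is the number of intervals selected at the end by Revoke-to-the-Left when the intervals of $I$ arrive in the order $\sigma$, and $\sigma$ is a uniformly random permutation.
   Context: A simple chain of size $n$ is a set of $n$ unit-length intervals $I_1,\dots,I_n$ on the real line, numbered from left to right, such that $I_i$ and $I_j$ ($i\neq j$) overlap if and only if $|i-j|=1$ (the intersection graph is a path on $n$ vertices in this order). Online Interval Selection (unweighted): intervals arrive one by one; on arrival of each interval the algorithm irrevocably rejects it or accepts it; in the setting with revocable acceptances the algorithm may also revoke (permanently discard) previously accepted intervals when accepting a new one. At all times the currently selected intervals must be pairwise non-overlapping. The value of the algorithm is the number of selected intervals at the end. $\mathrm{OPT}(I)$ is the maximum size of a set of pairwise non-overlapping intervals of $I$ (equal to $\lceil n/2\rceil$ for a simple chain of size $n$). Random order model: the set of intervals is fixed by an adversary and then presented in a uniformly random order; the algorithm's performance is its expected value over this order. Revoke-to-the-Left: when an interval $[s_i,f_i]$ arrives, if it overlaps a currently selected interval $[s_j,f_j]$ with $s_i<f_j<f_i$ (a selected interval on its left side), it is rejected. Otherwise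 it is accepted, and every currently selected interval overlapping it is revoked. On a simple chain: an arriving $I_i$ is rejected if $I_{i-1}$ is currently selected; otherwise $I_i$ is accepted and $I_{i+1}$ is revoked if it is currently selected. -}

module Defs where

open import Data.Fin.Base as Fin using (Fin; toℕ)
import Data.Fin.Properties as Fin
open import Data.Integer.Base as ℤ using (+_)
import Data.Integer.Properties as ℤ
open import Data.List.Base
  using (List; []; _∷_; _++_; map; concatMap; filter; foldl; length; allFin)
open import Data.List.Extrema.Nat using (max)
open import Data.List.Relation.Unary.AllPairs using (AllPairs; allPairs?)
open import Data.List.Relation.Unary.Any using (any?)
open import Data.Nat.Base as ℕ using (ℕ; zero; suc; _!)
open import Data.Nat.ListAction using (sum)
import Data.Nat.Properties as ℕ
open import Data.Product.Base using (∃; _×_; _,_; proj₁; proj₂)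
open import Data.Rational.Base as ℚ using (ℚ; 0ℚ; 1ℚ; ½; _/_; ∣_∣; ↥_; ↧ₙ_)
import Data.Rational.Properties as ℚ
open import Data.Rational.Solver using (module +-*-Solver)
import Data.Rational.Unnormalised.Base as ℚᵘ
import Data.Rational.Unnormalised.Properties as ℚᵘ
open import Data.Sum.Base using (inj₁; inj₂)
open import Function.Bundles using (_⇔_; Equivalence)
open import Relation.Binary.Definitions using (tri<; tri≈; tri>)
open import Relation.Binary.PropositionalEquality
open import Relation.Nullary.Decidable using (Dec; yes; no; ¬?; _×-dec_; map′)
open import Relation.Nullary.Negation using (¬_; contradiction)

module RationalLemmas where
  open +-*-Solver using (solve; _:=_; _:+_; _:*_; :-_; con)

  private
    infix 4 _≤_
    _≤_ = ℚ._≤_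

  ι : ℕ → ℚ
  ι k = + k / 1

  frac-ι : ∀ a b .{{_ : ℕ.NonZero b}} → (+ a / b) ℚ.* ι b ≡ ι a
  frac-ι a b@(suc b-1) = ℚ.toℚᵘ-injective (begin
    ℚ.toℚᵘ ((+ a / b) ℚ.* ι b)
      ≈⟨ ℚ.toℚᵘ-homo-* (+ a / b) (ι b) ⟩
    ℚ.toℚᵘ (+ a / b) ℚᵘ.* ℚ.toℚᵘ (ι b)
      ≈⟨ ℚᵘ.*-cong (ℚ.toℚᵘ-fromℚᵘ (ℚᵘ.mkℚᵘ (+ a) b-1))
                   (ℚ.toℚᵘ-fromℚᵘ (ℚᵘ.mkℚᵘ (+ b) 0)) ⟩
    ℚᵘ.mkℚᵘ (+ a) b-1 ℚᵘ.* ℚᵘ.mkℚᵘ (+ b) 0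
      ≈⟨ ℚᵘ.*≡* (trans (ℤ.*-identityʳ _)
           (cong (λ k → + a ℤ.* (+ suc k)) (sym (ℕ.*-identityʳ b-1)))) ⟩
    ℚᵘ.mkℚᵘ (+ a) 0
      ≈⟨ ℚ.toℚᵘ-fromℚᵘ (ℚᵘ.mkℚᵘ (+ a) 0) ⟨
    ℚ.toℚᵘ (ι a) ∎)
    where open ℚᵘ.≃-Reasoning

  ι-mono : ∀ {a b} → a ℕ.≤ b → ι a ≤ ι b
  ι-mono {a} {b} a≤b = ℚ.toℚᵘ-cancel-≤ (begin
    ℚ.toℚᵘ (ι a)      ≃⟨ ℚ.toℚᵘ-fromℚᵘ (ℚᵘ.mkℚᵘ (+ a) 0) ⟩
    ℚᵘ.mkℚᵘ (+ a) 0   ≤⟨ ℚᵘ.*≤* (ℤ.*-monoʳ-≤-nonNeg (+ 1) (ℤ.+≤+ a≤b)) ⟩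
    ℚᵘ.mkℚᵘ (+ b) 0   ≃⟨ ℚ.toℚᵘ-fromℚᵘ (ℚᵘ.mkℚᵘ (+ b) 0) ⟨
    ℚ.toℚᵘ (ι b)      ∎)
    where open ℚᵘ.≤-Reasoning

  ι-* : ∀ a b → ι (a ℕ.* b) ≡ ι a ℚ.* ι b
  ι-* a b = ℚ.toℚᵘ-injective (begin
    ℚ.toℚᵘ (ι (a ℕ.* b))
      ≈⟨ ℚ.toℚᵘ-fromℚᵘ (ℚᵘ.mkℚᵘ (+ (a ℕ.* b)) 0) ⟩
    ℚᵘ.mkℚᵘ (+ (a ℕ.* b)) 0
      ≈⟨ ℚᵘ.*≡* (cong (ℤ._* + 1) (ℤ.pos-* a b)) ⟩
    ℚᵘ.mkℚᵘ (+ a) 0 ℚᵘ.* ℚᵘ.mkℚᵘ (+ b) 0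
      ≈⟨ ℚᵘ.*-cong (ℚ.toℚᵘ-fromℚᵘ (ℚᵘ.mkℚᵘ (+ a) 0))
                   (ℚ.toℚᵘ-fromℚᵘ (ℚᵘ.mkℚᵘ (+ b) 0)) ⟨
    ℚ.toℚᵘ (ι a) ℚᵘ.* ℚ.toℚᵘ (ι b)
      ≈⟨ ℚ.toℚᵘ-homo-* (ι a) (ι b) ⟨
    ℚ.toℚᵘ (ι a ℚ.* ι b) ∎)
    where open ℚᵘ.≃-Reasoning

  ι-suc : ∀ a → ι (suc a) ≡ ι a ℚ.+ 1ℚ
  ι-suc a = ℚ.toℚᵘ-injective (begin
    ℚ.toℚᵘ (ι (suc a))
      ≈⟨ ℚ.toℚᵘ-fromℚᵘ (ℚᵘ.mkℚᵘ (+ suc a) 0) ⟩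
    ℚᵘ.mkℚᵘ (+ suc a) 0
      ≈⟨ ℚᵘ.*≡* (cong (ℤ._* + 1) (trans (ℤ.+-comm (+ 1) (+ a))
           (cong (ℤ._+ + 1) (sym (ℤ.*-identityʳ (+ a)))))) ⟩
    ℚᵘ.mkℚᵘ (+ a) 0 ℚᵘ.+ ℚ.toℚᵘ 1ℚ
      ≈⟨ ℚᵘ.+-cong (ℚ.toℚᵘ-fromℚᵘ (ℚᵘ.mkℚᵘ (+ a) 0)) (ℚᵘ.≃-refl {ℚ.toℚᵘ 1ℚ}) ⟨
    ℚ.toℚᵘ (ι a) ℚᵘ.+ ℚ.toℚᵘ 1ℚ
      ≈⟨ ℚ.toℚᵘ-homo-+ (ι a) 1ℚ ⟨
    ℚ.toℚᵘ (ι a ℚ.+ 1ℚ) ∎)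
    where open ℚᵘ.≃-Reasoning

  0≤ι : ∀ a → 0ℚ ≤ ι a
  0≤ι a = ι-mono {0} {a} ℕ.z≤n

  0<1 : 0ℚ ℚ.< 1ℚ
  0<1 = ℚ.positive⁻¹ 1ℚ

  0<ι : ∀ a .{{_ : ℕ.NonZero a}} → 0ℚ ℚ.< ι a
  0<ι a@(suc _) = ℚ.<-≤-trans 0<1 (ι-mono {1} {a} (ℕ.s≤s ℕ.z≤n))

  *-pos : ∀ {p q} → 0ℚ ℚ.< p → 0ℚ ℚ.< q → 0ℚ ℚ.< p ℚ.* q
  *-pos {p} {q} 0<p 0<q = ℚ.positive⁻¹ (p ℚ.* q) {{ℚ.pos*pos⇒pos p {{ℚ.positive 0<p}} q {{ℚ.positive 0<q}}}}

  *-mono-≤ : ∀ {p p′ q q′} → 0ℚ ≤ p → 0ℚ ≤ q′ → p ≤ p′ → q ≤ q′ → p ℚ.* q ≤ p′ ℚ.* q′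
  *-mono-≤ {p} {p′} {q} {q′} 0≤p 0≤q′ p≤p′ q≤q′ = ℚ.≤-trans
    (ℚ.*-monoˡ-≤-nonNeg p {{ℚ.nonNegative 0≤p}} q≤q′)
    (ℚ.*-monoʳ-≤-nonNeg q′ {{ℚ.nonNegative 0≤q′}} p≤p′)

  *-cancelʳ-≤ : ∀ {p q} r → 0ℚ ℚ.< r → p ℚ.* r ≤ q ℚ.* r → p ≤ q
  *-cancelʳ-≤ r 0<r = ℚ.*-cancelʳ-≤-pos r {{ℚ.positive 0<r}}

  0≤frac : ∀ a b .{{_ : ℕ.NonZero b}} → 0ℚ ≤ + a / b
  0≤frac a b = *-cancelʳ-≤ (ι b) (0<ι b)
    (subst₂ _≤_ (sym (ℚ.*-zeroˡ (ι b))) (sym (frac-ι a b)) (0≤ι a))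

  unit-anti : ∀ {a b} .{{_ : ℕ.NonZero a}} .{{_ : ℕ.NonZero b}} → a ℕ.≤ b → + 1 / b ≤ + 1 / a
  unit-anti {a} {b} a≤b = *-cancelʳ-≤ (ι b) (0<ι b) (begin
    (+ 1 / b) ℚ.* ι b ≡⟨ frac-ι 1 b ⟩
    1ℚ                ≡⟨ frac-ι 1 a ⟨
    (+ 1 / a) ℚ.* ι a ≤⟨ ℚ.*-monoˡ-≤-nonNeg (+ 1 / a) {{ℚ.nonNegative (0≤frac 1 a)}} (ι-mono a≤b) ⟩
    (+ 1 / a) ℚ.* ι b ∎)
    where open ℚ.≤-Reasoning

  *-denominator : ∀ q → q ℚ.* ι (↧ₙ q) ≡ ↥ q / 1
  *-denominator q@record{} = ℚ.toℚᵘ-injective (begin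
    ℚ.toℚᵘ (q ℚ.* ι (↧ₙ q))
      ≈⟨ ℚ.toℚᵘ-homo-* q (ι (↧ₙ q)) ⟩
    ℚ.toℚᵘ q ℚᵘ.* ℚ.toℚᵘ (ι (↧ₙ q))
      ≈⟨ ℚᵘ.*-cong (ℚᵘ.≃-refl {ℚ.toℚᵘ q}) (ℚ.toℚᵘ-fromℚᵘ (ℚᵘ.mkℚᵘ (+ ↧ₙ q) 0)) ⟩
    ℚ.toℚᵘ q ℚᵘ.* ℚᵘ.mkℚᵘ (+ ↧ₙ q) 0
      ≈⟨ ℚᵘ.*≡* (trans (ℤ.*-identityʳ _)
           (cong (λ k → ↥ q ℤ.* (+ suc k)) (sym (ℕ.*-identityʳ (ℚ.denominator-1 q))))) ⟩
    ℚᵘ.mkℚᵘ (↥ q) 0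
      ≈⟨ ℚ.toℚᵘ-fromℚᵘ (ℚᵘ.mkℚᵘ (↥ q) 0) ⟨
    ℚ.toℚᵘ (↥ q / 1) ∎)
    where open ℚᵘ.≃-Reasoning

  *-denominator-nonNeg : ∀ q → 0ℚ ≤ q → q ℚ.* ι (↧ₙ q) ≡ ι ℤ.∣ ↥ q ∣
  *-denominator-nonNeg q@record{} 0≤q = trans (*-denominator q)
    (cong (_/ 1) (sym (ℤ.0≤i⇒+∣i∣≡i (ℤ.nonNegative⁻¹ (↥ q) {{ℚ.nonNegative 0≤q}}))))

  archimedean : ∀ ε → 0ℚ ℚ.< ε → ∃ λ N → ∀ n → N ℕ.≤ n → + 1 / suc n ≤ ε
  archimedean ε 0<ε = ↧ₙ ε , λ n N≤n → ℚ.≤-trans (unit-anti (ℕ.m≤n⇒m≤1+n N≤n)) below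
    where
    open ℚ.≤-Reasoning
    below : + 1 / ↧ₙ ε ≤ ε
    below = *-cancelʳ-≤ (ι (↧ₙ ε)) (0<ι (↧ₙ ε)) (begin
      (+ 1 / ↧ₙ ε) ℚ.* ι (↧ₙ ε) ≡⟨ frac-ι 1 (↧ₙ ε) ⟩
      ι 1                       ≤⟨ ι-mono (positive-numerator ε 0<ε) ⟩
      ι ℤ.∣ ↥ ε ∣               ≡⟨ *-denominator-nonNeg ε (ℚ.<⇒≤ 0<ε) ⟨
      ε ℚ.* ι (↧ₙ ε)            ∎)
      where
      positive-numerator : ∀ p → 0ℚ ℚ.< p → 1 ℕ.≤ ℤ.∣ ↥ p ∣
      positive-numerator (ℚ.mkℚ p _ _) 0<p with p | ℚ.positive 0<p
      ... | ℤ.+[1+ _ ] | _ = ℕ.s≤s ℕ.z≤n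

  ∣-∣-intro : ∀ {p q ε} → p ≤ q ℚ.+ ε → q ≤ p ℚ.+ ε → ∣ p ℚ.- q ∣ ≤ ε
  ∣-∣-intro {p} {q} {ε} p≤ q≤ with ℚ.∣p∣≡p∨∣p∣≡-p (p ℚ.- q)
  ... | inj₁ eq = subst₂ _≤_ (sym eq)
    (solve 2 (λ q ε → (q :+ ε) :+ (:- q) := ε) refl q ε) (ℚ.+-monoˡ-≤ (ℚ.- q) p≤)
  ... | inj₂ eq = subst₂ _≤_
    (trans (solve 2 (λ p q → q :+ (:- p) := :- (p :+ (:- q))) refl p q) (sym eq))
    (solve 2 (λ p ε → (p :+ ε) :+ (:- p) := ε) refl p ε) (ℚ.+-monoˡ-≤ (ℚ.- p) q≤)

  p≤∣p∣ : ∀ p → p ≤ ∣ p ∣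
  p≤∣p∣ p with ℚ.≤-total 0ℚ p
  ... | inj₁ 0≤p = ℚ.≤-reflexive (sym (ℚ.0≤p⇒∣p∣≡p 0≤p))
  ... | inj₂ p≤0 = ℚ.≤-trans p≤0 (ℚ.0≤∣p∣ p)

  ∣-∣-elim : ∀ {p q ε} → ∣ p ℚ.- q ∣ ≤ ε → p ≤ q ℚ.+ ε
  ∣-∣-elim {p} {q} {ε} d = subst (_≤ q ℚ.+ ε)
    (solve 2 (λ p q → q :+ (p :+ (:- q)) := p) refl p q)
    (ℚ.+-monoʳ-≤ q (ℚ.≤-trans (p≤∣p∣ (p ℚ.- q)) d))

  0<half : ∀ {ε} → 0ℚ ℚ.< ε → 0ℚ ℚ.< ½ ℚ.* ε
  0<half = *-pos (ℚ.positive⁻¹ ½)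

  halves : ∀ ε → ½ ℚ.* ε ℚ.+ ½ ℚ.* ε ≡ ε
  halves ε = trans (sym (ℚ.*-distribʳ-+ ε ½ ½)) (ℚ.*-identityˡ ε)

  ≤+ : ∀ p {ε} → 0ℚ ≤ ε → p ≤ p ℚ.+ ε
  ≤+ p {ε} 0≤ε = subst (_≤ p ℚ.+ ε) (ℚ.+-identityʳ p) (ℚ.+-monoʳ-≤ p 0≤ε)

  ⊔-step : ∀ c {p q ε} → 0ℚ ≤ ε → p ≤ q ℚ.+ ε → c ℚ.⊔ p ≤ (c ℚ.⊔ q) ℚ.+ ε
  ⊔-step c {p} {q} {ε} 0≤ε p≤ = ℚ.⊔-lub
    (ℚ.≤-trans (ℚ.p≤p⊔q c q) (≤+ _ 0≤ε))
    (ℚ.≤-trans p≤ (ℚ.+-monoˡ-≤ ε (ℚ.p≤q⊔p c q)))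

  *-near : ∀ {a b c d A B δ} → ∣ a ∣ ℚ.≤ A → ∣ d ∣ ℚ.≤ B → 0ℚ ℚ.≤ B → 0ℚ ℚ.≤ δ →
    ∣ a ℚ.- b ∣ ℚ.≤ δ → ∣ c ℚ.- d ∣ ℚ.≤ δ →
    ∣ a ℚ.* c ℚ.- b ℚ.* d ∣ ℚ.≤ δ ℚ.* (A ℚ.+ B)
  *-near {a} {b} {c} {d} {A} {B} {δ} a≤ d≤ 0≤B 0≤δ a-b c-d = begin
    ∣ a ℚ.* c ℚ.- b ℚ.* d ∣
      ≡⟨ cong ∣_∣ (solve 4 (λ a b c d → a :* c :+ (:- (b :* d)) :=
           a :* (c :+ (:- d)) :+ (a :+ (:- b)) :* d) refl a b c d) ⟩
    ∣ a ℚ.* (c ℚ.- d) ℚ.+ (a ℚ.- b) ℚ.* d ∣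
      ≤⟨ ℚ.∣p+q∣≤∣p∣+∣q∣ (a ℚ.* (c ℚ.- d)) ((a ℚ.- b) ℚ.* d) ⟩
    ∣ a ℚ.* (c ℚ.- d) ∣ ℚ.+ ∣ (a ℚ.- b) ℚ.* d ∣
      ≡⟨ cong₂ ℚ._+_ (ℚ.∣p*q∣≡∣p∣*∣q∣ a (c ℚ.- d)) (ℚ.∣p*q∣≡∣p∣*∣q∣ (a ℚ.- b) d) ⟩
    ∣ a ∣ ℚ.* ∣ c ℚ.- d ∣ ℚ.+ ∣ a ℚ.- b ∣ ℚ.* ∣ d ∣
      ≤⟨ ℚ.+-mono-≤ (*-mono-≤ (ℚ.0≤∣p∣ a) 0≤δ a≤ c-d)
                    (*-mono-≤ (ℚ.0≤∣p∣ (a ℚ.- b)) 0≤B a-b d≤) ⟩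
    A ℚ.* δ ℚ.+ δ ℚ.* B
      ≡⟨ solve 3 (λ a b d → a :* d :+ d :* b := d :* (a :+ b)) refl A B δ ⟩
    δ ℚ.* (A ℚ.+ B) ∎
    where
    open ℚ.≤-Reasoning

  split : ∀ C → 0ℚ ℚ.< C → ∀ ε → 0ℚ ℚ.< ε → ∃ λ δ → 0ℚ ℚ.< δ × δ ℚ.* C ≡ ε
  split C 0<C ε 0<ε =
    ε ℚ.* C⁻¹ ,
    *-pos 0<ε (ℚ.positive⁻¹ C⁻¹ {{ℚ.1/pos⇒pos C {{ℚ.positive 0<C}}}}) ,
    trans (ℚ.*-assoc ε C⁻¹ C)
      (trans (cong (ε ℚ.*_) (ℚ.*-inverseˡ C {{C≢0}})) (ℚ.*-identityʳ ε))
    where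
    C≢0 : ℚ.NonZero C
    C≢0 = ℚ.pos⇒nonZero C {{ℚ.positive 0<C}}
    C⁻¹ : ℚ
    C⁻¹ = (ℚ.1/ C) {{C≢0}}

  square-cancel-≤ : ∀ {p q} → 0ℚ ℚ.≤ q → p ℚ.* p ℚ.≤ q ℚ.* q → p ℚ.≤ q
  square-cancel-≤ {p} {q} 0≤q pp≤qq = ℚ.≮⇒≥ λ q<p →
    ℚ.<-irrefl refl (ℚ.≤-<-trans pp≤qq (ℚ.≤-<-trans
      (ℚ.*-monoˡ-≤-nonNeg q {{ℚ.nonNegative 0≤q}} (ℚ.<⇒≤ q<p))
      (ℚ.*-monoˡ-<-pos p {{ℚ.positive (ℚ.≤-<-trans 0≤q q<p)}} q<p)))

open RationalLemmas

infix  4 _≤_ _<_ _≃_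
infix  8 -_ √_
infixl 7 _*_
infixl 6 _+_ _-_

-- Cauchy sequences of rationals with an explicit modulus.  Equality of reals
-- is the relation _≃_, not propositional equality.
record ℝ : Set where
  constructor mkℝ
  field
    approx : ℕ → ℚ
    cauchy : ∀ ε → 0ℚ ℚ.< ε →
             ∃ λ N → ∀ m n → N ℕ.≤ m → N ℕ.≤ n → ∣ approx m ℚ.- approx n ∣ ℚ.≤ ε

open ℝ public

_≤_ : ℝ → ℝ → Set
x ≤ y = ∀ ε → 0ℚ ℚ.< ε → ∃ λ N → ∀ n → N ℕ.≤ n → approx x n ℚ.≤ approx y n ℚ.+ ε

_<_ : ℝ → ℝ → Set
x < y = ∃ λ ε → 0ℚ ℚ.< ε × ∃ λ N → ∀ n → N ℕ.≤ n → approx x n ℚ.+ ε ℚ.≤ approx y n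

_≃_ : ℝ → ℝ → Set
x ≃ y = x ≤ y × y ≤ x

oneSided : (x : ℕ → ℚ) →
  (∀ ε → 0ℚ ℚ.< ε → ∃ λ N → ∀ m n → N ℕ.≤ m → N ℕ.≤ n → x m ℚ.≤ x n ℚ.+ ε) → ℝ
oneSided x c = mkℝ x λ ε 0<ε → let N , close = c ε 0<ε in
  N , λ m n N≤m N≤n → ∣-∣-intro (close m n N≤m N≤n) (close n m N≤n N≤m)

near : ∀ x ε → 0ℚ ℚ.< ε →
  ∃ λ N → ∀ m n → N ℕ.≤ m → N ℕ.≤ n → approx x m ℚ.≤ approx x n ℚ.+ ε
near x ε 0<ε = let N , close = cauchy x ε 0<ε in
  N , λ m n N≤m N≤n → ∣-∣-elim (close m n N≤m N≤n)

fromℚ : ℚ → ℝ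
fromℚ q = oneSided (λ _ → q) λ ε 0<ε → 0 , λ _ _ _ _ → ≤+ q (ℚ.<⇒≤ 0<ε)

fromℕ : ℕ → ℝ
fromℕ k = fromℚ (+ k / 1)

0ℝ 1ℝ : ℝ
0ℝ = fromℕ 0
1ℝ = fromℕ 1

_+_ : ℝ → ℝ → ℝ
x + y = oneSided (λ n → approx x n ℚ.+ approx y n) λ ε 0<ε →
  let M , closeˣ = near x (½ ℚ.* ε) (0<half 0<ε)
      N , closeʸ = near y (½ ℚ.* ε) (0<half 0<ε)
  in M ℕ.⊔ N , λ m n ≤m ≤n → begin
    approx x m ℚ.+ approx y m
      ≤⟨ ℚ.+-mono-≤ (closeˣ m n (ℕ.m⊔n≤o⇒m≤o M N ≤m) (ℕ.m⊔n≤o⇒m≤o M N ≤n))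
                    (closeʸ m n (ℕ.m⊔n≤o⇒n≤o M N ≤m) (ℕ.m⊔n≤o⇒n≤o M N ≤n)) ⟩
    (approx x n ℚ.+ ½ ℚ.* ε) ℚ.+ (approx y n ℚ.+ ½ ℚ.* ε)
      ≡⟨ solve 3 (λ a b h → (a :+ h) :+ (b :+ h) := (a :+ b) :+ (h :+ h)) refl
           (approx x n) (approx y n) (½ ℚ.* ε) ⟩
    (approx x n ℚ.+ approx y n) ℚ.+ (½ ℚ.* ε ℚ.+ ½ ℚ.* ε)
      ≡⟨ cong (approx x n ℚ.+ approx y n ℚ.+_) (halves ε) ⟩
    (approx x n ℚ.+ approx y n) ℚ.+ ε ∎
  where
  open ℚ.≤-Reasoning
  open +-*-Solver

-_ : ℝ → ℝ
- x = oneSided (λ n → ℚ.- approx x n) λ ε 0<ε →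
  let N , close = near x ε 0<ε in
  N , λ m n N≤m N≤n → subst₂ ℚ._≤_
    (solve 2 (λ a b → b :+ ((:- a) :+ (:- b)) := :- a) refl (approx x m) (approx x n))
    (solve 3 (λ a b e → (a :+ e) :+ ((:- a) :+ (:- b)) := (:- b) :+ e) refl
       (approx x m) (approx x n) ε)
    (ℚ.+-monoˡ-≤ (ℚ.- approx x m ℚ.+ ℚ.- approx x n) (close n m N≤n N≤m))
  where open +-*-Solver

_-_ : ℝ → ℝ → ℝ
x - y = x + (- y)

bounded : ∀ x → ∃ λ B → 0ℚ ℚ.< B × ∃ λ N → ∀ n → N ℕ.≤ n → ∣ approx x n ∣ ℚ.≤ B
bounded x = let N , close = cauchy x 1ℚ 0<1 in
  ∣ approx x N ∣ ℚ.+ 1ℚ ,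
  ℚ.+-mono-≤-< (ℚ.0≤∣p∣ (approx x N)) 0<1 ,
  N , λ n N≤n → begin
    ∣ approx x n ∣
      ≡⟨ cong ∣_∣ (solve 2 (λ a b → b := a :+ (b :+ (:- a))) refl (approx x N) (approx x n)) ⟩
    ∣ approx x N ℚ.+ (approx x n ℚ.- approx x N) ∣
      ≤⟨ ℚ.∣p+q∣≤∣p∣+∣q∣ (approx x N) (approx x n ℚ.- approx x N) ⟩
    ∣ approx x N ∣ ℚ.+ ∣ approx x n ℚ.- approx x N ∣
      ≤⟨ ℚ.+-monoʳ-≤ ∣ approx x N ∣ (close n N N≤n ℕ.≤-refl) ⟩
    ∣ approx x N ∣ ℚ.+ 1ℚ ∎
  where
  open ℚ.≤-Reasoning
  open +-*-Solver

_*_ : ℝ → ℝ → ℝ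
x * y = mkℝ (λ n → approx x n ℚ.* approx y n) λ ε 0<ε →
  let A , 0<A , K , ∣x∣≤A = bounded x
      B , 0<B , L , ∣y∣≤B = bounded y
      δ , 0<δ , δ*[A+B]≡ε = split (A ℚ.+ B) (ℚ.+-mono-< 0<A 0<B) ε 0<ε
      M , closeˣ = cauchy x δ 0<δ
      N , closeʸ = cauchy y δ 0<δ
      K≤ = λ {n} (h : (K ℕ.⊔ L) ℕ.⊔ (M ℕ.⊔ N) ℕ.≤ n) →
        ℕ.m⊔n≤o⇒m≤o K L (ℕ.m⊔n≤o⇒m≤o (K ℕ.⊔ L) (M ℕ.⊔ N) h)
      L≤ = λ {n} (h : (K ℕ.⊔ L) ℕ.⊔ (M ℕ.⊔ N) ℕ.≤ n) →
        ℕ.m⊔n≤o⇒n≤o K L (ℕ.m⊔n≤o⇒m≤o (K ℕ.⊔ L) (M ℕ.⊔ N) h)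
      M≤ = λ {n} (h : (K ℕ.⊔ L) ℕ.⊔ (M ℕ.⊔ N) ℕ.≤ n) →
        ℕ.m⊔n≤o⇒m≤o M N (ℕ.m⊔n≤o⇒n≤o (K ℕ.⊔ L) (M ℕ.⊔ N) h)
      N≤ = λ {n} (h : (K ℕ.⊔ L) ℕ.⊔ (M ℕ.⊔ N) ℕ.≤ n) →
        ℕ.m⊔n≤o⇒n≤o M N (ℕ.m⊔n≤o⇒n≤o (K ℕ.⊔ L) (M ℕ.⊔ N) h)
  in (K ℕ.⊔ L) ℕ.⊔ (M ℕ.⊔ N) , λ m n ≤m ≤n → ℚ.≤-trans
    (*-near (∣x∣≤A m (K≤ ≤m)) (∣y∣≤B n (L≤ ≤n)) (ℚ.<⇒≤ 0<B) (ℚ.<⇒≤ 0<δ)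
       (closeˣ m n (M≤ ≤m) (M≤ ≤n)) (closeʸ m n (N≤ ≤m) (N≤ ≤n)))
    (ℚ.≤-reflexive δ*[A+B]≡ε)

-- Since x is eventually at least the rational bound ε extracted from 0 < x,
-- clamping its approximations at ε does not change the limit.
recip : (x : ℝ) → 0ℝ < x → ℝ
recip x (ε₀ , 0<ε₀ , _) = oneSided (λ n → inv (approx x n)) λ ε 0<ε →
  let 0<δ = *-pos 0<ε (*-pos 0<ε₀ 0<ε₀)
      N , close = near x (ε ℚ.* (ε₀ ℚ.* ε₀)) 0<δ
  in N , λ m n N≤m N≤n → inv-step (ℚ.<⇒≤ 0<ε) (⊔-step ε₀ {approx x n} {approx x m} (ℚ.<⇒≤ 0<δ) (close n m N≤n N≤m))
  where
  open ℚ.≤-Reasoning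
  open +-*-Solver
  clamp : ℚ → ℚ
  clamp q = ε₀ ℚ.⊔ q
  clamp-pos : ∀ q → 0ℚ ℚ.< clamp q
  clamp-pos q = ℚ.<-≤-trans 0<ε₀ (ℚ.p≤p⊔q ε₀ q)
  clamp≢0 : ∀ q → ℚ.NonZero (clamp q)
  clamp≢0 q = ℚ.pos⇒nonZero (clamp q) {{ℚ.positive (clamp-pos q)}}
  inv : ℚ → ℚ
  inv q = (ℚ.1/ clamp q) {{clamp≢0 q}}
  inv-* : ∀ q → inv q ℚ.* clamp q ≡ 1ℚ
  inv-* q = ℚ.*-inverseˡ (clamp q) {{clamp≢0 q}}
  inv-step : ∀ {p q ε} → 0ℚ ℚ.≤ ε → clamp q ℚ.≤ clamp p ℚ.+ ε ℚ.* (ε₀ ℚ.* ε₀) →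
    inv p ℚ.≤ inv q ℚ.+ ε
  inv-step {p} {q} {ε} 0≤ε h =
    *-cancelʳ-≤ (clamp p ℚ.* clamp q) (*-pos (clamp-pos p) (clamp-pos q)) (begin
      inv p ℚ.* (clamp p ℚ.* clamp q)
        ≡⟨ ℚ.*-assoc (inv p) (clamp p) (clamp q) ⟨
      inv p ℚ.* clamp p ℚ.* clamp q
        ≡⟨ cong (ℚ._* clamp q) (inv-* p) ⟩
      1ℚ ℚ.* clamp q
        ≡⟨ ℚ.*-identityˡ (clamp q) ⟩
      clamp q
        ≤⟨ h ⟩
      clamp p ℚ.+ ε ℚ.* (ε₀ ℚ.* ε₀)
        ≤⟨ ℚ.+-monoʳ-≤ (clamp p) (ℚ.*-monoˡ-≤-nonNeg ε {{ℚ.nonNegative 0≤ε}}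
             (*-mono-≤ (ℚ.<⇒≤ 0<ε₀) (ℚ.<⇒≤ (clamp-pos q)) (ℚ.p≤p⊔q ε₀ p) (ℚ.p≤p⊔q ε₀ q))) ⟩
      clamp p ℚ.+ ε ℚ.* (clamp p ℚ.* clamp q)
        ≡⟨ cong (ℚ._+ ε ℚ.* (clamp p ℚ.* clamp q))
             (trans (sym (ℚ.*-identityˡ (clamp p))) (cong (ℚ._* clamp p) (sym (inv-* q)))) ⟩
      inv q ℚ.* clamp q ℚ.* clamp p ℚ.+ ε ℚ.* (clamp p ℚ.* clamp q)
        ≡⟨ solve 4 (λ i a b e → i :* b :* a :+ e :* (a :* b) := (i :+ e) :* (a :* b)) refl
             (inv q) (clamp p) (clamp q) ε ⟩
      (inv q ℚ.+ ε) ℚ.* (clamp p ℚ.* clamp q) ∎)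

isqrt : ℕ → ℕ
isqrt zero = 0
isqrt (suc m) with suc (isqrt m) ℕ.* suc (isqrt m) ℕ.≤? suc m
... | yes _ = suc (isqrt m)
... | no  _ = isqrt m

isqrt-lower : ∀ m → isqrt m ℕ.* isqrt m ℕ.≤ m
isqrt-lower zero = ℕ.z≤n
isqrt-lower (suc m) with suc (isqrt m) ℕ.* suc (isqrt m) ℕ.≤? suc m
... | yes p = p
... | no  _ = ℕ.m≤n⇒m≤1+n (isqrt-lower m)

isqrt-upper : ∀ m → m ℕ.< suc (isqrt m) ℕ.* suc (isqrt m)
isqrt-upper zero = ℕ.s≤s ℕ.z≤n
isqrt-upper (suc m) with suc (isqrt m) ℕ.* suc (isqrt m) ℕ.≤? suc m
... | yes _ = ℕ.<-≤-trans (ℕ.s≤s (isqrt-upper m))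
  (ℕ.*-mono-< (ℕ.n<1+n (suc (isqrt m))) (ℕ.n<1+n (suc (isqrt m))))
... | no ¬p = ℕ.≰⇒> ¬p

-- With q = p / d and D = d (n + 1) this is ⌊√(p d (n + 1)²)⌋ / D, the largest
-- multiple of 1 / D whose square is at most q.
rootDenominator : ℚ → ℕ → ℕ
rootDenominator q n = ↧ₙ q ℕ.* suc n

rootRadicand : ℚ → ℕ → ℕ
rootRadicand q n = ℤ.∣ ↥ q ∣ ℕ.* ↧ₙ q ℕ.* (suc n ℕ.* suc n)

root : ℚ → ℕ → ℚ
root q n = + isqrt (rootRadicand q n) / rootDenominator q n

rootGap : ℚ → ℕ → ℚ
rootGap q n = + 1 / rootDenominator q n

module RootLemmas (q : ℚ) (0≤q : 0ℚ ℚ.≤ q) (n : ℕ) where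
  open ℚ.≤-Reasoning
  open +-*-Solver

  private
    D = rootDenominator q n
    i = isqrt (rootRadicand q n)
    s = root q n
    g = rootGap q n
    0<DD : 0ℚ ℚ.< ι D ℚ.* ι D
    0<DD = *-pos (0<ι D) (0<ι D)

  q*DD : q ℚ.* (ι D ℚ.* ι D) ≡ ι (rootRadicand q n)
  q*DD = begin-equality
    q ℚ.* (ι D ℚ.* ι D)
      ≡⟨ cong (λ t → q ℚ.* (t ℚ.* t)) (ι-* (↧ₙ q) (suc n)) ⟩
    q ℚ.* ((d ℚ.* k) ℚ.* (d ℚ.* k))
      ≡⟨ solve 3 (λ q d k → q :* ((d :* k) :* (d :* k)) := ((q :* d) :* d) :* (k :* k)) refl q d k ⟩
    ((q ℚ.* d) ℚ.* d) ℚ.* (k ℚ.* k)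
      ≡⟨ cong (λ t → (t ℚ.* d) ℚ.* (k ℚ.* k)) (*-denominator-nonNeg q 0≤q) ⟩
    (ι ℤ.∣ ↥ q ∣ ℚ.* d) ℚ.* (k ℚ.* k)
      ≡⟨ cong₂ ℚ._*_ (sym (ι-* ℤ.∣ ↥ q ∣ (↧ₙ q))) (sym (ι-* (suc n) (suc n))) ⟩
    ι (ℤ.∣ ↥ q ∣ ℕ.* ↧ₙ q) ℚ.* ι (suc n ℕ.* suc n)
      ≡⟨ ι-* (ℤ.∣ ↥ q ∣ ℕ.* ↧ₙ q) (suc n ℕ.* suc n) ⟨
    ι (rootRadicand q n) ∎
    where
    d = ι (↧ₙ q)
    k = ι (suc n)

  root≥0 : 0ℚ ℚ.≤ s
  root≥0 = 0≤frac i D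

  rootGap≥0 : 0ℚ ℚ.≤ g
  rootGap≥0 = 0≤frac 1 D

  rootGap≤ : g ℚ.≤ + 1 / suc n
  rootGap≤ = unit-anti {suc n} {D} (ℕ.m≤n*m (suc n) (↧ₙ q))

  root²≤ : s ℚ.* s ℚ.≤ q
  root²≤ = *-cancelʳ-≤ (ι D ℚ.* ι D) 0<DD (begin
    s ℚ.* s ℚ.* (ι D ℚ.* ι D)
      ≡⟨ solve 2 (λ s d → s :* s :* (d :* d) := (s :* d) :* (s :* d)) refl s (ι D) ⟩
    (s ℚ.* ι D) ℚ.* (s ℚ.* ι D)
      ≡⟨ cong (λ t → t ℚ.* t) (frac-ι i D) ⟩
    ι i ℚ.* ι i
      ≡⟨ ι-* i i ⟨
    ι (i ℕ.* i)
      ≤⟨ ι-mono (isqrt-lower (rootRadicand q n)) ⟩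
    ι (rootRadicand q n)
      ≡⟨ q*DD ⟨
    q ℚ.* (ι D ℚ.* ι D) ∎)

  ≤[root+gap]² : q ℚ.≤ (s ℚ.+ g) ℚ.* (s ℚ.+ g)
  ≤[root+gap]² = *-cancelʳ-≤ (ι D ℚ.* ι D) 0<DD (begin
    q ℚ.* (ι D ℚ.* ι D)
      ≡⟨ q*DD ⟩
    ι (rootRadicand q n)
      ≤⟨ ι-mono (ℕ.<⇒≤ (isqrt-upper (rootRadicand q n))) ⟩
    ι (suc i ℕ.* suc i)
      ≡⟨ ι-* (suc i) (suc i) ⟩
    ι (suc i) ℚ.* ι (suc i)
      ≡⟨ cong (λ t → t ℚ.* t) (ι-suc i) ⟩
    (ι i ℚ.+ 1ℚ) ℚ.* (ι i ℚ.+ 1ℚ)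
      ≡⟨ cong (λ t → t ℚ.* t) (cong₂ ℚ._+_ (frac-ι i D) (frac-ι 1 D)) ⟨
    (s ℚ.* ι D ℚ.+ g ℚ.* ι D) ℚ.* (s ℚ.* ι D ℚ.+ g ℚ.* ι D)
      ≡⟨ solve 3 (λ s g d → (s :* d :+ g :* d) :* (s :* d :+ g :* d) :=
           (s :+ g) :* (s :+ g) :* (d :* d)) refl s g (ι D) ⟩
    (s ℚ.+ g) ℚ.* (s ℚ.+ g) ℚ.* (ι D ℚ.* ι D) ∎)

-- The junk value of √ x for x < 0 is 0.
√_ : ℝ → ℝ
√ x = oneSided (λ n → root (0ℚ ℚ.⊔ approx x n) n) √-close
  where
  open ℚ.≤-Reasoning
  open +-*-Solver
  x⁺ : ℕ → ℚ
  x⁺ n = 0ℚ ℚ.⊔ approx x n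
  √-close : ∀ ε → 0ℚ ℚ.< ε → ∃ λ N → ∀ m n → N ℕ.≤ m → N ℕ.≤ n →
    root (x⁺ m) m ℚ.≤ root (x⁺ n) n ℚ.+ ε
  √-close ε 0<ε =
    let h = ½ ℚ.* ε
        0<h = 0<half 0<ε
        M , small = archimedean h 0<h
        N , close = near x (h ℚ.* h) (*-pos 0<h 0<h)
    in M ℕ.⊔ N , λ m n ≤m ≤n →
      let module Rₘ = RootLemmas (x⁺ m) (ℚ.p≤p⊔q 0ℚ (approx x m)) m
          module Rₙ = RootLemmas (x⁺ n) (ℚ.p≤p⊔q 0ℚ (approx x n)) n
          s = root (x⁺ m) m
          t = root (x⁺ n) n
          g = rootGap (x⁺ n) n
          g≤h = ℚ.≤-trans Rₙ.rootGap≤ (small n (ℕ.m⊔n≤o⇒m≤o M N ≤n))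
          0≤t+g = ℚ.+-mono-≤ Rₙ.root≥0 Rₙ.rootGap≥0
          0≤cross = ℚ.nonNegative⁻¹ ((t ℚ.+ g) ℚ.* h)
            {{ℚ.nonNeg*nonNeg⇒nonNeg (t ℚ.+ g) {{ℚ.nonNegative 0≤t+g}} h {{ℚ.nonNegative (ℚ.<⇒≤ 0<h)}}}}
      in ℚ.≤-trans
        (square-cancel-≤ {s} {(t ℚ.+ g) ℚ.+ h} (ℚ.+-mono-≤ 0≤t+g (ℚ.<⇒≤ 0<h)) (begin
          s ℚ.* s
            ≤⟨ Rₘ.root²≤ ⟩
          x⁺ m
            ≤⟨ ⊔-step 0ℚ {approx x m} {approx x n} (ℚ.<⇒≤ (*-pos 0<h 0<h))
                 (close m n (ℕ.m⊔n≤o⇒n≤o M N ≤m) (ℕ.m⊔n≤o⇒n≤o M N ≤n)) ⟩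
          x⁺ n ℚ.+ h ℚ.* h
            ≤⟨ ℚ.+-monoˡ-≤ (h ℚ.* h) Rₙ.≤[root+gap]² ⟩
          (t ℚ.+ g) ℚ.* (t ℚ.+ g) ℚ.+ h ℚ.* h
            ≤⟨ ≤+ _ (ℚ.+-mono-≤ 0≤cross 0≤cross) ⟩
          (t ℚ.+ g) ℚ.* (t ℚ.+ g) ℚ.+ h ℚ.* h ℚ.+ ((t ℚ.+ g) ℚ.* h ℚ.+ (t ℚ.+ g) ℚ.* h)
            ≡⟨ solve 2 (λ a h → a :* a :+ h :* h :+ (a :* h :+ a :* h) := (a :+ h) :* (a :+ h))
                 refl (t ℚ.+ g) h ⟩
          ((t ℚ.+ g) ℚ.+ h) ℚ.* ((t ℚ.+ g) ℚ.+ h) ∎))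
        (begin
          (t ℚ.+ g) ℚ.+ h  ≤⟨ ℚ.+-monoˡ-≤ h (ℚ.+-monoʳ-≤ t g≤h) ⟩
          (t ℚ.+ h) ℚ.+ h  ≡⟨ ℚ.+-assoc t h h ⟩
          t ℚ.+ (h ℚ.+ h)  ≡⟨ cong (t ℚ.+_) (halves ε) ⟩
          t ℚ.+ ε          ∎)

1/_! : ℕ → ℚ
1/ k ! = (+ 1 / k !) {{k ℕ.!≢0}}

1/!≥0 : ∀ k → 0ℚ ℚ.≤ 1/ k !
1/!≥0 k = 0≤frac 1 (k !) {{k ℕ.!≢0}}

1/!-suc : ∀ k → 1/ suc k ! ℚ.* ι (suc k) ≡ 1/ k !
1/!-suc k = ℚ.≤-antisym
  (*-cancelʳ-≤ (ι (k !)) 0<k! (ℚ.≤-reflexive eq))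
  (*-cancelʳ-≤ (ι (k !)) 0<k! (ℚ.≤-reflexive (sym eq)))
  where
  open ≡-Reasoning
  0<k! = 0<ι (k !) {{k ℕ.!≢0}}
  eq : 1/ suc k ! ℚ.* ι (suc k) ℚ.* ι (k !) ≡ 1/ k ! ℚ.* ι (k !)
  eq = begin
    1/ suc k ! ℚ.* ι (suc k) ℚ.* ι (k !)   ≡⟨ ℚ.*-assoc (1/ suc k !) (ι (suc k)) (ι (k !)) ⟩
    1/ suc k ! ℚ.* (ι (suc k) ℚ.* ι (k !)) ≡⟨ cong (1/ suc k ! ℚ.*_) (ι-* (suc k) (k !)) ⟨
    1/ suc k ! ℚ.* ι (suc k !)             ≡⟨ frac-ι 1 (suc k !) {{suc k ℕ.!≢0}} ⟩
    1ℚ                                     ≡⟨ frac-ι 1 (k !) {{k ℕ.!≢0}} ⟨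
    1/ k ! ℚ.* ι (k !)                     ∎

1/!≤ : ∀ k → 1/ suc k ! ℚ.≤ + 1 / suc k
1/!≤ k = unit-anti {suc k} {suc k !} {{_}} {{suc k ℕ.!≢0}}
  (ℕ.m≤m*n (suc k) (k !) {{k ℕ.!≢0}})

expSum : ℕ → ℚ
expSum zero    = 0ℚ
expSum (suc n) = expSum n ℚ.+ 1/ n !

expSum-mono : ∀ {m n} → m ℕ.≤ n → expSum m ℚ.≤ expSum n
expSum-mono m≤n = go (ℕ.≤⇒≤′ m≤n)
  where
  go : ∀ {m n} → m ℕ.≤′ n → expSum m ℚ.≤ expSum n
  go ℕ.≤′-refl             = ℚ.≤-refl
  go (ℕ.≤′-step {n} m≤′n) = ℚ.≤-trans (go m≤′n) (≤+ (expSum n) (1/!≥0 n))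

expUpper : ℕ → ℚ
expUpper n = expSum n ℚ.+ (1/ n ! ℚ.+ 1/ n !)

expUpper-anti : ∀ {m n} → 1 ℕ.≤ m → m ℕ.≤ n → expUpper n ℚ.≤ expUpper m
expUpper-anti 1≤m m≤n = go 1≤m (ℕ.≤⇒≤′ m≤n)
  where
  open ℚ.≤-Reasoning
  step : ∀ n → 1 ℕ.≤ n → expUpper (suc n) ℚ.≤ expUpper n
  step n 1≤n = begin
    expSum n ℚ.+ 1/ n ! ℚ.+ (1/ suc n ! ℚ.+ 1/ suc n !)
      ≡⟨ ℚ.+-assoc (expSum n) (1/ n !) _ ⟩
    expSum n ℚ.+ (1/ n ! ℚ.+ (1/ suc n ! ℚ.+ 1/ suc n !))
      ≤⟨ ℚ.+-monoʳ-≤ (expSum n) (ℚ.+-monoʳ-≤ (1/ n !) (begin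
           1/ suc n ! ℚ.+ 1/ suc n !
             ≡⟨ cong₂ ℚ._+_ (ℚ.*-identityʳ (1/ suc n !)) (ℚ.*-identityʳ (1/ suc n !)) ⟨
           1/ suc n ! ℚ.* 1ℚ ℚ.+ 1/ suc n ! ℚ.* 1ℚ
             ≡⟨ ℚ.*-distribˡ-+ (1/ suc n !) 1ℚ 1ℚ ⟨
           1/ suc n ! ℚ.* ι 2
             ≤⟨ ℚ.*-monoˡ-≤-nonNeg (1/ suc n !) {{ℚ.nonNegative (1/!≥0 (suc n))}}
                  (ι-mono (ℕ.s≤s 1≤n)) ⟩
           1/ suc n ! ℚ.* ι (suc n)
             ≡⟨ 1/!-suc n ⟩
           1/ n ! ∎)) ⟩
    expUpper n ∎
  go : ∀ {m n} → 1 ℕ.≤ m → m ℕ.≤′ n → expUpper n ℚ.≤ expUpper m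
  go _   ℕ.≤′-refl             = ℚ.≤-refl
  go 1≤m (ℕ.≤′-step {n} m≤′n) =
    ℚ.≤-trans (step n (ℕ.≤-trans 1≤m (ℕ.≤′⇒≤ m≤′n))) (go 1≤m m≤′n)

e : ℝ
e = oneSided expSum λ ε 0<ε →
  let h = ½ ℚ.* ε
      N , small = archimedean h (0<half 0<ε)
      u≤h = ℚ.≤-trans (1/!≤ N) (small N ℕ.≤-refl)
  in suc N , λ m n N<m N<n → begin
    expSum m
      ≤⟨ ≤+ (expSum m) (ℚ.+-mono-≤ (1/!≥0 m) (1/!≥0 m)) ⟩
    expUpper m
      ≤⟨ expUpper-anti (ℕ.s≤s ℕ.z≤n) N<m ⟩
    expUpper (suc N)
      ≤⟨ ℚ.+-mono-≤ (expSum-mono N<n) (ℚ.≤-trans (ℚ.+-mono-≤ u≤h u≤h) (ℚ.≤-reflexive (halves ε))) ⟩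
    expSum n ℚ.+ ε ∎
  where open ℚ.≤-Reasoning

√e>0 : 0ℝ < √ e
√e>0 = ½ , ℚ.positive⁻¹ ½ , 1 , λ n 1≤n →
  let q = 0ℚ ℚ.⊔ expSum n
      module R = RootLemmas q (ℚ.p≤p⊔q 0ℚ (expSum n)) n
      1≤q : 1ℚ ℚ.≤ q
      1≤q = ℚ.≤-trans (expSum-mono 1≤n) (ℚ.p≤q⊔p 0ℚ (expSum n))
      1≤s+g : 1ℚ ℚ.≤ root q n ℚ.+ rootGap q n
      1≤s+g = square-cancel-≤ (ℚ.+-mono-≤ R.root≥0 R.rootGap≥0) (ℚ.≤-trans 1≤q R.≤[root+gap]²)
      g≤½ : rootGap q n ℚ.≤ ½
      g≤½ = ℚ.≤-trans R.rootGap≤ (unit-anti {2} {suc n} (ℕ.s≤s 1≤n))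
  in begin
    1ℚ ℚ.- ½
      ≤⟨ ℚ.+-monoˡ-≤ (ℚ.- ½) (ℚ.≤-trans 1≤s+g (ℚ.+-monoʳ-≤ (root q n) g≤½)) ⟩
    root q n ℚ.+ ½ ℚ.- ½
      ≡⟨ ℚ.+-assoc (root q n) ½ (ℚ.- ½) ⟩
    root q n ℚ.+ 0ℚ
      ≡⟨ ℚ.+-identityʳ (root q n) ⟩
    root q n ∎
  where open ℚ.≤-Reasoning

1/√e : ℝ
1/√e = recip (√ e) √e>0

≤-<-trans : ∀ {x y z} → x ≤ y → y < z → x < z
≤-<-trans {x} {y} {z} x≤y (ε , 0<ε , N , y<z) =
  let h = ½ ℚ.* ε
      M , x≤y+h = x≤y h (0<half 0<ε)
  in h , 0<half 0<ε , M ℕ.⊔ N , λ n ≤n → begin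
    approx x n ℚ.+ h
      ≤⟨ ℚ.+-monoˡ-≤ h (x≤y+h n (ℕ.m⊔n≤o⇒m≤o M N ≤n)) ⟩
    approx y n ℚ.+ h ℚ.+ h
      ≡⟨ ℚ.+-assoc (approx y n) h h ⟩
    approx y n ℚ.+ (h ℚ.+ h)
      ≡⟨ cong (approx y n ℚ.+_) (halves ε) ⟩
    approx y n ℚ.+ ε
      ≤⟨ y<z n (ℕ.m⊔n≤o⇒n≤o M N ≤n) ⟩
    approx z n ∎
  where open ℚ.≤-Reasoning

<-≤-trans : ∀ {x y z} → x < y → y ≤ z → x < z
<-≤-trans {x} {y} {z} (ε , 0<ε , N , x<y) y≤z =
  let h = ½ ℚ.* ε
      M , y≤z+h = y≤z h (0<half 0<ε)
  in h , 0<half 0<ε , M ℕ.⊔ N , λ n ≤n → cancel (begin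
    approx x n ℚ.+ h ℚ.+ h
      ≡⟨ ℚ.+-assoc (approx x n) h h ⟩
    approx x n ℚ.+ (h ℚ.+ h)
      ≡⟨ cong (approx x n ℚ.+_) (halves ε) ⟩
    approx x n ℚ.+ ε
      ≤⟨ x<y n (ℕ.m⊔n≤o⇒n≤o M N ≤n) ⟩
    approx y n
      ≤⟨ y≤z+h n (ℕ.m⊔n≤o⇒m≤o M N ≤n) ⟩
    approx z n ℚ.+ h ∎)
  where
  open ℚ.≤-Reasoning
  open +-*-Solver
  cancel : ∀ {p q h} → p ℚ.+ h ℚ.≤ q ℚ.+ h → p ℚ.≤ q
  cancel {p} {q} {h} p+h≤q+h = subst₂ ℚ._≤_ (undo p) (undo q) (ℚ.+-monoˡ-≤ (ℚ.- h) p+h≤q+h)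
    where
    undo : ∀ r → r ℚ.+ h ℚ.- h ≡ r
    undo r = solve 2 (λ r h → (r :+ h) :+ (:- h) := r) refl r h

<-asym : ∀ {x y} → x < y → ¬ (y < x)
<-asym {x} {y} (ε , 0<ε , M , x<y) (δ , 0<δ , N , y<x) = ℚ.<-irrefl refl (begin-strict
  approx x n
    ≡⟨ ℚ.+-identityʳ (approx x n) ⟨
  approx x n ℚ.+ 0ℚ
    <⟨ ℚ.+-monoʳ-< (approx x n) 0<ε ⟩
  approx x n ℚ.+ ε
    ≤⟨ x<y n (ℕ.m≤m⊔n M N) ⟩
  approx y n
    ≤⟨ ≤+ (approx y n) (ℚ.<⇒≤ 0<δ) ⟩
  approx y n ℚ.+ δ
    ≤⟨ y<x n (ℕ.m≤n⊔m M N) ⟩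
  approx x n ∎)
  where
  open ℚ.≤-Reasoning
  n = M ℕ.⊔ N

<-irrefl : ∀ {x} → ¬ (x < x)
<-irrefl {x} x<x = <-asym {x} {x} x<x x<x

+-monoˡ-< : ∀ {x y} z → x < y → x + z < y + z
+-monoˡ-< {x} {y} z (ε , 0<ε , N , x<y) = ε , 0<ε , N , λ n N≤n →
  subst (ℚ._≤ approx y n ℚ.+ approx z n)
    (solve 3 (λ a c e → (a :+ e) :+ c := (a :+ c) :+ e) refl (approx x n) (approx z n) ε)
    (ℚ.+-monoˡ-≤ (approx z n) (x<y n N≤n))
  where open +-*-Solver

x<x+1 : ∀ x → x < x + 1ℝ
x<x+1 x = 1ℚ , 0<1 , 0 , λ _ _ → ℚ.≤-refl

record Interval : Set where
  constructor [_,_]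
  field
    start finish : ℝ

open Interval public

UnitLength : Interval → Set
UnitLength a = finish a ≃ start a + 1ℝ

-- Intervals that only share an endpoint do not overlap.
Overlap : Interval → Interval → Set
Overlap a b = start a < finish b × start b < finish a

record SimpleChain (n : ℕ) : Set where
  field
    interval : Fin n → Interval
    unit     : ∀ i → UnitLength (interval i)
    ordered  : ∀ {i j} → i Fin.< j → start (interval i) < start (interval j)
    adjacent : ∀ {i j} → i ≢ j →
               Overlap (interval i) (interval j) ⇔ ℕ.∣ toℕ i - toℕ j ∣ ≡ 1

sublists : ∀ {A : Set} → List A → List (List A)
sublists []       = [] ∷ []
sublists (x ∷ xs) = sublists xs ++ map (x ∷_) (sublists xs)

insertions : ∀ {A : Set} → A → List A → List (List A)
insertions x []       = (x ∷ []) ∷ []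
insertions x (y ∷ ys) = (x ∷ y ∷ ys) ∷ map (y ∷_) (insertions x ys)

permutations : ∀ {A : Set} → List A → List (List A)
permutations []       = [] ∷ []
permutations (x ∷ xs) = concatMap (insertions x) (permutations xs)

-- The order on ℝ is not decidable, so the comparisons an algorithm makes on the
-- intervals of an instance are supplied together with the instance.
module Selection {n : ℕ} (interval : Fin n → Interval)
  (overlap? : ∀ i j → Dec (Overlap (interval i) (interval j)))
  (finish<? : ∀ i j → Dec (finish (interval i) < finish (interval j)))
  where

  Compatible : List (Fin n) → Set
  Compatible = AllPairs (λ i j → ¬ Overlap (interval i) (interval j))

  compatible? : ∀ is → Dec (Compatible is)
  compatible? = allPairs? (λ i j → ¬? (overlap? i j))

  opt : ℕ
  opt = max 0 (map length (filter compatible? (sublists (allFin n))))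

  BlockedBy : Fin n → Fin n → Set
  BlockedBy i j = Overlap (interval i) (interval j) ×
    start (interval i) < finish (interval j) × finish (interval j) < finish (interval i)

  blockedBy? : ∀ i j → Dec (BlockedBy i j)
  blockedBy? i j = map′ (λ (o , f) → o , proj₁ o , f) (λ (o , _ , f) → o , f)
    (overlap? i j ×-dec finish<? j i)

  revokeToTheLeft : List (Fin n) → Fin n → List (Fin n)
  revokeToTheLeft selected i with any? (blockedBy? i) selected
  ... | yes _ = selected
  ... | no  _ = i ∷ filter (λ j → ¬? (overlap? i j)) selected

  alg : List (Fin n) → ℕ
  alg σ = length (foldl revokeToTheLeft [] σ)

  -- permutations lists each of the n ! arrival orders exactly once.
  expectedAlg : ℚ
  expectedAlg = (+ sum (map alg (permutations (allFin n))) / n !) {{n ℕ.!≢0}}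

module _ {n : ℕ} (I : SimpleChain n) where
  open SimpleChain I

  start<finish : ∀ i → start (interval i) < finish (interval i)
  start<finish i = <-≤-trans {start (interval i)} {start (interval i) + 1ℝ} {finish (interval i)}
    (x<x+1 (start (interval i))) (proj₂ (unit i))

  finish-ordered : ∀ {i j} → i Fin.< j → finish (interval i) < finish (interval j)
  finish-ordered {i} {j} i<j =
    ≤-<-trans {finish a} {start a + 1ℝ} {finish b} (proj₁ (unit i))
      (<-≤-trans {start a + 1ℝ} {start b + 1ℝ} {finish b}
        (+-monoˡ-< {start a} {start b} 1ℝ (ordered i<j)) (proj₂ (unit j)))
    where
    a = interval i
    b = interval j

  overlap? : ∀ i j → Dec (Overlap (interval i) (interval j))
  overlap? i j with i Fin.≟ j
  ... | yes refl = yes (start<finish i , start<finish i)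
  ... | no  i≢j  = map′ (Equivalence.from (adjacent i≢j)) (Equivalence.to (adjacent i≢j))
    (ℕ.∣ toℕ i - toℕ j ∣ ℕ.≟ 1)

  finish<? : ∀ i j → Dec (finish (interval i) < finish (interval j))
  finish<? i j with Fin.<-cmp i j
  ... | tri< i<j _ _ = yes (finish-ordered i<j)
  ... | tri≈ _ refl _ = no (<-irrefl {finish (interval i)})
  ... | tri> _ _ j<i =
    no (<-asym {finish (interval j)} {finish (interval i)} (finish-ordered j<i))

  OPT : ℕ
  OPT = Selection.opt interval overlap? finish<?

  𝔼ALG : ℚ
  𝔼ALG = Selection.expectedAlg interval overlap? finish<?

-- The additive constant b may depend on ρ but not on n or on the chain.
Guarantees : ℝ → Set
Guarantees ρ = ∃ λ (b : ℝ) → ∀ n → 1 ℕ.≤ n → (I : SimpleChain n) →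
  ρ * fromℕ (OPT I) - b ≤ fromℚ (𝔼ALG I)

{-# OPTIONS --safe #-}

-- Condition on which interval arrives last.  Then the probability Q that an
-- interval is finally selected depends only on the number r of intervals in the
-- unbroken run that ends at it, even if the instance is any subset of a chain,
-- and r Q(r) = Q(0) + … + Q(r - 2) + Q(r - 2).  The solution is
-- Q(r) = 1 - (c₀ + … + c_r), where Σ c_k x^k = exp (- x + x² / 2).  Summation by
-- parts turns the expected value Q(1) + … + Q(n) into (n + 1) Q(n) - c_{n-1}.
-- The c_k alternate in sign and (k + 1) |c_{k+1}| ≤ 2, so this is
-- n (1 - Σ c_k) + O(1).  Finally Σ c_k = 1 / √e: multiplication of series gives
-- exp (- x + x² / 2) * exp x = exp (x² / 2), and exp (1 / 2) squares to e.
module Submission where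

open import Data.Empty using (⊥)
open import Data.Fin.Base as Fin using (Fin; toℕ)
import Data.Fin.Properties as Fin
open import Data.Integer.Base using (+_)
open import Data.List.Base
  using (List; []; _∷_; _++_; _∷ʳ_; map; concatMap; filter; foldl; length;
         upTo; applyUpTo; allFin; tabulate)
import Data.List.Properties as List
open import Data.List.Extrema.Nat using (max≤v⁺; xs≤max)
open import Data.List.Membership.Propositional using (_∈_; _∉_)
open import Data.List.Membership.Propositional.Properties
open import Data.List.Relation.Unary.All as All using (All; []; _∷_)
open import Data.List.Relation.Unary.AllPairs using (AllPairs; []; _∷_)
import Data.List.Relation.Unary.AllPairs.Properties as AllPairs
open import Data.List.Relation.Unary.Any as Any using (Any; any?; here; there)
import Data.List.Relation.Unary.Any.Properties as Any
open import Data.List.Relation.Unary.Linked using (Linked; []; [-]; _∷_)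
import Data.List.Relation.Unary.Linked.Properties as Linked
open import Data.List.Relation.Unary.Unique.Propositional using (Unique)
import Data.List.Relation.Unary.Unique.Propositional.Properties as Unique
open import Data.Nat.Base as ℕ using (ℕ; zero; suc; _!; ⌈_/2⌉)
import Data.Nat.Properties as ℕ
open import Data.List.Membership.DecPropositional ℕ._≟_ using (_∈?_)
open import Data.Nat.ListAction using (sum)
open import Data.Product.Base using (∃; _,_; proj₁; proj₂)
open import Data.Rational.Base as ℚ using (ℚ; 0ℚ; 1ℚ; ½; _/_; ∣_∣)
import Data.Rational.Properties as ℚ
open import Data.Rational.Solver using (module +-*-Solver)
open import Data.Sum.Base using (_⊎_; inj₁; inj₂; [_,_]′)
open import Function.Base using (_∘_; id)
open import Function.Bundles using (mk⇔; Equivalence)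
open import Relation.Binary.Definitions using (tri<; tri≈; tri>)
open import Relation.Binary.PropositionalEquality
open import Relation.Nullary.Decidable using (Dec; yes; no; ¬?; _⊎-dec_)
open import Relation.Nullary.Negation using (¬_; contradiction)

open import Defs
open import Data.Product using (_×_)

open RationalLemmas
open +-*-Solver using (solve; _:=_; _:+_; _:*_; :-_; con)

-- Cauchy products

-- The recursion comes from what the last arrival j does to an interval k whose run has length r ≥
-- 2. If j is k, then k is selected exactly when its left neighbour is not: 1 - Q(r - 1). If j is
-- that neighbour, k was selected before, having nothing on its left, and survives exactly when j is
-- rejected: Q(r - 2). Any other j leaves the fate of k as it was without j; inside the run, at
-- distance d ≥ 2, its absence shortens the run to d. With Q(0) = 0 and Q(1) = 1 these r values add
-- up as claimed, and each interval outside the run contributes Q(r). Deleting j tears a chain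
-- apart, hence the induction over arbitrary sets of indices. Subtracting the recursions for r and r
-- - 1 leaves r c_r = - c_{r-1} + c_{r-2}, that is, C′ = (- 1 + x) C.
--
-- The constant b has to absorb n times the tail of Σ c_k, so that tail must be O(1 / n) and not
-- merely null. The value of the limit can be found at any rate; as reals are Cauchy sequences, this
-- is done with rational sequences that agree up to a null sequence.

psum : (ℕ → ℚ) → ℕ → ℚ
psum a zero    = 0ℚ
psum a (suc n) = psum a n ℚ.+ a n

psum-suc : ∀ a n → psum a (suc n) ≡ a 0 ℚ.+ psum (a ∘ suc) n
psum-suc a zero    = ℚ.+-comm 0ℚ (a 0)
psum-suc a (suc n) = trans (cong (ℚ._+ a (suc n)) (psum-suc a n))
  (ℚ.+-assoc (a 0) (psum (a ∘ suc) n) (a (suc n)))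

psum-cong : ∀ {a b} → (∀ k → a k ≡ b k) → ∀ n → psum a n ≡ psum b n
psum-cong a≗b zero    = refl
psum-cong a≗b (suc n) = cong₂ ℚ._+_ (psum-cong a≗b n) (a≗b n)

-- A sequence is read as the coefficients of a formal power series: conv is the
-- product, ∂ the derivative and delay the multiplication by x.
conv : (ℕ → ℚ) → (ℕ → ℚ) → ℕ → ℚ
conv a b zero    = a 0 ℚ.* b 0
conv a b (suc n) = a 0 ℚ.* b (suc n) ℚ.+ conv (a ∘ suc) b n

conv-congˡ : ∀ {a a′} b → (∀ k → a k ≡ a′ k) → ∀ n → conv a b n ≡ conv a′ b n
conv-congˡ b a≗a′ zero    = cong (ℚ._* b 0) (a≗a′ 0)
conv-congˡ b a≗a′ (suc n) =
  cong₂ ℚ._+_ (cong (ℚ._* b (suc n)) (a≗a′ 0)) (conv-congˡ b (a≗a′ ∘ suc) n)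

conv-congʳ : ∀ a {b b′} → (∀ k → b k ≡ b′ k) → ∀ n → conv a b n ≡ conv a b′ n
conv-congʳ a b≗b′ zero    = cong (a 0 ℚ.*_) (b≗b′ 0)
conv-congʳ a b≗b′ (suc n) =
  cong₂ ℚ._+_ (cong (a 0 ℚ.*_) (b≗b′ (suc n))) (conv-congʳ (a ∘ suc) b≗b′ n)

conv-+ˡ : ∀ a a′ b n → conv (λ k → a k ℚ.+ a′ k) b n ≡ conv a b n ℚ.+ conv a′ b n
conv-+ˡ a a′ b zero    = ℚ.*-distribʳ-+ (b 0) (a 0) (a′ 0)
conv-+ˡ a a′ b (suc n) = trans
  (cong ((a 0 ℚ.+ a′ 0) ℚ.* b (suc n) ℚ.+_) (conv-+ˡ (a ∘ suc) (a′ ∘ suc) b n))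
  (solve 5 (λ x y z p q → (x :+ y) :* z :+ (p :+ q) := (x :* z :+ p) :+ (y :* z :+ q)) refl
    (a 0) (a′ 0) (b (suc n)) (conv (a ∘ suc) b n) (conv (a′ ∘ suc) b n))

conv-*ˡ : ∀ r a b n → conv (λ k → r ℚ.* a k) b n ≡ r ℚ.* conv a b n
conv-*ˡ r a b zero    = ℚ.*-assoc r (a 0) (b 0)
conv-*ˡ r a b (suc n) = trans
  (cong ((r ℚ.* a 0) ℚ.* b (suc n) ℚ.+_) (conv-*ˡ r (a ∘ suc) b n))
  (solve 4 (λ r x y z → (r :* x) :* y :+ r :* z := r :* (x :* y :+ z)) refl
    r (a 0) (b (suc n)) (conv (a ∘ suc) b n))

conv-*ʳ : ∀ r a b n → conv a (λ k → r ℚ.* b k) n ≡ r ℚ.* conv a b n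
conv-*ʳ r a b zero    = solve 3 (λ r x y → x :* (r :* y) := r :* (x :* y)) refl r (a 0) (b 0)
conv-*ʳ r a b (suc n) = trans
  (cong (a 0 ℚ.* (r ℚ.* b (suc n)) ℚ.+_) (conv-*ʳ r (a ∘ suc) b n))
  (solve 4 (λ r x y z → x :* (r :* y) :+ r :* z := r :* (x :* y :+ z)) refl
    r (a 0) (b (suc n)) (conv (a ∘ suc) b n))

conv-const : ∀ r b n → conv (λ _ → r) b n ≡ r ℚ.* psum b (suc n)
conv-const r b zero    = cong (r ℚ.*_) (sym (ℚ.+-identityˡ (b 0)))
conv-const r b (suc n) = trans (cong (r ℚ.* b (suc n) ℚ.+_) (conv-const r b n))
  (solve 3 (λ r x y → r :* x :+ r :* y := r :* (y :+ x)) refl r (b (suc n)) (psum b (suc n)))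

-- `psum` is multiplication by x / (1 - x), so this is associativity of the product of series.
conv-psum : ∀ a b n → conv (psum a) b n ≡ psum (conv a b) n
conv-psum a b zero    = ℚ.*-zeroˡ (b 0)
conv-psum a b (suc n) = begin
  0ℚ ℚ.* b (suc n) ℚ.+ conv (λ k → psum a k ℚ.+ a k) b n
    ≡⟨ cong₂ ℚ._+_ (ℚ.*-zeroˡ (b (suc n))) (conv-+ˡ (psum a) a b n) ⟩
  0ℚ ℚ.+ (conv (psum a) b n ℚ.+ conv a b n)
    ≡⟨ ℚ.+-identityˡ _ ⟩
  conv (psum a) b n ℚ.+ conv a b n
    ≡⟨ cong (ℚ._+ conv a b n) (conv-psum a b n) ⟩
  psum (conv a b) n ℚ.+ conv a b n ∎
  where open ≡-Reasoning

NonNeg : (ℕ → ℚ) → Set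
NonNeg a = ∀ k → 0ℚ ℚ.≤ a k

*-nonNeg : ∀ {p q} → 0ℚ ℚ.≤ p → 0ℚ ℚ.≤ q → 0ℚ ℚ.≤ p ℚ.* q
*-nonNeg {p} {q} 0≤p 0≤q = ℚ.nonNegative⁻¹ (p ℚ.* q)
  {{ℚ.nonNeg*nonNeg⇒nonNeg p {{ℚ.nonNegative 0≤p}} q {{ℚ.nonNegative 0≤q}}}}

∣*∣≤ : ∀ {p q A} → 0ℚ ℚ.≤ q → ∣ p ∣ ℚ.≤ A → ∣ p ℚ.* q ∣ ℚ.≤ A ℚ.* q
∣*∣≤ {p} {q} {A} 0≤q p≤A = begin
  ∣ p ℚ.* q ∣     ≡⟨ ℚ.∣p*q∣≡∣p∣*∣q∣ p q ⟩
  ∣ p ∣ ℚ.* ∣ q ∣ ≡⟨ cong (∣ p ∣ ℚ.*_) (ℚ.0≤p⇒∣p∣≡p 0≤q) ⟩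
  ∣ p ∣ ℚ.* q     ≤⟨ ℚ.*-monoʳ-≤-nonNeg q {{ℚ.nonNegative 0≤q}} p≤A ⟩
  A ℚ.* q         ∎
  where open ℚ.≤-Reasoning

conv-bound : ∀ {a A b} n → NonNeg b → (∀ k → k ℕ.≤ n → ∣ a k ∣ ℚ.≤ A k) →
  ∣ conv a b n ∣ ℚ.≤ conv A b n
conv-bound zero    0≤b a≤A = ∣*∣≤ (0≤b 0) (a≤A 0 ℕ.z≤n)
conv-bound {a} {A} {b} (suc n) 0≤b a≤A = ℚ.≤-trans
  (ℚ.∣p+q∣≤∣p∣+∣q∣ (a 0 ℚ.* b (suc n)) (conv (a ∘ suc) b n))
  (ℚ.+-mono-≤ (∣*∣≤ (0≤b (suc n)) (a≤A 0 ℕ.z≤n))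
    (conv-bound n 0≤b λ k k≤n → a≤A (suc k) (ℕ.s≤s k≤n)))

-- The two sides differ by the products a i * b j with i, j < n ≤ i + j; for
-- fixed j these add up to b j times a block of the series of a.
conv-product : ∀ {a A b} → NonNeg A → NonNeg b →
  (∀ {m n} → m ℕ.≤ n → ∣ psum a n ℚ.- psum a m ∣ ℚ.≤ A m) →
  ∀ n → ∣ psum a n ℚ.* psum b n ℚ.- psum (conv a b) n ∣ ℚ.≤ conv A b n
conv-product {a} {A} {b} 0≤A 0≤b tail zero    = *-nonNeg (0≤A 0) (0≤b 0)
conv-product {a} {A} {b} 0≤A 0≤b tail (suc n) = begin
  ∣ K ℚ.* psum b (suc n) ℚ.- psum (conv a b) (suc n) ∣
    ≡⟨ cong ∣_∣ split-off ⟩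
  ∣ conv (λ k → K ℚ.- psum a (suc k)) b n ∣
    ≤⟨ conv-bound n 0≤b (λ k k≤n → tail (ℕ.s≤s k≤n)) ⟩
  -- The term `A 0 * b (suc n)` is given away so that the bound becomes a coefficient of a product
  -- of two series, which a differential equation can evaluate or estimate.
  conv (A ∘ suc) b n
    ≡⟨ ℚ.+-identityˡ _ ⟨
  0ℚ ℚ.+ conv (A ∘ suc) b n
    ≤⟨ ℚ.+-monoˡ-≤ _ (*-nonNeg (0≤A 0) (0≤b (suc n))) ⟩
  conv A b (suc n) ∎
  where
  open ℚ.≤-Reasoning
  K = psum a (suc n)
  R = conv (psum a ∘ suc) b n
  split-off : K ℚ.* psum b (suc n) ℚ.- psum (conv a b) (suc n) ≡
    conv (λ k → K ℚ.- psum a (suc k)) b n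
  split-off = sym (begin-equality
    conv (λ k → K ℚ.- psum a (suc k)) b n
      ≡⟨ conv-+ˡ (λ _ → K) (λ k → ℚ.- psum a (suc k)) b n ⟩
    conv (λ _ → K) b n ℚ.+ conv (λ k → ℚ.- psum a (suc k)) b n
      ≡⟨ cong₂ ℚ._+_ (conv-const K b n) (conv-congˡ b (λ k → neg (psum a (suc k))) n) ⟩
    K ℚ.* psum b (suc n) ℚ.+ conv (λ k → (ℚ.- 1ℚ) ℚ.* psum a (suc k)) b n
      ≡⟨ cong (K ℚ.* psum b (suc n) ℚ.+_) (conv-*ˡ (ℚ.- 1ℚ) (psum a ∘ suc) b n) ⟩
    K ℚ.* psum b (suc n) ℚ.+ (ℚ.- 1ℚ) ℚ.* R
      ≡⟨ cong (K ℚ.* psum b (suc n) ℚ.+_)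
           (solve 2 (λ r x → con (ℚ.- 1ℚ) :* r := :- (con 0ℚ :* x :+ r)) refl R (b (suc n))) ⟩
    K ℚ.* psum b (suc n) ℚ.- (0ℚ ℚ.* b (suc n) ℚ.+ R)
      ≡⟨ cong (λ z → K ℚ.* psum b (suc n) ℚ.- z) (conv-psum a b (suc n)) ⟩
    K ℚ.* psum b (suc n) ℚ.- psum (conv a b) (suc n) ∎)
    where
    neg : ∀ x → ℚ.- x ≡ (ℚ.- 1ℚ) ℚ.* x
    neg = solve 1 (λ x → :- x := con (ℚ.- 1ℚ) :* x) refl

-- Formal derivatives of power series

∂ : (ℕ → ℚ) → ℕ → ℚ
∂ a k = ι (suc k) ℚ.* a (suc k)

delay : (ℕ → ℚ) → ℕ → ℚ
delay a zero    = 0ℚ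
delay a (suc k) = a k

conv-delayˡ : ∀ a b n → conv (delay a) b n ≡ delay (conv a b) n
conv-delayˡ a b zero    = ℚ.*-zeroˡ (b 0)
conv-delayˡ a b (suc n) = trans (cong (ℚ._+ conv a b n) (ℚ.*-zeroˡ (b (suc n))))
  (ℚ.+-identityˡ (conv a b n))

-- The induction peels off a = a 0 + x a′. As (x a′ b)′ = a′ b + x (a′ b)′, the surplus a′ b is what
-- turns `∂ a′` into the shift of `∂ a`.
leibniz : ∀ a b n → ∂ (conv a b) n ≡ conv (∂ a) b n ℚ.+ conv a (∂ b) n
leibniz a b zero    = solve 5 (λ i x y z w → i :* (x :* y :+ z :* w) := (i :* z) :* w :+ x :* (i :* y)) refl
  (ι 1) (a 0) (b 1) (a 1) (b 0)
leibniz a b (suc n) = begin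
  ι (suc (suc n)) ℚ.* (a 0 ℚ.* b (suc (suc n)) ℚ.+ V)
    ≡⟨ solve 4 (λ i x y v → i :* (x :* y :+ v) := x :* (i :* y) :+ i :* v) refl
         (ι (suc (suc n))) (a 0) (b (suc (suc n))) V ⟩
  X ℚ.+ ι (suc (suc n)) ℚ.* V
    ≡⟨ cong (λ i → X ℚ.+ i ℚ.* V) (ι-suc (suc n)) ⟩
  X ℚ.+ (ι (suc n) ℚ.+ 1ℚ) ℚ.* V
    ≡⟨ solve 3 (λ x i v → x :+ (i :+ con 1ℚ) :* v := x :+ (i :* v :+ v)) refl X (ι (suc n)) V ⟩
  X ℚ.+ (∂ (conv a′ b) n ℚ.+ V)
    ≡⟨ cong (λ z → X ℚ.+ (z ℚ.+ V)) (leibniz a′ b n) ⟩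
  X ℚ.+ ((conv (∂ a′) b n ℚ.+ conv a′ (∂ b) n) ℚ.+ (a 1 ℚ.* b (suc n) ℚ.+ conv a″ b n))
    ≡⟨ solve 6 (λ x p q y z r → x :+ ((p :+ q) :+ (y :* z :+ r)) :=
         (con 1ℚ :* y) :* z :+ (p :+ r) :+ (x :+ q)) refl
         X (conv (∂ a′) b n) (conv a′ (∂ b) n) (a 1) (b (suc n)) (conv a″ b n) ⟩
  ∂ a 0 ℚ.* b (suc n) ℚ.+ (conv (∂ a′) b n ℚ.+ conv a″ b n) ℚ.+ conv a (∂ b) (suc n)
    ≡⟨ cong (λ z → ∂ a 0 ℚ.* b (suc n) ℚ.+ z ℚ.+ conv a (∂ b) (suc n)) (begin
         conv (∂ a′) b n ℚ.+ conv a″ b n   ≡⟨ conv-+ˡ (∂ a′) a″ b n ⟨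
         conv (λ k → ∂ a′ k ℚ.+ a″ k) b n ≡⟨ conv-congˡ b (λ k → shift k) n ⟩
         conv (∂ a ∘ suc) b n              ∎) ⟩
  conv (∂ a) b (suc n) ℚ.+ conv a (∂ b) (suc n) ∎
  where
  open ≡-Reasoning
  a′ = a ∘ suc
  a″ = a′ ∘ suc
  V = conv a′ b (suc n)
  X = a 0 ℚ.* ∂ b (suc n)
  shift : ∀ k → ∂ a′ k ℚ.+ a″ k ≡ ∂ a (suc k)
  shift k = trans
    (solve 2 (λ i x → i :* x :+ x := (i :+ con 1ℚ) :* x) refl (ι (suc k)) (a″ k))
    (cong (ℚ._* a″ k) (sym (ι-suc (suc k))))

ι-/ : ∀ x n → ι (suc n) ℚ.* (x ℚ.* (+ 1 / suc n)) ≡ x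
ι-/ x n = begin
  ι (suc n) ℚ.* (x ℚ.* (+ 1 / suc n))
    ≡⟨ solve 3 (λ i x u → i :* (x :* u) := x :* (u :* i)) refl (ι (suc n)) x (+ 1 / suc n) ⟩
  x ℚ.* ((+ 1 / suc n) ℚ.* ι (suc n)) ≡⟨ cong (x ℚ.*_) (frac-ι 1 (suc n)) ⟩
  x ℚ.* 1ℚ                            ≡⟨ ℚ.*-identityʳ x ⟩
  x                                   ∎
  where open ≡-Reasoning

ι-cancel-≤ : ∀ {p q} n → ι (suc n) ℚ.* p ℚ.≤ ι (suc n) ℚ.* q → p ℚ.≤ q
ι-cancel-≤ {p} {q} n h = *-cancelʳ-≤ (ι (suc n)) (0<ι (suc n))
  (subst₂ ℚ._≤_ (ℚ.*-comm (ι (suc n)) p) (ℚ.*-comm (ι (suc n)) q) h)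

ι-cancel-≡ : ∀ {p q} n → ι (suc n) ℚ.* p ≡ ι (suc n) ℚ.* q → p ≡ q
ι-cancel-≡ n eq = ℚ.≤-antisym (ι-cancel-≤ n (ℚ.≤-reflexive eq))
  (ι-cancel-≤ n (ℚ.≤-reflexive (sym eq)))

ι-+ : ∀ a b → ι (a ℕ.+ b) ≡ ι a ℚ.+ ι b
ι-+ zero    b = sym (ℚ.+-identityˡ (ι b))
ι-+ (suc a) b = begin
  ι (suc (a ℕ.+ b))      ≡⟨ ι-suc (a ℕ.+ b) ⟩
  ι (a ℕ.+ b) ℚ.+ 1ℚ     ≡⟨ cong (ℚ._+ 1ℚ) (ι-+ a b) ⟩
  ι a ℚ.+ ι b ℚ.+ 1ℚ     ≡⟨ solve 2 (λ a b → a :+ b :+ con 1ℚ := (a :+ con 1ℚ) :+ b) refl (ι a) (ι b) ⟩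
  ι a ℚ.+ 1ℚ ℚ.+ ι b     ≡⟨ cong (ℚ._+ ι b) (ι-suc a) ⟨
  ι (suc a) ℚ.+ ι b      ∎
  where open ≡-Reasoning

-- The series of exp (± x + x² / 2) and their tails

-- Coefficients of exp (x + x² / 2).
T : ℕ → ℚ
T zero          = 1ℚ
T (suc zero)    = 1ℚ
T (suc (suc k)) = (T (suc k) ℚ.+ T k) ℚ.* (+ 1 / suc (suc k))

∂-T : ∀ k → ∂ T k ≡ T k ℚ.+ delay T k
∂-T zero    = refl
∂-T (suc k) = ι-/ (T (suc k) ℚ.+ T k) (suc k)

T≥0 : NonNeg T
T≥0 zero          = ℚ.<⇒≤ 0<1
T≥0 (suc zero)    = ℚ.<⇒≤ 0<1
T≥0 (suc (suc k)) = *-nonNeg (ℚ.+-mono-≤ (T≥0 (suc k)) (T≥0 k)) (0≤frac 1 (suc (suc k)))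

T-anti : ∀ k → T (suc k) ℚ.≤ T k
T-anti zero    = ℚ.≤-refl
T-anti (suc k) = ι-cancel-≤ (suc k) (begin
  ∂ T (suc k)                               ≡⟨ ∂-T (suc k) ⟩
  T (suc k) ℚ.+ T k                         ≤⟨ ℚ.+-monoʳ-≤ (T (suc k)) (≤+ (T k) (delay≥0 k)) ⟩
  T (suc k) ℚ.+ (T k ℚ.+ delay T k)         ≡⟨ cong (T (suc k) ℚ.+_) (∂-T k) ⟨
  T (suc k) ℚ.+ ∂ T k                       ≡⟨ solve 2 (λ i t → t :+ i :* t := (i :+ con 1ℚ) :* t) refl
                                                 (ι (suc k)) (T (suc k)) ⟩
  (ι (suc k) ℚ.+ 1ℚ) ℚ.* T (suc k)          ≡⟨ cong (ℚ._* T (suc k)) (ι-suc (suc k)) ⟨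
  ι (suc (suc k)) ℚ.* T (suc k)             ∎)
  where
  open ℚ.≤-Reasoning
  delay≥0 : NonNeg (delay T)
  delay≥0 zero    = ℚ.≤-refl
  delay≥0 (suc k) = T≥0 k

T≤1 : ∀ k → T k ℚ.≤ 1ℚ
T≤1 zero    = ℚ.≤-refl
T≤1 (suc k) = ℚ.≤-trans (T-anti k) (T≤1 k)

∂-T≤2 : ∀ k → ∂ T k ℚ.≤ ι 2
∂-T≤2 zero    = ι-mono {1} {2} (ℕ.s≤s ℕ.z≤n)
∂-T≤2 (suc k) = ℚ.≤-trans (ℚ.≤-reflexive (∂-T (suc k))) (ℚ.+-mono-≤ (T≤1 (suc k)) (T≤1 k))

sign : ℕ → ℚ
sign zero    = 1ℚ
sign (suc k) = ℚ.- sign k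

∣sign*∣ : ∀ k x → ∣ sign k ℚ.* x ∣ ≡ ∣ x ∣
∣sign*∣ zero    x = cong ∣_∣ (ℚ.*-identityˡ x)
∣sign*∣ (suc k) x = trans (cong ∣_∣ (sym (ℚ.neg-distribˡ-* (sign k) x)))
  (trans (ℚ.∣-p∣≡∣p∣ (sign k ℚ.* x)) (∣sign*∣ k x))

-- Coefficients of exp (- x + x² / 2).
c : ℕ → ℚ
c k = sign k ℚ.* T k

∂-c : ∀ k → ∂ c k ≡ (ℚ.- 1ℚ) ℚ.* c k ℚ.+ delay c k
∂-c zero    = refl
∂-c (suc k) = begin
  ι (suc (suc k)) ℚ.* (ℚ.- ℚ.- s ℚ.* T (suc (suc k)))
    ≡⟨ solve 3 (λ i s t → i :* (:- (:- s) :* t) := s :* (i :* t)) refl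
         (ι (suc (suc k))) s (T (suc (suc k))) ⟩
  s ℚ.* ∂ T (suc k)
    ≡⟨ cong (s ℚ.*_) (∂-T (suc k)) ⟩
  s ℚ.* (T (suc k) ℚ.+ T k)
    ≡⟨ solve 3 (λ s t u → s :* (t :+ u) := con (ℚ.- 1ℚ) :* (:- s :* t) :+ s :* u) refl
         s (T (suc k)) (T k) ⟩
  (ℚ.- 1ℚ) ℚ.* c (suc k) ℚ.+ c k ∎
  where
  open ≡-Reasoning
  s = sign k

∣c∣≤1 : ∀ k → ∣ c k ∣ ℚ.≤ 1ℚ
∣c∣≤1 k = ℚ.≤-trans (ℚ.≤-reflexive (trans (∣sign*∣ k (T k)) (ℚ.0≤p⇒∣p∣≡p (T≥0 k)))) (T≤1 k)

alternating : ℕ → ℕ → ℚ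
alternating m zero    = 0ℚ
alternating m (suc l) = T m ℚ.- alternating (suc m) l

-- Leibniz's criterion. The two bounds need each other: subtracting the next block uses its upper
-- bound for positivity and its positivity for the upper bound.
alternating-bounds : ∀ m l → 0ℚ ℚ.≤ alternating m l × alternating m l ℚ.≤ T m
alternating-bounds m zero    = ℚ.≤-refl , T≥0 m
alternating-bounds m (suc l) =
  let 0≤r , r≤T = alternating-bounds (suc m) l
      r = alternating (suc m) l
  in subst (ℚ._≤ T m ℚ.- r) (ℚ.+-inverseʳ r) (ℚ.+-monoˡ-≤ (ℚ.- r) (ℚ.≤-trans r≤T (T-anti m))) ,
     subst (T m ℚ.- r ℚ.≤_) (ℚ.+-identityʳ (T m)) (ℚ.+-monoʳ-≤ (T m) (ℚ.neg-antimono-≤ 0≤r))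

psum-c-+ : ∀ m l → psum c (m ℕ.+ l) ≡ psum c m ℚ.+ sign m ℚ.* alternating m l
psum-c-+ m zero    = trans (cong (psum c) (ℕ.+-identityʳ m))
  (sym (trans (cong (psum c m ℚ.+_) (ℚ.*-zeroʳ (sign m))) (ℚ.+-identityʳ (psum c m))))
psum-c-+ m (suc l) = trans (cong (psum c) (ℕ.+-suc m l)) (trans (psum-c-+ (suc m) l)
  (solve 4 (λ p s t r → (p :+ s :* t) :+ (:- s) :* r := p :+ s :* (t :+ :- r)) refl
    (psum c m) (sign m) (T m) (alternating (suc m) l)))

psum-c-tail : ∀ {m n} → m ℕ.≤ n → ∣ psum c n ℚ.- psum c m ∣ ℚ.≤ T m
psum-c-tail {m} {n} m≤n = begin
  ∣ psum c n ℚ.- psum c m ∣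
    ≡⟨ cong (λ k → ∣ psum c k ℚ.- psum c m ∣) (ℕ.m+[n∸m]≡n m≤n) ⟨
  ∣ psum c (m ℕ.+ l) ℚ.- psum c m ∣
    ≡⟨ cong (λ z → ∣ z ℚ.- psum c m ∣) (psum-c-+ m l) ⟩
  ∣ psum c m ℚ.+ sign m ℚ.* r ℚ.- psum c m ∣
    ≡⟨ cong ∣_∣ (solve 2 (λ p x → (p :+ x) :+ :- p := x) refl (psum c m) (sign m ℚ.* r)) ⟩
  ∣ sign m ℚ.* r ∣
    ≡⟨ ∣sign*∣ m r ⟩
  ∣ r ∣
    ≡⟨ ℚ.0≤p⇒∣p∣≡p (proj₁ (alternating-bounds m l)) ⟩
  r
    ≤⟨ proj₂ (alternating-bounds m l) ⟩
  T m ∎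
  where
  open ℚ.≤-Reasoning
  l = n ℕ.∸ m
  r = alternating m l

-- The selection probabilities and their recursion

-- The probability that the last interval of a chain of r intervals is selected
-- in the end.
Q : ℕ → ℚ
Q r = 1ℚ ℚ.- psum c (suc r)

-- Summation by parts, as k * c k telescopes by ∂-c.
psum-Q : ∀ n → psum Q (suc (suc n)) ≡ ι (suc (suc n)) ℚ.* Q (suc n) ℚ.- c n
psum-Q zero    = refl
psum-Q (suc n) = begin
  psum Q (suc (suc n)) ℚ.+ Q (suc (suc n))
    ≡⟨ cong (ℚ._+ Q (suc (suc n))) (psum-Q n) ⟩
  ι (suc (suc n)) ℚ.* (1ℚ ℚ.- p) ℚ.- c n ℚ.+ (1ℚ ℚ.- (p ℚ.+ x))
    ≡⟨ solve 4 (λ i p x y → i :* (con 1ℚ :+ :- p) :+ :- y :+ (con 1ℚ :+ :- (p :+ x)) :=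
         (i :+ con 1ℚ) :* (con 1ℚ :+ :- (p :+ x)) :+ (i :* x :+ :- y)) refl
         (ι (suc (suc n))) p x (c n) ⟩
  (ι (suc (suc n)) ℚ.+ 1ℚ) ℚ.* Q (suc (suc n)) ℚ.+ (∂ c (suc n) ℚ.- c n)
    ≡⟨ cong₂ ℚ._+_ (cong (ℚ._* Q (suc (suc n))) (sym (ι-suc (suc (suc n)))))
         (trans (cong (ℚ._- c n) (∂-c (suc n)))
           (solve 2 (λ x y → (con (ℚ.- 1ℚ) :* x :+ y) :+ :- y := :- x) refl (c (suc n)) (c n))) ⟩
  ι (suc (suc (suc n))) ℚ.* Q (suc (suc n)) ℚ.- c (suc n) ∎
  where
  open ≡-Reasoning
  p = psum c (suc (suc n))
  x = c (suc (suc n))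

-- Multiplied by n + 2, the step from `Q (suc n)` to `Q (suc (suc n))` costs `∂ c (suc n)`. The
-- differential equation expresses this by `c n`, which `psum-Q` absorbs, and by `c (suc n)`, which
-- is `Q n - Q (suc n)`. The sum runs through `Q (suc n)` before it is corrected because cutting a
-- run at all its places produces the full sum.
Q-rec : ∀ n → ι (suc (suc n)) ℚ.* Q (suc (suc n)) ≡ psum Q (suc (suc n)) ℚ.- Q (suc n) ℚ.+ Q n
Q-rec n = begin
  i ℚ.* (1ℚ ℚ.- (p ℚ.+ y ℚ.+ z))
    ≡⟨ solve 4 (λ i p y z → i :* (con 1ℚ :+ :- (p :+ y :+ z)) :=
         i :* (con 1ℚ :+ :- (p :+ y)) :+ :- (i :* z)) refl i p y z ⟩
  i ℚ.* Q (suc n) ℚ.- ∂ c (suc n)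
    ≡⟨ cong (λ w → i ℚ.* Q (suc n) ℚ.- w) (∂-c (suc n)) ⟩
  i ℚ.* Q (suc n) ℚ.- ((ℚ.- 1ℚ) ℚ.* y ℚ.+ c n)
    ≡⟨ solve 4 (λ q p y x → q :+ :- (con (ℚ.- 1ℚ) :* y :+ x) :=
         (q :+ :- x) :+ :- (con 1ℚ :+ :- (p :+ y)) :+ (con 1ℚ :+ :- p)) refl
         (i ℚ.* Q (suc n)) p y (c n) ⟩
  i ℚ.* Q (suc n) ℚ.- c n ℚ.- Q (suc n) ℚ.+ Q n
    ≡⟨ cong (λ w → w ℚ.- Q (suc n) ℚ.+ Q n) (psum-Q n) ⟨
  psum Q (suc (suc n)) ℚ.- Q (suc n) ℚ.+ Q n ∎
  where
  open ≡-Reasoning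
  i = ι (suc (suc n))
  p = psum c (suc n)
  y = c (suc n)
  z = c (suc (suc n))

-- Products of exponential series

-- Coefficients of exp (x / 2).
h : ℕ → ℚ
h zero    = 1ℚ
h (suc k) = (½ ℚ.* h k) ℚ.* (+ 1 / suc k)

∂-h : ∀ k → ∂ h k ≡ ½ ℚ.* h k
∂-h k = ι-/ (½ ℚ.* h k) k

h≥0 : NonNeg h
h≥0 zero    = ℚ.<⇒≤ 0<1
h≥0 (suc k) = *-nonNeg (*-nonNeg (ℚ.nonNegative⁻¹ ½) (h≥0 k)) (0≤frac 1 (suc k))

h-halves : ∀ k → h (suc k) ℚ.+ h (suc k) ℚ.≤ h k
h-halves k = begin
  h (suc k) ℚ.+ h (suc k)
    ≡⟨ solve 2 (λ h u → (con ½ :* h) :* u :+ (con ½ :* h) :* u := h :* u) refl (h k) (+ 1 / suc k) ⟩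
  h k ℚ.* (+ 1 / suc k)
    ≤⟨ ℚ.*-monoˡ-≤-nonNeg (h k) {{ℚ.nonNegative (h≥0 k)}} (unit-anti {1} {suc k} (ℕ.s≤s ℕ.z≤n)) ⟩
  h k ℚ.* 1ℚ
    ≡⟨ ℚ.*-identityʳ (h k) ⟩
  h k ∎
  where open ℚ.≤-Reasoning

psum-mono : ∀ {a} → NonNeg a → ∀ {m n} → m ℕ.≤ n → psum a m ℚ.≤ psum a n
psum-mono {a} 0≤a m≤n = go (ℕ.≤⇒≤′ m≤n)
  where
  go : ∀ {m n} → m ℕ.≤′ n → psum a m ℚ.≤ psum a n
  go ℕ.≤′-refl             = ℚ.≤-refl
  go (ℕ.≤′-step {n} m≤′n) = ℚ.≤-trans (go m≤′n) (≤+ (psum a n) (0≤a n))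

-- A partial sum plus twice the first omitted term is an upper bound that only decreases: by
-- `h-halves`, one of the two copies pays for both copies of the next term.
psum-h-upper : ∀ {m n} → m ℕ.≤′ n → psum h n ℚ.+ (h n ℚ.+ h n) ℚ.≤ psum h m ℚ.+ (h m ℚ.+ h m)
psum-h-upper ℕ.≤′-refl                 = ℚ.≤-refl
psum-h-upper {m} (ℕ.≤′-step {n} m≤′n) = begin
  psum h n ℚ.+ h n ℚ.+ (h (suc n) ℚ.+ h (suc n)) ≤⟨ ℚ.+-monoʳ-≤ (psum h n ℚ.+ h n) (h-halves n) ⟩
  psum h n ℚ.+ h n ℚ.+ h n                       ≡⟨ ℚ.+-assoc (psum h n) (h n) (h n) ⟩
  psum h n ℚ.+ (h n ℚ.+ h n)                     ≤⟨ psum-h-upper m≤′n ⟩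
  psum h m ℚ.+ (h m ℚ.+ h m)                     ∎
  where open ℚ.≤-Reasoning

psum-h-tail : ∀ {m n} → m ℕ.≤ n → ∣ psum h n ℚ.- psum h m ∣ ℚ.≤ ι 2 ℚ.* h m
psum-h-tail {m} {n} m≤n = ∣-∣-intro
  (begin
    psum h n                   ≤⟨ ≤+ (psum h n) (ℚ.+-mono-≤ (h≥0 n) (h≥0 n)) ⟩
    psum h n ℚ.+ (h n ℚ.+ h n) ≤⟨ psum-h-upper (ℕ.≤⇒≤′ m≤n) ⟩
    psum h m ℚ.+ (h m ℚ.+ h m) ≡⟨ cong (psum h m ℚ.+_) (solve 1 (λ x → x :+ x := con (ι 2) :* x) refl (h m)) ⟩
    psum h m ℚ.+ ι 2 ℚ.* h m   ∎)
  (ℚ.≤-trans (psum-mono h≥0 m≤n) (≤+ (psum h n) (*-nonNeg (0≤ι 2) (h≥0 m))))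
  where open ℚ.≤-Reasoning

∂-! : ∀ k → ∂ 1/_! k ≡ 1/ k !
∂-! k = trans (ℚ.*-comm (ι (suc k)) (1/ suc k !)) (1/!-suc k)

psum-! : ∀ n → psum 1/_! n ≡ expSum n
psum-! zero    = refl
psum-! (suc n) = cong (ℚ._+ 1/ n !) (psum-! n)

-- Both sides solve y′ = y with y(0) = 1, and `ι-cancel-≡` makes the equation determine every
-- further coefficient.
conv-h-h : ∀ n → conv h h n ≡ 1/ n !
conv-h-h zero    = refl
conv-h-h (suc n) = ι-cancel-≡ n (begin
  ∂ (conv h h) n
    ≡⟨ leibniz h h n ⟩
  conv (∂ h) h n ℚ.+ conv h (∂ h) n
    ≡⟨ cong₂ ℚ._+_ (trans (conv-congˡ h ∂-h n) (conv-*ˡ ½ h h n))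
                   (trans (conv-congʳ h ∂-h n) (conv-*ʳ ½ h h n)) ⟩
  ½ ℚ.* conv h h n ℚ.+ ½ ℚ.* conv h h n
    ≡⟨ halves (conv h h n) ⟩
  conv h h n
    ≡⟨ conv-h-h n ⟩
  1/ n !
    ≡⟨ ∂-! n ⟨
  ι (suc n) ℚ.* 1/ suc n ! ∎)
  where open ≡-Reasoning

H : ℕ → ℚ
H = psum h

-- The tail bound of `h` is `h` itself up to the factor 2, so the error in `conv-product` is again a
-- coefficient of exp (x / 2) squared.
H²-near : ∀ n → ∣ H n ℚ.* H n ℚ.- expSum n ∣ ℚ.≤ ι 2 ℚ.* 1/ n !
H²-near n = subst₂ ℚ._≤_
  (cong (λ z → ∣ H n ℚ.* H n ℚ.- z ∣) (trans (psum-cong conv-h-h n) (psum-! n)))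
  (trans (conv-*ˡ (ι 2) h h n) (cong (ι 2 ℚ.*_) (conv-h-h n)))
  (conv-product (λ k → *-nonNeg (0≤ι 2) (h≥0 k)) h≥0 psum-h-tail n)

-- The hypothesis reads a′ = (r + x) a, and multiplication by exp x raises r by 1. It is applied to
-- `c` with r = - 1 and to `T` with r = 1.
∂-conv-! : ∀ {a r} → (∀ k → ∂ a k ≡ r ℚ.* a k ℚ.+ delay a k) → ∀ n →
  ∂ (conv a 1/_!) n ≡ (r ℚ.+ 1ℚ) ℚ.* conv a 1/_! n ℚ.+ delay (conv a 1/_!) n
∂-conv-! {a} {r} ∂-a n = begin
  ∂ X n
    ≡⟨ leibniz a 1/_! n ⟩
  conv (∂ a) 1/_! n ℚ.+ conv a (∂ 1/_!) n
    ≡⟨ cong₂ ℚ._+_ (conv-congˡ 1/_! ∂-a n) (conv-congʳ a ∂-! n) ⟩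
  conv (λ k → r ℚ.* a k ℚ.+ delay a k) 1/_! n ℚ.+ X n
    ≡⟨ cong (ℚ._+ X n) (trans (conv-+ˡ (λ k → r ℚ.* a k) (delay a) 1/_! n)
         (cong₂ ℚ._+_ (conv-*ˡ r a 1/_! n) (conv-delayˡ a 1/_! n))) ⟩
  r ℚ.* X n ℚ.+ delay X n ℚ.+ X n
    ≡⟨ solve 3 (λ r x y → r :* x :+ y :+ x := (r :+ con 1ℚ) :* x :+ y) refl r (X n) (delay X n) ⟩
  (r ℚ.+ 1ℚ) ℚ.* X n ℚ.+ delay X n ∎
  where
  open ≡-Reasoning
  X = conv a 1/_!

-- exp (- x + x² / 2) * exp x = exp (x² / 2).
X : ℕ → ℚ
X = conv c 1/_!

∂-X : ∀ k → ∂ X k ≡ delay X k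
∂-X k = trans (∂-conv-! {c} {ℚ.- 1ℚ} ∂-c k)
  (solve 2 (λ x y → con 0ℚ :* x :+ y := y) refl (X k) (delay X k))

-- The equation X′ = x X links coefficients two apart, so the parities decouple. The odd ones start
-- from 0; the even ones obey the recurrence of `h`, since 2 (k + 1) X(2 k + 2) = X(2 k).
X-odd-even : ∀ k → X (k ℕ.+ k) ≡ h k × X (suc (k ℕ.+ k)) ≡ 0ℚ
X-odd-even zero    = refl , refl
X-odd-even (suc k) rewrite ℕ.+-suc k k = even , odd
  where
  open ≡-Reasoning
  m = k ℕ.+ k
  even : X (suc (suc m)) ≡ h (suc k)
  even = ι-cancel-≡ (suc m) (begin
    ∂ X (suc m)
      ≡⟨ ∂-X (suc m) ⟩
    X m
      ≡⟨ proj₁ (X-odd-even k) ⟩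
    h k
      ≡⟨ halves (h k) ⟨
    ½ ℚ.* h k ℚ.+ ½ ℚ.* h k
      ≡⟨ cong₂ ℚ._+_ (∂-h k) (∂-h k) ⟨
    ι (suc k) ℚ.* h (suc k) ℚ.+ ι (suc k) ℚ.* h (suc k)
      ≡⟨ ℚ.*-distribʳ-+ (h (suc k)) (ι (suc k)) (ι (suc k)) ⟨
    (ι (suc k) ℚ.+ ι (suc k)) ℚ.* h (suc k)
      ≡⟨ cong (ℚ._* h (suc k)) (trans (sym (ι-+ (suc k) (suc k))) (cong (ι ∘ suc) (ℕ.+-suc k k))) ⟩
    ι (suc (suc m)) ℚ.* h (suc k) ∎)
  odd : X (suc (suc (suc m))) ≡ 0ℚ
  odd = ι-cancel-≡ (suc (suc m)) (begin
    ∂ X (suc (suc m))                  ≡⟨ ∂-X (suc (suc m)) ⟩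
    X (suc m)                          ≡⟨ proj₂ (X-odd-even k) ⟩
    0ℚ                                 ≡⟨ ℚ.*-zeroʳ (ι (suc (suc (suc m)))) ⟨
    ι (suc (suc (suc m))) ℚ.* 0ℚ       ∎)

-- Up to index 2 k the series in x² / 2 has used exactly k of its terms. This is why `c` is summed
-- to doubled indices in what follows.
psum-X : ∀ k → psum X (k ℕ.+ k) ≡ H k
psum-X zero    = refl
psum-X (suc k) rewrite ℕ.+-suc k k = trans
  (cong₂ ℚ._+_ (cong₂ ℚ._+_ (psum-X k) (proj₁ (X-odd-even k))) (proj₂ (X-odd-even k)))
  (ℚ.+-identityʳ (H k ℚ.+ h k))

-- Coefficients of exp (2 x + x² / 2), which bound the error in multiplying the
-- partial sums of c and 1/_!.
G : ℕ → ℚ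
G = conv T 1/_!

∂-G : ∀ k → ∂ G k ≡ ι 2 ℚ.* G k ℚ.+ delay G k
∂-G = ∂-conv-! {T} {1ℚ} λ k → trans (∂-T k) (cong (ℚ._+ delay T k) (sym (ℚ.*-identityˡ (T k))))

-- If the two preceding coefficients are at most C, then `∂ G k` is at most 3 C, so the next one is
-- at most C once it is divided by 3 or more. The constant 3 therefore has to be checked only for
-- the initial values 1, 2 and 5 / 2. The companion bound 9 also gives the decay in `G-small`.
G≤3 : ∀ k → G k ℚ.≤ ι 3
∂-G≤9 : ∀ k → ∂ G k ℚ.≤ ι 9

∂-G≤9 k = begin
  ∂ G k                        ≡⟨ ∂-G k ⟩
  ι 2 ℚ.* G k ℚ.+ delay G k    ≤⟨ ℚ.+-mono-≤ (ℚ.*-monoˡ-≤-nonNeg (ι 2) (G≤3 k)) (delay≤ k) ⟩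
  ι 2 ℚ.* ι 3 ℚ.+ ι 3          ∎
  where
  open ℚ.≤-Reasoning
  delay≤ : ∀ k → delay G k ℚ.≤ ι 3
  delay≤ zero    = 0≤ι 3
  delay≤ (suc k) = G≤3 k

G≤3 zero                = ι-mono {1} {3} (ℕ.s≤s ℕ.z≤n)
G≤3 (suc zero)          = ι-mono {2} {3} (ℕ.s≤s (ℕ.s≤s ℕ.z≤n))
G≤3 (suc (suc zero))    = ι-cancel-≤ 1 (begin
  ∂ G 1         ≡⟨⟩
  ι 5           ≤⟨ ι-mono {5} {6} (ℕ.n≤1+n 5) ⟩
  ι 2 ℚ.* ι 3   ∎)
  where open ℚ.≤-Reasoning
G≤3 (suc (suc (suc k))) = ι-cancel-≤ (suc (suc k)) (begin
  ∂ G (suc (suc k))             ≤⟨ ∂-G≤9 (suc (suc k)) ⟩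
  ι 3 ℚ.* ι 3                   ≤⟨ ℚ.*-monoʳ-≤-nonNeg (ι 3) (ι-mono {3} {3 ℕ.+ k} (ℕ.m≤m+n 3 k)) ⟩
  ι (suc (suc (suc k))) ℚ.* ι 3 ∎)
  where open ℚ.≤-Reasoning

G-small : ∀ k → G (suc k) ℚ.≤ ι 9 ℚ.* (+ 1 / suc k)
G-small k = ι-cancel-≤ k (ℚ.≤-trans (∂-G≤9 k) (ℚ.≤-reflexive (sym (ι-/ (ι 9) k))))

psum-c-expSum : ∀ k → ∣ psum c (k ℕ.+ k) ℚ.* expSum (k ℕ.+ k) ℚ.- H k ∣ ℚ.≤ G (k ℕ.+ k)
psum-c-expSum k = subst₂ (λ x y → ∣ psum c (k ℕ.+ k) ℚ.* x ℚ.- y ∣ ℚ.≤ G (k ℕ.+ k))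
  (psum-! (k ℕ.+ k)) (psum-X k)
  (conv-product T≥0 1/!≥0 psum-c-tail (k ℕ.+ k))

-- Convergence to 1 / √e

infix 4 _≈_

-- Neither sequence is required to converge; between the approximations of two reals this amounts to
-- `_≃_`.
record _≈_ (a b : ℕ → ℚ) : Set where
  constructor closeness
  field
    close : ∀ ε → 0ℚ ℚ.< ε → ∃ λ N → ∀ n → N ℕ.≤ n → ∣ a n ℚ.- b n ∣ ℚ.≤ ε

open _≈_ using (close)

∣-∣-sym : ∀ p q → ∣ p ℚ.- q ∣ ≡ ∣ q ℚ.- p ∣
∣-∣-sym p q = trans (sym (ℚ.∣-p∣≡∣p∣ (p ℚ.- q)))
  (cong ∣_∣ (solve 2 (λ p q → :- (p :+ :- q) := q :+ :- p) refl p q))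

∣-∣-triangle : ∀ p q r → ∣ p ℚ.- r ∣ ℚ.≤ ∣ p ℚ.- q ∣ ℚ.+ ∣ q ℚ.- r ∣
∣-∣-triangle p q r = subst (ℚ._≤ ∣ p ℚ.- q ∣ ℚ.+ ∣ q ℚ.- r ∣)
  (cong ∣_∣ (solve 3 (λ p q r → (p :+ :- q) :+ (q :+ :- r) := p :+ :- r) refl p q r))
  (ℚ.∣p+q∣≤∣p∣+∣q∣ (p ℚ.- q) (q ℚ.- r))

≈-sym : ∀ {a b} → a ≈ b → b ≈ a
≈-sym {a} {b} a≈b = closeness λ ε 0<ε → let N , a-b = close a≈b ε 0<ε in
  N , λ n N≤n → subst (ℚ._≤ ε) (∣-∣-sym (a n) (b n)) (a-b n N≤n)

≈-trans : ∀ {a b c} → a ≈ b → b ≈ c → a ≈ c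
≈-trans {a} {b} {c} a≈b b≈c = closeness λ ε 0<ε →
  let M , a-b = close a≈b (½ ℚ.* ε) (0<half 0<ε)
      N , b-c = close b≈c (½ ℚ.* ε) (0<half 0<ε)
  in M ℕ.⊔ N , λ n ≤n → begin
    ∣ a n ℚ.- c n ∣
      ≤⟨ ∣-∣-triangle (a n) (b n) (c n) ⟩
    ∣ a n ℚ.- b n ∣ ℚ.+ ∣ b n ℚ.- c n ∣
      ≤⟨ ℚ.+-mono-≤ (a-b n (ℕ.m⊔n≤o⇒m≤o M N ≤n)) (b-c n (ℕ.m⊔n≤o⇒n≤o M N ≤n)) ⟩
    ½ ℚ.* ε ℚ.+ ½ ℚ.* ε
      ≡⟨ halves ε ⟩
    ε ∎
  where open ℚ.≤-Reasoning

≈-rate : ∀ {a b} C → 0ℚ ℚ.< C →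
  (∀ n → ∣ a (suc n) ℚ.- b (suc n) ∣ ℚ.≤ C ℚ.* (+ 1 / suc n)) → a ≈ b
≈-rate {a} {b} C 0<C rate = closeness λ ε 0<ε →
  let δ , 0<δ , δC≡ε = split C 0<C ε 0<ε
      N , small = archimedean δ 0<δ
  in suc N , λ { (suc n) (ℕ.s≤s N≤n) → begin
    ∣ a (suc n) ℚ.- b (suc n) ∣  ≤⟨ rate n ⟩
    C ℚ.* (+ 1 / suc n)          ≤⟨ ℚ.*-monoˡ-≤-nonNeg C {{ℚ.nonNegative (ℚ.<⇒≤ 0<C)}} (small n N≤n) ⟩
    C ℚ.* δ                      ≡⟨ trans (ℚ.*-comm C δ) δC≡ε ⟩
    ε                            ∎ }
  where open ℚ.≤-Reasoning

≈-dominated : ∀ {a b a′ b′} C → 0ℚ ℚ.< C →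
  (∀ n → ∣ a′ (suc n) ℚ.- b′ (suc n) ∣ ℚ.≤ C ℚ.* ∣ a (suc n) ℚ.- b (suc n) ∣) →
  a ≈ b → a′ ≈ b′
≈-dominated {a} {b} {a′} {b′} C 0<C dominated a≈b = closeness λ ε 0<ε →
  let δ , 0<δ , δC≡ε = split C 0<C ε 0<ε
      N , a-b = close a≈b δ 0<δ
  in suc N , λ { (suc n) (ℕ.s≤s N≤n) → begin
    ∣ a′ (suc n) ℚ.- b′ (suc n) ∣     ≤⟨ dominated n ⟩
    C ℚ.* ∣ a (suc n) ℚ.- b (suc n) ∣ ≤⟨ ℚ.*-monoˡ-≤-nonNeg C {{ℚ.nonNegative (ℚ.<⇒≤ 0<C)}}
                                           (a-b (suc n) (ℕ.m≤n⇒m≤1+n N≤n)) ⟩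
    C ℚ.* δ                           ≡⟨ trans (ℚ.*-comm C δ) δC≡ε ⟩
    ε                                 ∎ }
  where open ℚ.≤-Reasoning

≈-*ˡ : ∀ {a b} (f : ℕ → ℚ) C → 0ℚ ℚ.< C → (∀ n → ∣ f n ∣ ℚ.≤ C) → a ≈ b →
  (λ n → f n ℚ.* a n) ≈ (λ n → f n ℚ.* b n)
≈-*ˡ {a} {b} f C 0<C f≤C = ≈-dominated C 0<C λ n → let m = suc n in begin
  ∣ f m ℚ.* a m ℚ.- f m ℚ.* b m ∣
    ≡⟨ cong ∣_∣ (solve 3 (λ f a b → f :* a :+ :- (f :* b) := f :* (a :+ :- b)) refl (f m) (a m) (b m)) ⟩
  ∣ f m ℚ.* (a m ℚ.- b m) ∣
    ≡⟨ ℚ.∣p*q∣≡∣p∣*∣q∣ (f m) (a m ℚ.- b m) ⟩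
  ∣ f m ∣ ℚ.* ∣ a m ℚ.- b m ∣
    ≤⟨ ℚ.*-monoʳ-≤-nonNeg ∣ a m ℚ.- b m ∣ {{ℚ.nonNegative (ℚ.0≤∣p∣ (a m ℚ.- b m))}} (f≤C m) ⟩
  C ℚ.* ∣ a m ℚ.- b m ∣ ∎
  where open ℚ.≤-Reasoning

-- The factor p + q of p² - q² is at least ½, so dividing by it costs at most a factor 2.
≈-square-cancel : ∀ {a b} → (∀ n → 0ℚ ℚ.≤ a (suc n)) → (∀ n → ½ ℚ.≤ b (suc n)) →
  (λ n → a n ℚ.* a n) ≈ (λ n → b n ℚ.* b n) → a ≈ b
≈-square-cancel {a} {b} 0≤a ½≤b = ≈-dominated (ι 2) (0<ι 2)
  λ n → bound (0≤a n) (½≤b n)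
  where
  open ℚ.≤-Reasoning
  bound : ∀ {p q} → 0ℚ ℚ.≤ p → ½ ℚ.≤ q → ∣ p ℚ.- q ∣ ℚ.≤ ι 2 ℚ.* ∣ p ℚ.* p ℚ.- q ℚ.* q ∣
  bound {p} {q} 0≤p ½≤q = begin
    ∣ p ℚ.- q ∣
      ≡⟨ solve 1 (λ x → x := con (ι 2) :* (con ½ :* x)) refl ∣ p ℚ.- q ∣ ⟩
    ι 2 ℚ.* (½ ℚ.* ∣ p ℚ.- q ∣)
      ≤⟨ ℚ.*-monoˡ-≤-nonNeg (ι 2) (ℚ.*-monoʳ-≤-nonNeg ∣ p ℚ.- q ∣ {{ℚ.nonNegative (ℚ.0≤∣p∣ (p ℚ.- q))}} ½≤p+q) ⟩
    ι 2 ℚ.* ((p ℚ.+ q) ℚ.* ∣ p ℚ.- q ∣)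
      ≡⟨ cong (λ z → ι 2 ℚ.* (z ℚ.* ∣ p ℚ.- q ∣)) (ℚ.0≤p⇒∣p∣≡p 0≤p+q) ⟨
    ι 2 ℚ.* (∣ p ℚ.+ q ∣ ℚ.* ∣ p ℚ.- q ∣)
      ≡⟨ cong (ι 2 ℚ.*_) (ℚ.∣p*q∣≡∣p∣*∣q∣ (p ℚ.+ q) (p ℚ.- q)) ⟨
    ι 2 ℚ.* ∣ (p ℚ.+ q) ℚ.* (p ℚ.- q) ∣
      ≡⟨ cong (λ z → ι 2 ℚ.* ∣ z ∣) (solve 2 (λ p q → (p :+ q) :* (p :+ :- q) := p :* p :+ :- (q :* q)) refl p q) ⟩
    ι 2 ℚ.* ∣ p ℚ.* p ℚ.- q ℚ.* q ∣ ∎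
    where
    ½≤p+q : ½ ℚ.≤ p ℚ.+ q
    ½≤p+q = ℚ.+-mono-≤ 0≤p ½≤q
    0≤p+q : 0ℚ ℚ.≤ p ℚ.+ q
    0≤p+q = ℚ.≤-trans (ℚ.nonNegative⁻¹ ½) ½≤p+q

-- The clamped root inverted by the reciprocal in 1/√e.
s : ℕ → ℚ
s k = ½ ℚ.⊔ approx (√ e) k

½≤s : ∀ k → ½ ℚ.≤ s k
½≤s k = ℚ.p≤p⊔q ½ (approx (√ e) k)

0<s : ∀ k → 0ℚ ℚ.< s k
0<s k = ℚ.<-≤-trans (ℚ.positive⁻¹ ½) (½≤s k)

v : ℕ → ℚ
v = approx 1/√e

v*s : ∀ k → v k ℚ.* s k ≡ 1ℚ
v*s k = ℚ.*-inverseˡ (s k) {{ℚ.pos⇒nonZero (s k) {{ℚ.positive (0<s k)}}}}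

0≤v : ∀ k → 0ℚ ℚ.≤ v k
0≤v k = *-cancelʳ-≤ (s k) (0<s k)
  (subst₂ ℚ._≤_ (sym (ℚ.*-zeroˡ (s k))) (sym (v*s k)) (ℚ.<⇒≤ 0<1))

v≤2 : ∀ k → v k ℚ.≤ ι 2
v≤2 k = *-cancelʳ-≤ (s k) (0<s k)
  (subst (ℚ._≤ ι 2 ℚ.* s k) (sym (v*s k)) (ℚ.*-monoˡ-≤-nonNeg (ι 2) (½≤s k)))

expSum≤3 : ∀ k → expSum (suc k) ℚ.≤ ι 3
expSum≤3 k = ℚ.≤-trans
  (≤+ (expSum (suc k)) (ℚ.+-mono-≤ (1/!≥0 (suc k)) (1/!≥0 (suc k))))
  (expUpper-anti {1} {suc k} ℕ.≤-refl (ℕ.s≤s ℕ.z≤n))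

1≤expSum : ∀ k → 1ℚ ℚ.≤ expSum (suc k)
1≤expSum k = expSum-mono {1} {suc k} (ℕ.s≤s ℕ.z≤n)

-- A root t rounded down with gap g has a square that falls short by at most (t + t + g) g, and t ≤
-- 2 and g ≤ 1 give 5 = 2 + 2 + 1.
s²≈expSum : (λ k → s k ℚ.* s k) ≈ expSum
s²≈expSum = ≈-rate (ι 5) (0<ι 5) λ n → rate n
  where
  open ℚ.≤-Reasoning
  module _ (n : ℕ) where
    k = suc n
    q = 0ℚ ℚ.⊔ expSum k
    q≡ : q ≡ expSum k
    q≡ = ℚ.p≤q⇒p⊔q≡q (ℚ.≤-trans (ℚ.<⇒≤ 0<1) (1≤expSum n))
    module R = RootLemmas q (ℚ.p≤p⊔q 0ℚ (expSum k)) k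
    t = root q k
    g = rootGap q k
    0<half≤t : ½ ℚ.≤ t
    0<half≤t = proj₂ (proj₂ (proj₂ √e>0)) k (ℕ.s≤s ℕ.z≤n)
    s≡t : s k ≡ t
    s≡t = ℚ.p≤q⇒p⊔q≡q 0<half≤t
    t≤2 : t ℚ.≤ ι 2
    t≤2 = square-cancel-≤ (0≤ι 2) (begin
      t ℚ.* t     ≤⟨ R.root²≤ ⟩
      q           ≡⟨ q≡ ⟩
      expSum k    ≤⟨ expSum≤3 n ⟩
      ι 3         ≤⟨ ι-mono {3} {4} (ℕ.n≤1+n 3) ⟩
      ι 2 ℚ.* ι 2 ∎)
    g≤1 : g ℚ.≤ 1ℚ
    g≤1 = ℚ.≤-trans R.rootGap≤ (unit-anti {1} {suc k} (ℕ.s≤s ℕ.z≤n))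
    ε = ι 5 ℚ.* (+ 1 / suc n)
    rate : ∣ s k ℚ.* s k ℚ.- expSum k ∣ ℚ.≤ ε
    rate = subst₂ (λ x y → ∣ x ℚ.* x ℚ.- y ∣ ℚ.≤ ε) (sym s≡t) q≡ (∣-∣-intro
      (ℚ.≤-trans R.root²≤ (≤+ q (*-nonNeg (0≤ι 5) (0≤frac 1 (suc n)))))
      (begin
        q
          ≤⟨ R.≤[root+gap]² ⟩
        (t ℚ.+ g) ℚ.* (t ℚ.+ g)
          ≡⟨ solve 2 (λ t g → (t :+ g) :* (t :+ g) := t :* t :+ (t :+ t :+ g) :* g) refl t g ⟩
        t ℚ.* t ℚ.+ (t ℚ.+ t ℚ.+ g) ℚ.* g
          ≤⟨ ℚ.+-monoʳ-≤ (t ℚ.* t) (*-mono-≤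
               (ℚ.+-mono-≤ (ℚ.+-mono-≤ R.root≥0 R.root≥0) R.rootGap≥0) (0≤frac 1 (suc n))
               (ℚ.+-mono-≤ (ℚ.+-mono-≤ t≤2 t≤2) g≤1)
               (ℚ.≤-trans R.rootGap≤ (unit-anti {suc n} {suc k} (ℕ.n≤1+n (suc n))))) ⟩
        t ℚ.* t ℚ.+ ε ∎))

H²≈expSum : (λ k → H k ℚ.* H k) ≈ expSum
H²≈expSum = ≈-rate (ι 2) (0<ι 2) λ n → ℚ.≤-trans (H²-near (suc n))
  (ℚ.*-monoˡ-≤-nonNeg (ι 2) (1/!≤ n))

H≈s : H ≈ s
H≈s = ≈-square-cancel (λ n → psum-mono h≥0 {0} {suc n} ℕ.z≤n) (λ n → ½≤s (suc n))
  (≈-trans H²≈expSum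
    (≈-sym s²≈expSum))

u : ℕ → ℚ
u k = psum c (k ℕ.+ k)

∣u∣≤1 : ∀ k → ∣ u k ∣ ℚ.≤ 1ℚ
∣u∣≤1 k = subst (λ z → ∣ z ∣ ℚ.≤ 1ℚ) (ℚ.+-identityʳ (u k)) (psum-c-tail {0} {k ℕ.+ k} ℕ.z≤n)

u*expSum≈H : (λ k → u k ℚ.* expSum (k ℕ.+ k)) ≈ H
u*expSum≈H = ≈-rate (ι 9) (0<ι 9) λ n → begin
  ∣ u (suc n) ℚ.* expSum (suc n ℕ.+ suc n) ℚ.- H (suc n) ∣
    ≤⟨ psum-c-expSum (suc n) ⟩
  G (suc (n ℕ.+ suc n))
    ≤⟨ G-small (n ℕ.+ suc n) ⟩
  ι 9 ℚ.* (+ 1 / suc (n ℕ.+ suc n))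
    ≤⟨ ℚ.*-monoˡ-≤-nonNeg (ι 9) (unit-anti (ℕ.s≤s (ℕ.m≤m+n n (suc n)))) ⟩
  ι 9 ℚ.* (+ 1 / suc n) ∎
  where open ℚ.≤-Reasoning

expSum-double≈ : (λ k → expSum (k ℕ.+ k)) ≈ expSum
expSum-double≈ = closeness λ ε 0<ε → let N , near = cauchy e ε 0<ε in
  N , λ n N≤n → near (n ℕ.+ n) n (ℕ.≤-trans N≤n (ℕ.m≤m+n n n)) N≤n

-- u s² ≈ u e ≈ H ≈ s, and division by s² gives u ≈ 1 / s = v.
u≈v : u ≈ v
u≈v = subst₂-≈ (≈-*ˡ (λ k → v k ℚ.* v k) (ι 4) (0<ι 4) v²≤4 us²≈s)
  where
  open ℚ.≤-Reasoning
  v²≤4 : ∀ k → ∣ v k ℚ.* v k ∣ ℚ.≤ ι 4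
  v²≤4 k = subst (ℚ._≤ ι 4) (sym (ℚ.0≤p⇒∣p∣≡p (*-nonNeg (0≤v k) (0≤v k))))
    (*-mono-≤ (0≤v k) (0≤ι 2) (v≤2 k) (v≤2 k))
  s²≈ : (λ k → s k ℚ.* s k) ≈ (λ k → expSum (k ℕ.+ k))
  s²≈ = ≈-trans s²≈expSum
    (≈-sym expSum-double≈)
  us²≈s : (λ k → u k ℚ.* (s k ℚ.* s k)) ≈ s
  us²≈s = ≈-trans
    (≈-*ˡ u 1ℚ 0<1 ∣u∣≤1 s²≈)
    (≈-trans u*expSum≈H H≈s)
  left : ∀ k → (v k ℚ.* v k) ℚ.* (u k ℚ.* (s k ℚ.* s k)) ≡ u k
  left k = trans
    (solve 3 (λ v u s → (v :* v) :* (u :* (s :* s)) := u :* ((v :* s) :* (v :* s))) refl (v k) (u k) (s k))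
    (trans (cong (λ z → u k ℚ.* (z ℚ.* z)) (v*s k)) (ℚ.*-identityʳ (u k)))
  right : ∀ k → (v k ℚ.* v k) ℚ.* s k ≡ v k
  right k = trans (ℚ.*-assoc (v k) (v k) (s k)) (trans (cong (v k ℚ.*_) (v*s k)) (ℚ.*-identityʳ (v k)))
  subst₂-≈ : (λ k → (v k ℚ.* v k) ℚ.* (u k ℚ.* (s k ℚ.* s k))) ≈ (λ k → (v k ℚ.* v k) ℚ.* s k) → u ≈ v
  subst₂-≈ a≈b = closeness λ ε 0<ε → let N , a-b = close a≈b ε 0<ε in
    N , λ n N≤n → subst₂ (λ x y → ∣ x ℚ.- y ∣ ℚ.≤ ε) (left n) (right n) (a-b n N≤n)

psum-c-near : ∀ n ε → 0ℚ ℚ.< ε → ∃ λ N → ∀ k → N ℕ.≤ k → ∣ psum c n ℚ.- v k ∣ ℚ.≤ T n ℚ.+ ε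
psum-c-near n ε 0<ε = let N , u-v = close u≈v ε 0<ε in
  N ℕ.⊔ n , λ k ≤k → ℚ.≤-trans (∣-∣-triangle (psum c n) (u k) (v k)) (ℚ.+-mono-≤
    (subst (ℚ._≤ T n) (∣-∣-sym (u k) (psum c n))
      (psum-c-tail (ℕ.≤-trans (ℕ.m⊔n≤o⇒n≤o N n ≤k) (ℕ.m≤m+n k k))))
    (u-v k (ℕ.m⊔n≤o⇒m≤o N n ≤k)))

-- Arrival orders

∑ : ∀ {A : Set} → List A → (A → ℚ) → ℚ
∑ []       f = 0ℚ
∑ (x ∷ xs) f = f x ℚ.+ ∑ xs f

module _ {A : Set} where

  ∑-cong : ∀ (xs : List A) {f g} → (∀ {x} → x ∈ xs → f x ≡ g x) → ∑ xs f ≡ ∑ xs g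
  ∑-cong []       f≗g = refl
  ∑-cong (x ∷ xs) f≗g = cong₂ ℚ._+_ (f≗g (here refl)) (∑-cong xs (f≗g ∘ there))

  ∑-++ : ∀ (xs ys : List A) f → ∑ (xs ++ ys) f ≡ ∑ xs f ℚ.+ ∑ ys f
  ∑-++ []       ys f = sym (ℚ.+-identityˡ (∑ ys f))
  ∑-++ (x ∷ xs) ys f = trans (cong (f x ℚ.+_) (∑-++ xs ys f))
    (sym (ℚ.+-assoc (f x) (∑ xs f) (∑ ys f)))

  ∑-+ : ∀ (xs : List A) f g → ∑ xs (λ x → f x ℚ.+ g x) ≡ ∑ xs f ℚ.+ ∑ xs g
  ∑-+ []       f g = refl
  ∑-+ (x ∷ xs) f g = trans (cong (f x ℚ.+ g x ℚ.+_) (∑-+ xs f g))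
    (solve 4 (λ a b c d → (a :+ b) :+ (c :+ d) := (a :+ c) :+ (b :+ d)) refl
      (f x) (g x) (∑ xs f) (∑ xs g))

  ∑-*ˡ : ∀ (xs : List A) r f → ∑ xs (λ x → r ℚ.* f x) ≡ r ℚ.* ∑ xs f
  ∑-*ˡ []       r f = sym (ℚ.*-zeroʳ r)
  ∑-*ˡ (x ∷ xs) r f = trans (cong (r ℚ.* f x ℚ.+_) (∑-*ˡ xs r f))
    (sym (ℚ.*-distribˡ-+ r (f x) (∑ xs f)))

  ∑-const : ∀ (xs : List A) r → ∑ xs (λ _ → r) ≡ ι (length xs) ℚ.* r
  ∑-const []       r = sym (ℚ.*-zeroˡ r)
  ∑-const (x ∷ xs) r = begin
    r ℚ.+ ∑ xs (λ _ → r)          ≡⟨ cong (r ℚ.+_) (∑-const xs r) ⟩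
    r ℚ.+ ι (length xs) ℚ.* r     ≡⟨ solve 2 (λ r i → r :+ i :* r := (i :+ con 1ℚ) :* r) refl r (ι (length xs)) ⟩
    (ι (length xs) ℚ.+ 1ℚ) ℚ.* r  ≡⟨ cong (ℚ._* r) (ι-suc (length xs)) ⟨
    ι (suc (length xs)) ℚ.* r     ∎
    where open ≡-Reasoning

  ∑-map : ∀ {B : Set} (g : B → A) xs f → ∑ (map g xs) f ≡ ∑ xs (f ∘ g)
  ∑-map g []       f = refl
  ∑-map g (x ∷ xs) f = cong (f (g x) ℚ.+_) (∑-map g xs f)

  ∑-concatMap : ∀ {B : Set} (g : B → List A) xs f → ∑ (concatMap g xs) f ≡ ∑ xs (λ x → ∑ (g x) f)
  ∑-concatMap g []       f = refl
  ∑-concatMap g (x ∷ xs) f = trans (∑-++ (g x) (concatMap g xs) f)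
    (cong (∑ (g x) f ℚ.+_) (∑-concatMap g xs f))

∑-swap : ∀ {A B : Set} (xs : List A) (ys : List B) (f : A → B → ℚ) →
  ∑ xs (λ x → ∑ ys (f x)) ≡ ∑ ys (λ y → ∑ xs (λ x → f x y))
∑-swap []       ys f = sym (trans (∑-const ys 0ℚ) (ℚ.*-zeroʳ (ι (length ys))))
∑-swap (x ∷ xs) ys f = trans (cong (∑ ys (f x) ℚ.+_) (∑-swap xs ys f))
  (sym (∑-+ ys (f x) (λ y → ∑ xs (λ x → f x y))))

∑-applyUpTo : ∀ {A : Set} (g : ℕ → A) n f → ∑ (applyUpTo g n) f ≡ psum (f ∘ g) n
∑-applyUpTo g zero    f = refl
∑-applyUpTo g (suc n) f = trans (cong (f (g 0) ℚ.+_) (∑-applyUpTo (g ∘ suc) n f))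
  (sym (psum-suc (f ∘ g) n))

𝟙 : ∀ {P : Set} → Dec P → ℚ
𝟙 (yes _) = 1ℚ
𝟙 (no  _) = 0ℚ

𝟙-yes : ∀ {P : Set} (d : Dec P) → P → 𝟙 d ≡ 1ℚ
𝟙-yes (yes _) p = refl
𝟙-yes (no ¬p) p = contradiction p ¬p

𝟙-no : ∀ {P : Set} (d : Dec P) → ¬ P → 𝟙 d ≡ 0ℚ
𝟙-no (yes p) ¬p = contradiction p ¬p
𝟙-no (no _)  ¬p = refl

𝟙-cong : ∀ {P P′ : Set} (d : Dec P) (d′ : Dec P′) → (P → P′) → (P′ → P) → 𝟙 d ≡ 𝟙 d′
𝟙-cong (yes p) d′ to from = sym (𝟙-yes d′ (to p))
𝟙-cong (no ¬p) d′ to from = sym (𝟙-no d′ (¬p ∘ from))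

𝟙-¬ : ∀ {P P′ : Set} (d : Dec P) (d′ : Dec P′) → (P → ¬ P′) → (¬ P′ → P) → 𝟙 d ≡ 1ℚ ℚ.- 𝟙 d′
𝟙-¬ d (yes p′) to from = 𝟙-no d (λ p → to p p′)
𝟙-¬ d (no ¬p′) to from = 𝟙-yes d (from ¬p′)

∑-𝟙-∉ : ∀ {xs k} (z : ℚ) → k ∉ xs → ∑ xs (λ j → 𝟙 (j ℕ.≟ k) ℚ.* z) ≡ 0ℚ
∑-𝟙-∉ {[]}     z k∉ = refl
∑-𝟙-∉ {x ∷ xs} {k} z k∉ = trans
  (cong₂ ℚ._+_ (trans (cong (ℚ._* z) (𝟙-no (x ℕ.≟ k) (λ x≡k → k∉ (here (sym x≡k))))) (ℚ.*-zeroˡ z))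
    (∑-𝟙-∉ z (k∉ ∘ there)))
  (ℚ.+-identityˡ 0ℚ)

∑-𝟙-∈ : ∀ {xs k} (z : ℚ) → Unique xs → k ∈ xs → ∑ xs (λ j → 𝟙 (j ℕ.≟ k) ℚ.* z) ≡ z
∑-𝟙-∈ {k ∷ xs} z unq (here refl) = trans
  (cong₂ ℚ._+_ (trans (cong (ℚ._* z) (𝟙-yes (k ℕ.≟ k) refl)) (ℚ.*-identityˡ z))
    (∑-𝟙-∉ z (Unique.Unique[x∷xs]⇒x∉xs unq)))
  (ℚ.+-identityʳ z)
∑-𝟙-∈ {x ∷ xs} {k} z (x∉ ∷ unq) (there k∈) = trans
  (cong₂ ℚ._+_ (trans (cong (ℚ._* z) (𝟙-no (x ℕ.≟ k) (All.lookup x∉ k∈))) (ℚ.*-zeroˡ z))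
    (∑-𝟙-∈ z unq k∈))
  (ℚ.+-identityˡ z)

remove : ℕ → List ℕ → List ℕ
remove j = filter (λ k → ¬? (k ℕ.≟ j))

∈-remove⁺ : ∀ {j k xs} → k ∈ xs → k ≢ j → k ∈ remove j xs
∈-remove⁺ {j} = ∈-filter⁺ (λ k → ¬? (k ℕ.≟ j))

∈-remove⁻ : ∀ {j k xs} → k ∈ remove j xs → k ∈ xs × k ≢ j
∈-remove⁻ {j} = ∈-filter⁻ (λ k → ¬? (k ℕ.≟ j))

∉-remove : ∀ {j xs} → j ∉ remove j xs
∉-remove {j} {xs} j∈ = proj₂ (∈-remove⁻ {j} {j} {xs} j∈) refl

remove-unique : ∀ {j xs} → Unique xs → Unique (remove j xs)
remove-unique {j} = Unique.filter⁺ (λ k → ¬? (k ℕ.≟ j))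

remove-∷-≡ : ∀ {x xs} → x ∉ xs → remove x (x ∷ xs) ≡ xs
remove-∷-≡ {x} {xs} x∉ = trans
  (List.filter-reject (λ k → ¬? (k ℕ.≟ x)) (λ x≢x → x≢x refl))
  (List.filter-all (λ k → ¬? (k ℕ.≟ x)) (All.tabulate λ k∈ k≡x → x∉ (subst (_∈ xs) k≡x k∈)))

remove-∷-≢ : ∀ {j x xs} → x ≢ j → remove j (x ∷ xs) ≡ x ∷ remove j xs
remove-∷-≢ {j} = List.filter-accept (λ k → ¬? (k ℕ.≟ j))

length-remove : ∀ {j xs} → Unique xs → j ∈ xs → suc (length (remove j xs)) ≡ length xs
length-remove {j} {_ ∷ xs} unq (here refl) =
  cong (suc ∘ length) (remove-∷-≡ (Unique.Unique[x∷xs]⇒x∉xs unq))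
length-remove {j} {x ∷ xs} (x∉ ∷ unq) (there j∈) = trans
  (cong (suc ∘ length) (remove-∷-≢ {j} {x} {xs} (All.lookup x∉ j∈)))
  (cong suc (length-remove unq j∈))

-- `permutations` inserts the head of the list, whereas the argument conditions on the last arrival.
-- An insertion either leaves j last or puts x behind it.
∑-insertions-∷ʳ : ∀ {A : Set} (x : A) τ j f →
  ∑ (insertions x (τ ∷ʳ j)) f ≡ ∑ (insertions x τ) (λ σ → f (σ ∷ʳ j)) ℚ.+ f (τ ∷ʳ j ∷ʳ x)
∑-insertions-∷ʳ x []      j f = solve 2 (λ a b → a :+ (b :+ con 0ℚ) := (a :+ con 0ℚ) :+ b) refl
  (f (x ∷ j ∷ [])) (f (j ∷ x ∷ []))
∑-insertions-∷ʳ x (y ∷ τ) j f = begin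
  a ℚ.+ ∑ (map (y ∷_) (insertions x (τ ∷ʳ j))) f
    ≡⟨ cong (a ℚ.+_) (∑-map (y ∷_) (insertions x (τ ∷ʳ j)) f) ⟩
  a ℚ.+ ∑ (insertions x (τ ∷ʳ j)) (f ∘ (y ∷_))
    ≡⟨ cong (a ℚ.+_) (∑-insertions-∷ʳ x τ j (f ∘ (y ∷_))) ⟩
  a ℚ.+ (∑ (insertions x τ) (λ σ → f (y ∷ σ ∷ʳ j)) ℚ.+ b)
    ≡⟨ ℚ.+-assoc a (∑ (insertions x τ) (λ σ → f (y ∷ σ ∷ʳ j))) b ⟨
  a ℚ.+ ∑ (insertions x τ) (λ σ → f (y ∷ σ ∷ʳ j)) ℚ.+ b
    ≡⟨ cong (λ z → a ℚ.+ z ℚ.+ b) (∑-map (y ∷_) (insertions x τ) (λ σ → f (σ ∷ʳ j))) ⟨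
  a ℚ.+ ∑ (map (y ∷_) (insertions x τ)) (λ σ → f (σ ∷ʳ j)) ℚ.+ b ∎
  where
  open ≡-Reasoning
  a = f (x ∷ y ∷ τ ∷ʳ j)
  b = f (y ∷ τ ∷ʳ j ∷ʳ x)

-- The induction hypothesis is used twice: forwards, to split the orders of `xs` by their last
-- element j before x is inserted, and backwards with `f (τ ∷ʳ x)`, to reassemble the orders in
-- which x has been inserted behind j.
∑-permutations-last : ∀ {x xs} → Unique (x ∷ xs) → ∀ f →
  ∑ (permutations (x ∷ xs)) f ≡
  ∑ (x ∷ xs) (λ j → ∑ (permutations (remove j (x ∷ xs))) (λ σ → f (σ ∷ʳ j)))
∑-permutations-last {x} {[]} unq f = cong (ℚ._+ 0ℚ)
  (trans (sym (ℚ.+-identityʳ (f (x ∷ []))))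
    (cong (λ ys → ∑ (permutations ys) (λ σ → f (σ ∷ʳ x))) (sym (remove-∷-≡ {x} {[]} λ ()))))
∑-permutations-last {x} {xs@(_ ∷ _)} unq@(x∉ ∷ unq′) f = begin
  ∑ (concatMap (insertions x) (permutations xs)) f
    ≡⟨ ∑-concatMap (insertions x) (permutations xs) f ⟩
  ∑ (permutations xs) g
    ≡⟨ ∑-permutations-last unq′ g ⟩
  ∑ xs (λ j → ∑ (P j) (λ τ → g (τ ∷ʳ j)))
    ≡⟨ ∑-cong xs (λ {j} _ → trans (∑-cong (P j) (λ {τ} _ → ∑-insertions-∷ʳ x τ j f))
         (∑-+ (P j) (λ τ → ∑ (insertions x τ) (λ σ → f (σ ∷ʳ j))) (λ τ → f (τ ∷ʳ j ∷ʳ x)))) ⟩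
  ∑ xs (λ j → F j ℚ.+ ∑ (P j) (λ τ → f (τ ∷ʳ j ∷ʳ x)))
    ≡⟨ ∑-+ xs F (λ j → ∑ (P j) (λ τ → f (τ ∷ʳ j ∷ʳ x))) ⟩
  ∑ xs F ℚ.+ ∑ xs (λ j → ∑ (P j) (λ τ → f (τ ∷ʳ j ∷ʳ x)))
    ≡⟨ ℚ.+-comm (∑ xs F) _ ⟩
  ∑ xs (λ j → ∑ (P j) (λ τ → f (τ ∷ʳ j ∷ʳ x))) ℚ.+ ∑ xs F
    ≡⟨ cong₂ ℚ._+_
         (trans (sym (∑-permutations-last unq′ (λ τ → f (τ ∷ʳ x))))
           (cong (λ ys → ∑ (permutations ys) (λ τ → f (τ ∷ʳ x)))
             (sym (remove-∷-≡ (Unique.Unique[x∷xs]⇒x∉xs unq)))))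
         (∑-cong xs λ {j} j∈ → trans
           (sym (∑-concatMap (insertions x) (P j) (λ σ → f (σ ∷ʳ j))))
           (cong (λ ys → ∑ (permutations ys) (λ σ → f (σ ∷ʳ j)))
             (sym (remove-∷-≢ {j} {x} {xs} (All.lookup x∉ j∈))))) ⟩
  ∑ (x ∷ xs) (λ j → ∑ (permutations (remove j (x ∷ xs))) (λ σ → f (σ ∷ʳ j))) ∎
  where
  open ≡-Reasoning
  g : List ℕ → ℚ
  g τ = ∑ (insertions x τ) f
  P : ℕ → List (List ℕ)
  P j = permutations (remove j xs)
  F : ℕ → ℚ
  F j = ∑ (P j) (λ τ → ∑ (insertions x τ) (λ σ → f (σ ∷ʳ j)))

∑-permutations-1 : ∀ n {xs} → Unique xs → length xs ≡ n → ∑ (permutations xs) (λ _ → 1ℚ) ≡ ι (n !)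
∑-permutations-1 zero    {[]}     unq refl = refl
∑-permutations-1 (suc n) {x ∷ xs} unq len  = begin
  ∑ (permutations (x ∷ xs)) (λ _ → 1ℚ)
    ≡⟨ ∑-permutations-last unq (λ _ → 1ℚ) ⟩
  ∑ (x ∷ xs) (λ j → ∑ (permutations (remove j (x ∷ xs))) (λ _ → 1ℚ))
    ≡⟨ ∑-cong (x ∷ xs) (λ j∈ → ∑-permutations-1 n (remove-unique unq)
         (ℕ.suc-injective (trans (length-remove unq j∈) len))) ⟩
  ∑ (x ∷ xs) (λ _ → ι (n !))
    ≡⟨ ∑-const (x ∷ xs) (ι (n !)) ⟩
  ι (length (x ∷ xs)) ℚ.* ι (n !)
    ≡⟨ cong (λ m → ι m ℚ.* ι (n !)) len ⟩
  ι (suc n) ℚ.* ι (n !)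
    ≡⟨ ι-* (suc n) (n !) ⟨
  ι (suc n !) ∎
  where open ≡-Reasoning

module _ {A : Set} where

  ∈-insertions : ∀ {x k : A} τ {σ} → σ ∈ insertions x τ → k ∈ σ → k ≡ x ⊎ k ∈ τ
  ∈-insertions []      (here refl) (here k≡x) = inj₁ k≡x
  ∈-insertions (y ∷ τ) (here refl) (here k≡x) = inj₁ k≡x
  ∈-insertions (y ∷ τ) (here refl) (there k∈) = inj₂ k∈
  ∈-insertions (y ∷ τ) (there σ∈)  k∈ with ∈-map⁻ (y ∷_) σ∈
  ∈-insertions (y ∷ τ) (there _) (here k≡y) | _ , _ , refl = inj₂ (here k≡y)
  ∈-insertions (y ∷ τ) (there _) (there k∈) | _ , σ∈ , refl with ∈-insertions τ σ∈ k∈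
  ... | inj₁ k≡x = inj₁ k≡x
  ... | inj₂ k∈τ = inj₂ (there k∈τ)

  ∈-insertions⁺ : ∀ {x k : A} τ {σ} → σ ∈ insertions x τ → k ≡ x ⊎ k ∈ τ → k ∈ σ
  ∈-insertions⁺ []      (here refl) (inj₁ k≡x) = here k≡x
  ∈-insertions⁺ (y ∷ τ) (here refl) (inj₁ k≡x) = here k≡x
  ∈-insertions⁺ (y ∷ τ) (here refl) (inj₂ k∈)  = there k∈
  ∈-insertions⁺ (y ∷ τ) (there σ∈)  k∈ with ∈-map⁻ (y ∷_) σ∈ | k∈
  ... | _ , σ∈ , refl | inj₁ k≡x         = there (∈-insertions⁺ τ σ∈ (inj₁ k≡x))
  ... | _ , σ∈ , refl | inj₂ (here k≡y)  = here k≡y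
  ... | _ , σ∈ , refl | inj₂ (there k∈τ) = there (∈-insertions⁺ τ σ∈ (inj₂ k∈τ))

  permutations-step : ∀ (x : A) xs {σ} → σ ∈ permutations (x ∷ xs) →
    ∃ λ τ → τ ∈ permutations xs × σ ∈ insertions x τ
  permutations-step x xs σ∈ = find-τ (permutations xs) σ∈
    where
    find-τ : ∀ τs {σ} → σ ∈ concatMap (insertions x) τs → ∃ λ τ → τ ∈ τs × σ ∈ insertions x τ
    find-τ (τ ∷ τs) σ∈ with ∈-++⁻ (insertions x τ) σ∈
    ... | inj₁ σ∈τ = τ , here refl , σ∈τ
    ... | inj₂ σ∈τs = let τ′ , τ′∈ , σ∈τ′ = find-τ τs σ∈τs in τ′ , there τ′∈ , σ∈τ′

  ∈-permutations : ∀ {k : A} xs {σ} → σ ∈ permutations xs → k ∈ σ → k ∈ xs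
  ∈-permutations []       (here refl) ()
  ∈-permutations (x ∷ xs) σ∈ k∈ with permutations-step x xs σ∈
  ... | τ , τ∈ , σ∈τ with ∈-insertions τ σ∈τ k∈
  ... | inj₁ k≡x = here k≡x
  ... | inj₂ k∈τ = there (∈-permutations xs τ∈ k∈τ)

  ∈-permutations⁺ : ∀ {k : A} xs {σ} → σ ∈ permutations xs → k ∈ xs → k ∈ σ
  ∈-permutations⁺ (x ∷ xs) σ∈ k∈ with permutations-step x xs σ∈ | k∈
  ... | τ , τ∈ , σ∈τ | here k≡x  = ∈-insertions⁺ τ σ∈τ (inj₁ k≡x)
  ... | τ , τ∈ , σ∈τ | there k∈xs = ∈-insertions⁺ τ σ∈τ (inj₂ (∈-permutations⁺ xs τ∈ k∈xs))

-- Revoke-to-the-Left on natural numbers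

-- Overlap within a chain. Equality is included because an interval overlaps itself.
Near : ℕ → ℕ → Set
Near j k = k ≡ j ⊎ k ≡ suc j ⊎ suc k ≡ j

near? : ∀ j k → Dec (Near j k)
near? j k = (k ℕ.≟ j) ⊎-dec ((k ℕ.≟ suc j) ⊎-dec (suc k ℕ.≟ j))

-- The index is one more than the number of the interval, so that the left
-- neighbour of interval k has index k.
Selected : ℕ → List ℕ → Set
Selected zero    S = ⊥
Selected (suc k) S = k ∈ S

selected? : ∀ i S → Dec (Selected i S)
selected? zero    S = no λ ()
selected? (suc k) S = k ∈? S

-- By the index shift in `Selected`, the test is whether the left neighbour j - 1 is in `S`.
step : List ℕ → ℕ → List ℕ
step S j with selected? j S
... | yes _ = S
... | no  _ = j ∷ filter (λ k → ¬? (near? j k)) S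

final : List ℕ → List ℕ
final = foldl step []

final-∷ʳ : ∀ σ j → final (σ ∷ʳ j) ≡ step (final σ) j
final-∷ʳ σ j = List.foldl-∷ʳ step [] j σ

module _ (S : List ℕ) (j : ℕ) where

  ∈-step⁻ : ∀ {k} → k ∈ step S j → k ≡ j ⊎ k ∈ S
  ∈-step⁻ k∈ with selected? j S | k∈
  ... | yes _ | k∈S        = inj₂ k∈S
  ... | no  _ | here k≡j   = inj₁ k≡j
  ... | no  _ | there k∈S′ = inj₂ (proj₁ (∈-filter⁻ (λ k → ¬? (near? j k)) k∈S′))

  step-unique : Unique S → Unique (step S j)
  step-unique unq with selected? j S
  ... | yes _ = unq
  ... | no  _ = All.tabulate (λ k∈ j≡k → proj₂ (∈-filter⁻ (λ k → ¬? (near? j k)) {xs = S} k∈) (inj₁ (sym j≡k)))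
              ∷ Unique.filter⁺ (λ k → ¬? (near? j k)) unq

  ∈-step-new⁺ : ¬ Selected j S → j ∈ step S j
  ∈-step-new⁺ ¬blocked with selected? j S
  ... | yes blocked = contradiction blocked ¬blocked
  ... | no  _       = here refl

  ∈-step-new⁻ : j ∉ S → j ∈ step S j → ¬ Selected j S
  ∈-step-new⁻ j∉ j∈ with selected? j S
  ... | yes _        = contradiction j∈ j∉
  ... | no  ¬blocked = ¬blocked

  ∈-step-right⁺ : Selected j S → suc j ∈ S → suc j ∈ step S j
  ∈-step-right⁺ blocked ∈S with selected? j S
  ... | yes _        = ∈S
  ... | no  ¬blocked = contradiction blocked ¬blocked

  ∈-step-right⁻ : suc j ∈ step S j → Selected j S
  ∈-step-right⁻ ∈S with selected? j S | ∈S
  ... | yes blocked | _       = blocked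
  ... | no  _       | here ()
  ... | no  _       | there ∈S′ =
    contradiction (inj₂ (inj₁ refl)) (proj₂ (∈-filter⁻ (λ k → ¬? (near? j k)) {xs = S} ∈S′))

  ∈-step-other⁺ : ∀ {k} → k ≢ j → k ≢ suc j → k ∈ S → k ∈ step S j
  ∈-step-other⁺ k≢j k≢1+j k∈ with selected? j S
  ... | yes _        = k∈
  -- The left neighbour of j cannot be lost here: had it been selected, it would have blocked j.
  ... | no  ¬blocked = there (∈-filter⁺ (λ k → ¬? (near? j k)) k∈
    λ { (inj₁ k≡j) → k≢j k≡j ; (inj₂ (inj₁ k≡1+j)) → k≢1+j k≡1+j ; (inj₂ (inj₂ refl)) → ¬blocked k∈ })

∈-final⁻ : ∀ σ {k} → k ∈ final σ → k ∈ σ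
∈-final⁻ σ k∈ = [ (λ ()) , id ]′ (go [] σ k∈)
  where
  go : ∀ S σ {k} → k ∈ foldl step S σ → k ∈ S ⊎ k ∈ σ
  go S []      k∈ = inj₁ k∈
  go S (j ∷ σ) k∈ with go (step S j) σ k∈
  ... | inj₂ k∈σ = inj₂ (there k∈σ)
  ... | inj₁ k∈S with ∈-step⁻ S j k∈S
  ... | inj₁ k≡j = inj₂ (here k≡j)
  ... | inj₂ k∈S = inj₁ k∈S

final-unique : ∀ σ → Unique (final σ)
final-unique σ = go [] σ []
  where
  go : ∀ S σ → Unique S → Unique (foldl step S σ)
  go S []      unq = unq
  go S (j ∷ σ) unq = go (step S j) σ (step-unique S j unq)

-- Only the left neighbour of an interval can have it rejected or revoked.
∈-final-first : ∀ σ {k} → k ∈ σ → ¬ Selected k σ → k ∈ final σ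
∈-final-first σ {k} k∈σ first = go [] σ (inj₂ k∈σ) (¬empty k) first
  where
  ¬empty : ∀ i → ¬ Selected i []
  ¬empty (suc i) ()
  keep : ∀ i S j σ → ¬ Selected i S → ¬ Selected i (j ∷ σ) → ¬ Selected i (step S j)
  keep (suc i) S j σ i∉S i∉σ i∈ with ∈-step⁻ S j i∈
  ... | inj₁ i≡j = i∉σ (here i≡j)
  ... | inj₂ i∈S = i∉S i∈S
  weaken : ∀ i j σ → Selected i σ → Selected i (j ∷ σ)
  weaken (suc i) j σ = there
  go : ∀ S σ → k ∈ S ⊎ k ∈ σ → ¬ Selected k S → ¬ Selected k σ → k ∈ foldl step S σ
  go S []      (inj₁ k∈S) ¬S ¬σ = k∈S
  go S (j ∷ σ) k∈ ¬S ¬σ = go (step S j) σ (arrive k∈) (keep k S j σ ¬S ¬σ) (¬σ ∘ weaken k j σ)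
    where
    arrive : k ∈ S ⊎ k ∈ j ∷ σ → k ∈ step S j ⊎ k ∈ σ
    arrive (inj₂ (there k∈σ))  = inj₂ k∈σ
    arrive (inj₂ (here refl))  = inj₁ (∈-step-new⁺ S j ¬S)
    arrive (inj₁ k∈S) with k ℕ.≟ j | k ℕ.≟ suc j
    ... | yes refl | _         = inj₁ (∈-step-new⁺ S j ¬S)
    ... | no _     | yes refl  = contradiction (here refl) ¬σ
    ... | no k≢j   | no k≢1+j = inj₁ (∈-step-other⁺ S j k≢j k≢1+j k∈S)

-- Runs and the effect of a removal

-- The number of consecutive elements k - 1, k - 2, … of xs just below k.
run : List ℕ → ℕ → ℕ
run xs zero    = 0
run xs (suc k) with k ∈? xs
... | yes _ = suc (run xs k)
... | no  _ = 0

run-∈ : ∀ {xs k} → k ∈ xs → run xs (suc k) ≡ suc (run xs k)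
run-∈ {xs} {k} k∈ with k ∈? xs
... | yes _  = refl
... | no  k∉ = contradiction k∈ k∉

run-∉ : ∀ {xs k} → k ∉ xs → run xs (suc k) ≡ 0
run-∉ {xs} {k} k∉ with k ∈? xs
... | yes k∈ = contradiction k∈ k∉
... | no  _  = refl

run-remove-≥ : ∀ {j i} xs → i ℕ.≤ j → run (remove j xs) i ≡ run xs i
run-remove-≥ {j} {zero}  xs i≤j = refl
run-remove-≥ {j} {suc k} xs k<j with k ∈? xs
... | yes k∈ = trans (run-∈ (∈-remove⁺ k∈ (ℕ.<⇒≢ k<j))) (cong suc (run-remove-≥ xs (ℕ.<⇒≤ k<j)))
... | no  k∉ = run-∉ {remove j xs} (λ k∈ → k∉ (proj₁ (∈-remove⁻ {j} {k} {xs} k∈)))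

run-remove-∈ : ∀ {j k xs} → k ∈ xs → k ≢ j → run (remove j xs) (suc k) ≡ suc (run (remove j xs) k)
run-remove-∈ k∈ k≢j = run-∈ (∈-remove⁺ k∈ k≢j)

run-upTo : ∀ {n} i → i ℕ.≤ n → run (upTo n) i ≡ i
run-upTo zero    i≤n = refl
run-upTo (suc k) k<n = trans (run-∈ (∈-upTo⁺ k<n)) (cong suc (run-upTo k (ℕ.<⇒≤ k<n)))

-- Removing the element at distance d below i cuts the run at i down to d.
∑-run-remove : ∀ i xs → Unique xs → ∀ f →
  ∑ xs (λ j → f (run (remove j xs) i)) ≡
  (ι (length xs) ℚ.- ι (run xs i)) ℚ.* f (run xs i) ℚ.+ psum f (run xs i)
∑-run-remove zero    xs unq f = trans (∑-const xs (f 0))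
  (solve 2 (λ l x → l :* x := (l :+ :- con 0ℚ) :* x :+ con 0ℚ) refl (ι (length xs)) (f 0))
∑-run-remove (suc k) xs unq f with k ∈? xs
... | no  k∉ = trans
  (∑-cong xs λ {j} _ → cong f (run-∉ {remove j xs} λ k∈ → k∉ (proj₁ (∈-remove⁻ {j} {k} {xs} k∈))))
  (trans (∑-const xs (f 0))
    (solve 2 (λ l x → l :* x := (l :+ :- con 0ℚ) :* x :+ con 0ℚ) refl (ι (length xs)) (f 0)))
... | yes k∈ = begin
  ∑ xs (λ j → f (run (remove j xs) (suc k)))
    ≡⟨ ∑-cong xs (λ {j} _ → cut j) ⟩
  ∑ xs (λ j → f (suc (run (remove j xs) k)) ℚ.+ 𝟙 (j ℕ.≟ k) ℚ.* z)
    ≡⟨ ∑-+ xs (λ j → f (suc (run (remove j xs) k))) (λ j → 𝟙 (j ℕ.≟ k) ℚ.* z) ⟩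
  ∑ xs (λ j → f (suc (run (remove j xs) k))) ℚ.+ ∑ xs (λ j → 𝟙 (j ℕ.≟ k) ℚ.* z)
    ≡⟨ cong₂ ℚ._+_ (∑-run-remove k xs unq (f ∘ suc)) (∑-𝟙-∈ z unq k∈) ⟩
  (ι (length xs) ℚ.- ι r) ℚ.* f (suc r) ℚ.+ psum (f ∘ suc) r ℚ.+ z
    ≡⟨ solve 5 (λ l r x p y → (l :+ :- r) :* x :+ p :+ (y :+ :- x) :=
         (l :+ :- (r :+ con 1ℚ)) :* x :+ (y :+ p)) refl
         (ι (length xs)) (ι r) (f (suc r)) (psum (f ∘ suc) r) (f 0) ⟩
  (ι (length xs) ℚ.- (ι r ℚ.+ 1ℚ)) ℚ.* f (suc r) ℚ.+ (f 0 ℚ.+ psum (f ∘ suc) r)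
    ≡⟨ cong₂ (λ a b → (ι (length xs) ℚ.- a) ℚ.* f (suc r) ℚ.+ b) (sym (ι-suc r)) (sym (psum-suc f r)) ⟩
  (ι (length xs) ℚ.- ι (suc r)) ℚ.* f (suc r) ℚ.+ psum f (suc r) ∎
  where
  open ≡-Reasoning
  r = run xs k
  -- The induction hypothesis for `f ∘ suc` at k counts every term as if k were kept; z corrects the
  -- one term j = k, where the run breaks at once.
  z = f 0 ℚ.- f (suc r)
  cut : ∀ j → f (run (remove j xs) (suc k)) ≡ f (suc (run (remove j xs) k)) ℚ.+ 𝟙 (j ℕ.≟ k) ℚ.* z
  cut j with j ℕ.≟ k
  ... | yes refl = trans (cong f (run-∉ (∉-remove {k} {xs})))
    (trans (solve 2 (λ x y → y := x :+ con 1ℚ :* (y :+ :- x)) refl (f (suc r)) (f 0))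
      (cong (λ m → f (suc m) ℚ.+ 1ℚ ℚ.* z) (sym (run-remove-≥ {k} {k} xs ℕ.≤-refl))))
  ... | no  j≢k = trans (cong f (run-remove-∈ k∈ (j≢k ∘ sym)))
    (solve 2 (λ x z → x := x :+ con 0ℚ :* z) refl (f (suc (run (remove j xs) k))) z)

-- The probability that a given interval is selected

-- Every last arrival j is first credited with `Q` of the run that remains without it, and two terms
-- are then corrected. For j = k this credit is `Q 0`, that is 0, instead of `1 - Q (suc r)`: hence
-- `a`. For j = p it is `Q 1`, that is 1, instead of `Q r`: hence `b`.
marginal-step : ∀ n {xs p} → Unique xs → length xs ≡ suc n → p ∈ xs → suc p ∈ xs →
  (∀ {ys} → Unique ys → length ys ≡ n → ∀ i →
    ∑ (permutations ys) (λ σ → 𝟙 (selected? i (final σ))) ≡ ι (n !) ℚ.* Q (run ys i)) →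
  ∑ (permutations xs) (λ σ → 𝟙 (selected? (suc (suc p)) (final σ))) ≡
  ι (suc n !) ℚ.* Q (suc (suc (run xs p)))
marginal-step n {xs@(_ ∷ _)} {p} unq len p∈ k∈ marginal-n = begin
  ∑ (permutations xs) (λ σ → 𝟙 (selected? i (final σ)))
    ≡⟨ ∑-permutations-last unq (λ σ → 𝟙 (selected? i (final σ))) ⟩
  ∑ xs (λ j → ∑ (P j) (λ σ → 𝟙 (selected? i (final (σ ∷ʳ j)))))
    ≡⟨ ∑-cong xs (λ {j} j∈ → last j j∈) ⟩
  ∑ xs (λ j → N ℚ.* ((Q (run (remove j xs) i) ℚ.+ 𝟙 (j ℕ.≟ k) ℚ.* a) ℚ.+ 𝟙 (j ℕ.≟ p) ℚ.* b))
    ≡⟨ ∑-*ˡ xs N (λ j → (Q (run (remove j xs) i) ℚ.+ 𝟙 (j ℕ.≟ k) ℚ.* a) ℚ.+ 𝟙 (j ℕ.≟ p) ℚ.* b) ⟩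
  N ℚ.* ∑ xs (λ j → (Q (run (remove j xs) i) ℚ.+ 𝟙 (j ℕ.≟ k) ℚ.* a) ℚ.+ 𝟙 (j ℕ.≟ p) ℚ.* b)
    ≡⟨ cong (N ℚ.*_) (trans
         (∑-+ xs (λ j → Q (run (remove j xs) i) ℚ.+ 𝟙 (j ℕ.≟ k) ℚ.* a) (λ j → 𝟙 (j ℕ.≟ p) ℚ.* b))
         (cong₂ ℚ._+_
           (trans (∑-+ xs (λ j → Q (run (remove j xs) i)) (λ j → 𝟙 (j ℕ.≟ k) ℚ.* a))
             (cong₂ ℚ._+_ (∑-run-remove i xs unq Q) (∑-𝟙-∈ a unq k∈)))
           (∑-𝟙-∈ b unq p∈))) ⟩
  N ℚ.* ((ι (length xs) ℚ.- ι (run xs i)) ℚ.* Q (run xs i) ℚ.+ psum Q (run xs i) ℚ.+ a ℚ.+ b)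
    ≡⟨ cong₂ (λ l R → N ℚ.* ((ι l ℚ.- ι R) ℚ.* Q R ℚ.+ psum Q R ℚ.+ a ℚ.+ b)) len run-i ⟩
  N ℚ.* ((ι (suc n) ℚ.- ι (suc (suc r))) ℚ.* q ℚ.+ psum Q (suc (suc r)) ℚ.+ a ℚ.+ b)
    ≡⟨ solve 7 (λ N l R q P x y → N :* ((l :+ :- R) :* q :+ P :+ (con 1ℚ :+ :- x) :+ (y :+ :- con 1ℚ)) :=
         N :* (l :* q :+ :- (R :* q) :+ (P :+ :- x :+ y))) refl
         N (ι (suc n)) (ι (suc (suc r))) q (psum Q (suc (suc r))) (Q (suc r)) (Q r) ⟩
  -- The n + 1 - (r + 2) removals outside the run leave the value q; by the recursion the r + 2
  -- removals inside it add up to as many copies of q.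
  N ℚ.* (ι (suc n) ℚ.* q ℚ.- ι (suc (suc r)) ℚ.* q ℚ.+ (psum Q (suc (suc r)) ℚ.- Q (suc r) ℚ.+ Q r))
    ≡⟨ cong (λ z → N ℚ.* (ι (suc n) ℚ.* q ℚ.- ι (suc (suc r)) ℚ.* q ℚ.+ z)) (Q-rec r) ⟨
  N ℚ.* (ι (suc n) ℚ.* q ℚ.- ι (suc (suc r)) ℚ.* q ℚ.+ ι (suc (suc r)) ℚ.* q)
    ≡⟨ solve 4 (λ N l R q → N :* (l :* q :+ :- (R :* q) :+ R :* q) := (l :* N) :* q) refl
         N (ι (suc n)) (ι (suc (suc r))) q ⟩
  (ι (suc n) ℚ.* N) ℚ.* q
    ≡⟨ cong (ℚ._* q) (ι-* (suc n) (n !)) ⟨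
  ι (suc n !) ℚ.* q ∎
  where
  open ≡-Reasoning
  k = suc p
  i = suc k
  r = run xs p
  q = Q (suc (suc r))
  N = ι (n !)
  a = 1ℚ ℚ.- Q (suc r)
  b = Q r ℚ.- 1ℚ
  P : ℕ → List (List ℕ)
  P j = permutations (remove j xs)
  run-k : run xs k ≡ suc r
  run-k = run-∈ p∈
  run-i : run xs i ≡ suc (suc r)
  run-i = trans (run-∈ k∈) (cong suc run-k)
  len-remove : ∀ {j} → j ∈ xs → length (remove j xs) ≡ n
  len-remove j∈ = ℕ.suc-injective (trans (length-remove unq j∈) len)
  marginal-remove : ∀ {j} → j ∈ xs → ∀ i →
    ∑ (P j) (λ σ → 𝟙 (selected? i (final σ))) ≡ N ℚ.* Q (run (remove j xs) i)
  marginal-remove {j} j∈ = marginal-n (remove-unique unq) (len-remove j∈)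
  absent : ∀ {j σ} → σ ∈ P j → j ∉ σ
  absent {j} σ∈ j∈σ = ∉-remove {j} {xs} (∈-permutations (remove j xs) σ∈ j∈σ)
  last : ∀ j → j ∈ xs → ∑ (P j) (λ σ → 𝟙 (selected? i (final (σ ∷ʳ j)))) ≡
    N ℚ.* ((Q (run (remove j xs) i) ℚ.+ 𝟙 (j ℕ.≟ k) ℚ.* a) ℚ.+ 𝟙 (j ℕ.≟ p) ℚ.* b)
  last j j∈ with j ℕ.≟ k | j ℕ.≟ p
  ... | yes refl | yes k≡p  = contradiction (sym k≡p) (ℕ.<⇒≢ (ℕ.n<1+n p))
  ... | yes refl | no  _ = begin
    ∑ (P k) (λ σ → 𝟙 (selected? i (final (σ ∷ʳ k))))
      ≡⟨ ∑-cong (P k) (λ {σ} σ∈ → trans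
           (cong (𝟙 ∘ selected? i) (final-∷ʳ σ k))
           (𝟙-¬ (selected? i (step (final σ) k)) (selected? k (final σ))
             (∈-step-new⁻ (final σ) k (absent σ∈ ∘ ∈-final⁻ σ)) (∈-step-new⁺ (final σ) k))) ⟩
    ∑ (P k) (λ σ → 1ℚ ℚ.- 𝟙 (selected? k (final σ)))
      ≡⟨ ∑-cong (P k) (λ {σ} _ → cong (1ℚ ℚ.+_)
           (solve 1 (λ x → :- x := con (ℚ.- 1ℚ) :* x) refl (𝟙 (selected? k (final σ))))) ⟩
    ∑ (P k) (λ σ → 1ℚ ℚ.+ (ℚ.- 1ℚ) ℚ.* 𝟙 (selected? k (final σ)))
      ≡⟨ trans (∑-+ (P k) (λ _ → 1ℚ) (λ σ → (ℚ.- 1ℚ) ℚ.* 𝟙 (selected? k (final σ))))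
           (cong₂ ℚ._+_ (∑-permutations-1 n (remove-unique unq) (len-remove j∈))
             (∑-*ˡ (P k) (ℚ.- 1ℚ) (λ σ → 𝟙 (selected? k (final σ))))) ⟩
    N ℚ.+ (ℚ.- 1ℚ) ℚ.* ∑ (P k) (λ σ → 𝟙 (selected? k (final σ)))
      ≡⟨ cong (λ z → N ℚ.+ (ℚ.- 1ℚ) ℚ.* z) (trans (marginal-remove j∈ k)
           (cong (λ m → N ℚ.* Q m) (trans (run-remove-≥ {k} {k} xs ℕ.≤-refl) run-k))) ⟩
    N ℚ.+ (ℚ.- 1ℚ) ℚ.* (N ℚ.* Q (suc r))
      ≡⟨ solve 3 (λ N x b → N :+ con (ℚ.- 1ℚ) :* (N :* x) :=
           N :* ((con 0ℚ :+ con 1ℚ :* (con 1ℚ :+ :- x)) :+ con 0ℚ :* b)) refl N (Q (suc r)) b ⟩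
    N ℚ.* ((Q 0 ℚ.+ 1ℚ ℚ.* a) ℚ.+ 0ℚ ℚ.* b)
      ≡⟨ cong (λ m → N ℚ.* ((Q m ℚ.+ 1ℚ ℚ.* a) ℚ.+ 0ℚ ℚ.* b)) (run-∉ (∉-remove {k} {xs})) ⟨
    N ℚ.* ((Q (run (remove k xs) i) ℚ.+ 1ℚ ℚ.* a) ℚ.+ 0ℚ ℚ.* b) ∎
  ... | no  _ | yes refl = begin
    ∑ (P p) (λ σ → 𝟙 (selected? i (final (σ ∷ʳ p))))
      ≡⟨ ∑-cong (P p) (λ {σ} σ∈ → trans
           (cong (𝟙 ∘ selected? i) (final-∷ʳ σ p))
           (𝟙-cong (selected? i (step (final σ) p)) (selected? p (final σ))
             (∈-step-right⁻ (final σ) p)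
             (λ blocked → ∈-step-right⁺ (final σ) p blocked (∈-final-first σ
               (∈-permutations⁺ (remove p xs) σ∈ (∈-remove⁺ k∈ (ℕ.<⇒≢ (ℕ.n<1+n p) ∘ sym)))
               (absent σ∈))))) ⟩
    ∑ (P p) (λ σ → 𝟙 (selected? p (final σ)))
      ≡⟨ trans (marginal-remove j∈ p) (cong (λ m → N ℚ.* Q m) (run-remove-≥ {p} {p} xs ℕ.≤-refl)) ⟩
    N ℚ.* Q r
      ≡⟨ solve 3 (λ N x a → N :* x := N :* ((con 1ℚ :+ con 0ℚ :* a) :+ con 1ℚ :* (x :+ :- con 1ℚ))) refl
           N (Q r) a ⟩
    N ℚ.* ((Q 1 ℚ.+ 0ℚ ℚ.* a) ℚ.+ 1ℚ ℚ.* b)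
      ≡⟨ cong (λ m → N ℚ.* ((Q m ℚ.+ 0ℚ ℚ.* a) ℚ.+ 1ℚ ℚ.* b)) (trans
           (run-remove-∈ k∈ (ℕ.<⇒≢ (ℕ.n<1+n p) ∘ sym)) (cong suc (run-∉ (∉-remove {p} {xs})))) ⟨
    N ℚ.* ((Q (run (remove p xs) i) ℚ.+ 0ℚ ℚ.* a) ℚ.+ 1ℚ ℚ.* b) ∎
  ... | no j≢k | no j≢p = begin
    ∑ (P j) (λ σ → 𝟙 (selected? i (final (σ ∷ʳ j))))
      ≡⟨ ∑-cong (P j) (λ {σ} σ∈ → trans
           (cong (𝟙 ∘ selected? i) (final-∷ʳ σ j))
           (𝟙-cong (selected? i (step (final σ) j)) (selected? i (final σ))
             (λ k∈ → [ (λ k≡j → contradiction (sym k≡j) j≢k) , id ]′ (∈-step⁻ (final σ) j k∈))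
             (∈-step-other⁺ (final σ) j (j≢k ∘ sym) (j≢p ∘ sym ∘ ℕ.suc-injective)))) ⟩
    ∑ (P j) (λ σ → 𝟙 (selected? i (final σ)))
      ≡⟨ marginal-remove j∈ i ⟩
    N ℚ.* Q (run (remove j xs) i)
      ≡⟨ solve 4 (λ N x a b → N :* x := N :* ((x :+ con 0ℚ :* a) :+ con 0ℚ :* b)) refl
           N (Q (run (remove j xs) i)) a b ⟩
    N ℚ.* ((Q (run (remove j xs) i) ℚ.+ 0ℚ ℚ.* a) ℚ.+ 0ℚ ℚ.* b) ∎

-- Runs of length 0 and 1 are decided without randomness and give `Q 0` = 0 and `Q 1` = 1. The
-- statement covers all i at once, including the index 0 of a missing left neighbour, because the
-- step consults i and the two indices below it.
marginal : ∀ n {xs} → Unique xs → length xs ≡ n → ∀ i →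
  ∑ (permutations xs) (λ σ → 𝟙 (selected? i (final σ))) ≡ ι (n !) ℚ.* Q (run xs i)
marginal n {xs} unq len i = go n len i
  where
  open ≡-Reasoning
  never : ∀ n i → (∀ {σ} → σ ∈ permutations xs → ¬ Selected i (final σ)) →
    ∑ (permutations xs) (λ σ → 𝟙 (selected? i (final σ))) ≡ ι (n !) ℚ.* Q 0
  never n i ¬sel = begin
    ∑ (permutations xs) (λ σ → 𝟙 (selected? i (final σ)))
      ≡⟨ ∑-cong (permutations xs) (λ {σ} σ∈ → 𝟙-no (selected? i (final σ)) (¬sel σ∈)) ⟩
    ∑ (permutations xs) (λ _ → 0ℚ)
      ≡⟨ ∑-const (permutations xs) 0ℚ ⟩
    ι (length (permutations xs)) ℚ.* 0ℚ
      ≡⟨ trans (ℚ.*-zeroʳ (ι (length (permutations xs)))) (sym (ℚ.*-zeroʳ (ι (n !)))) ⟩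
    ι (n !) ℚ.* Q 0 ∎
  always : ∀ n i → length xs ≡ n → (∀ {σ} → σ ∈ permutations xs → Selected i (final σ)) →
    ∑ (permutations xs) (λ σ → 𝟙 (selected? i (final σ))) ≡ ι (n !) ℚ.* Q 1
  always n i len sel = begin
    ∑ (permutations xs) (λ σ → 𝟙 (selected? i (final σ)))
      ≡⟨ ∑-cong (permutations xs) (λ {σ} σ∈ → 𝟙-yes (selected? i (final σ)) (sel σ∈)) ⟩
    ∑ (permutations xs) (λ _ → 1ℚ)
      ≡⟨ ∑-permutations-1 n unq len ⟩
    ι (n !)
      ≡⟨ ℚ.*-identityʳ (ι (n !)) ⟨
    ι (n !) ℚ.* Q 1 ∎
  go : ∀ n → length xs ≡ n → ∀ i →
    ∑ (permutations xs) (λ σ → 𝟙 (selected? i (final σ))) ≡ ι (n !) ℚ.* Q (run xs i)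
  go n len zero = never n 0 λ _ ()
  go n len (suc k) with k ∈? xs
  ... | no k∉ = never n (suc k) λ {σ} σ∈ k∈ → k∉ (∈-permutations xs σ∈ (∈-final⁻ σ k∈))
  go n len (suc zero) | yes k∈ =
    always n 1 len λ {σ} σ∈ → ∈-final-first σ (∈-permutations⁺ xs σ∈ k∈) λ ()
  go n len (suc (suc p)) | yes k∈ with p ∈? xs
  ... | no p∉ = always n (suc (suc p)) len λ {σ} σ∈ →
    ∈-final-first σ (∈-permutations⁺ xs σ∈ k∈) λ p∈σ → p∉ (∈-permutations xs σ∈ p∈σ)
  go zero    len (suc (suc p)) | yes k∈ | yes p∈ = contradiction len λ len≡0 → ℕ.m<n⇒n≢0 (∈-length k∈) len≡0
  go (suc n) len (suc (suc p)) | yes k∈ | yes p∈ = marginal-step n unq len p∈ k∈ (marginal n)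

length-∑ : ∀ {xs S} → Unique xs → Unique S → (∀ {k} → k ∈ S → k ∈ xs) →
  ι (length S) ≡ ∑ xs (λ k → 𝟙 (k ∈? S))
length-∑ {xs} {[]}    unq _ _ = sym (trans (∑-const xs 0ℚ) (ℚ.*-zeroʳ (ι (length xs))))
length-∑ {xs} {k ∷ S} unq unqS@(_ ∷ unqS′) S⊆xs = begin
  ι (suc (length S))
    ≡⟨ ι-suc (length S) ⟩
  ι (length S) ℚ.+ 1ℚ
    ≡⟨ cong₂ ℚ._+_ (length-∑ unq unqS′ (S⊆xs ∘ there)) (sym (∑-𝟙-∈ 1ℚ unq (S⊆xs (here refl)))) ⟩
  ∑ xs (λ j → 𝟙 (j ∈? S)) ℚ.+ ∑ xs (λ j → 𝟙 (j ℕ.≟ k) ℚ.* 1ℚ)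
    ≡⟨ ∑-+ xs (λ j → 𝟙 (j ∈? S)) (λ j → 𝟙 (j ℕ.≟ k) ℚ.* 1ℚ) ⟨
  ∑ xs (λ j → 𝟙 (j ∈? S) ℚ.+ 𝟙 (j ℕ.≟ k) ℚ.* 1ℚ)
    ≡⟨ ∑-cong xs (λ {j} _ → sym (split-head j (j ℕ.≟ k))) ⟩
  ∑ xs (λ j → 𝟙 (j ∈? (k ∷ S))) ∎
  where
  open ≡-Reasoning
  k∉S = Unique.Unique[x∷xs]⇒x∉xs unqS
  split-head : ∀ j (d : Dec (j ≡ k)) → 𝟙 (j ∈? (k ∷ S)) ≡ 𝟙 (j ∈? S) ℚ.+ 𝟙 d ℚ.* 1ℚ
  split-head j (yes refl) = trans (𝟙-yes (k ∈? (k ∷ S)) (here refl)) (cong (ℚ._+ 1ℚ) (sym (𝟙-no (k ∈? S) k∉S)))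
  split-head j (no  j≢k)  = trans
    (𝟙-cong (j ∈? (k ∷ S)) (j ∈? S) (λ { (here j≡k) → contradiction j≡k j≢k ; (there j∈) → j∈ }) there)
    (sym (ℚ.+-identityʳ (𝟙 (j ∈? S))))

-- Linearity of expectation; in the full chain the run ending at interval k has length k + 1. The
-- sum may start at `Q 0`, which vanishes.
∑-length-final : ∀ n → ∑ (permutations (upTo n)) (λ σ → ι (length (final σ))) ≡ ι (n !) ℚ.* psum Q (suc n)
∑-length-final n = begin
  ∑ (permutations (upTo n)) (λ σ → ι (length (final σ)))
    ≡⟨ ∑-cong (permutations (upTo n)) (λ {σ} σ∈ → length-∑ (Unique.upTo⁺ n) (final-unique σ)
         (∈-permutations (upTo n) σ∈ ∘ ∈-final⁻ σ)) ⟩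
  ∑ (permutations (upTo n)) (λ σ → ∑ (upTo n) (λ k → 𝟙 (k ∈? final σ)))
    ≡⟨ ∑-swap (permutations (upTo n)) (upTo n) (λ σ k → 𝟙 (k ∈? final σ)) ⟩
  ∑ (upTo n) (λ k → ∑ (permutations (upTo n)) (λ σ → 𝟙 (k ∈? final σ)))
    ≡⟨ ∑-cong (upTo n) (λ {k} k∈ → trans (marginal n (Unique.upTo⁺ n) (List.length-upTo n) (suc k))
         (cong (λ m → ι (n !) ℚ.* Q m) (run-upTo (suc k) (∈-upTo⁻ k∈)))) ⟩
  ∑ (upTo n) (λ k → ι (n !) ℚ.* Q (suc k))
    ≡⟨ ∑-*ˡ (upTo n) (ι (n !)) (Q ∘ suc) ⟩
  ι (n !) ℚ.* ∑ (upTo n) (Q ∘ suc)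
    ≡⟨ cong (ι (n !) ℚ.*_) (trans (∑-applyUpTo id n (Q ∘ suc))
         (trans (sym (ℚ.+-identityˡ (psum (Q ∘ suc) n))) (sym (psum-suc Q n)))) ⟩
  ι (n !) ℚ.* psum Q (suc n) ∎
  where open ≡-Reasoning

-- Simple chains

ι-sum : ∀ {A : Set} (f : A → ℕ) xs → ι (sum (map f xs)) ≡ ∑ xs (ι ∘ f)
ι-sum f []       = refl
ι-sum f (x ∷ xs) = trans (ι-+ (f x) (sum (map f xs))) (cong (ι (f x) ℚ.+_) (ι-sum f xs))

∑-insertions-map : ∀ {A B : Set} (g : A → B) x ys f →
  ∑ (insertions (g x) (map g ys)) f ≡ ∑ (insertions x ys) (f ∘ map g)
∑-insertions-map g x []       f = refl
∑-insertions-map g x (y ∷ ys) f = cong (f (g x ∷ g y ∷ map g ys) ℚ.+_) (begin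
  ∑ (map (g y ∷_) (insertions (g x) (map g ys))) f
    ≡⟨ ∑-map (g y ∷_) (insertions (g x) (map g ys)) f ⟩
  ∑ (insertions (g x) (map g ys)) (f ∘ (g y ∷_))
    ≡⟨ ∑-insertions-map g x ys (f ∘ (g y ∷_)) ⟩
  ∑ (insertions x ys) (f ∘ (g y ∷_) ∘ map g)
    ≡⟨ ∑-map (y ∷_) (insertions x ys) (f ∘ map g) ⟨
  ∑ (map (y ∷_) (insertions x ys)) (f ∘ map g) ∎)
  where open ≡-Reasoning

∑-permutations-map : ∀ {A B : Set} (g : A → B) xs f →
  ∑ (permutations (map g xs)) f ≡ ∑ (permutations xs) (f ∘ map g)
∑-permutations-map g []       f = refl
∑-permutations-map g (x ∷ xs) f = begin
  ∑ (concatMap (insertions (g x)) (permutations (map g xs))) f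
    ≡⟨ ∑-concatMap (insertions (g x)) (permutations (map g xs)) f ⟩
  ∑ (permutations (map g xs)) (λ τ → ∑ (insertions (g x) τ) f)
    ≡⟨ ∑-permutations-map g xs (λ τ → ∑ (insertions (g x) τ) f) ⟩
  ∑ (permutations xs) (λ τ → ∑ (insertions (g x) (map g τ)) f)
    ≡⟨ ∑-cong (permutations xs) (λ {τ} _ → ∑-insertions-map g x τ f) ⟩
  ∑ (permutations xs) (λ τ → ∑ (insertions x τ) (f ∘ map g))
    ≡⟨ ∑-concatMap (insertions x) (permutations xs) (f ∘ map g) ⟨
  ∑ (concatMap (insertions x) (permutations xs)) (f ∘ map g) ∎
  where open ≡-Reasoning

map-toℕ-allFin : ∀ n → map toℕ (allFin n) ≡ upTo n
map-toℕ-allFin n = trans (List.map-tabulate id toℕ) (tabulate-toℕ n id)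
  where
  tabulate-toℕ : ∀ {A : Set} n (f : ℕ → A) → tabulate {n = n} (f ∘ toℕ) ≡ applyUpTo f n
  tabulate-toℕ zero    f = refl
  tabulate-toℕ (suc n) f = cong (f 0 ∷_) (tabulate-toℕ n (f ∘ suc))

∣-∣≡1⇒ : ∀ m n → ℕ.∣ m - n ∣ ≡ 1 → n ≡ suc m ⊎ suc n ≡ m
∣-∣≡1⇒ zero    n       eq = inj₁ eq
∣-∣≡1⇒ (suc m) zero    eq = inj₂ (sym eq)
∣-∣≡1⇒ (suc m) (suc n) eq with ∣-∣≡1⇒ m n eq
... | inj₁ n≡1+m = inj₁ (cong suc n≡1+m)
... | inj₂ 1+n≡m = inj₂ (cong suc 1+n≡m)

∣n-1+n∣≡1 : ∀ n → ℕ.∣ n - suc n ∣ ≡ 1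
∣n-1+n∣≡1 zero    = refl
∣n-1+n∣≡1 (suc n) = ∣n-1+n∣≡1 n

Near⇒∣-∣≡1 : ∀ {m n} → m ≢ n → Near m n → ℕ.∣ m - n ∣ ≡ 1
Near⇒∣-∣≡1 {m} m≢n (inj₁ n≡m)           = contradiction (sym n≡m) m≢n
Near⇒∣-∣≡1 {m} m≢n (inj₂ (inj₁ refl))   = ∣n-1+n∣≡1 m
Near⇒∣-∣≡1 {_} {n} m≢n (inj₂ (inj₂ refl)) = trans (ℕ.∣-∣-comm (suc n) n) (∣n-1+n∣≡1 n)

module _ {n : ℕ} (I : SimpleChain n) where
  open SimpleChain I
  open Selection interval (overlap? I) (finish<? I)

  overlap⇒near : ∀ {i j} → Overlap (interval i) (interval j) → Near (toℕ i) (toℕ j)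
  overlap⇒near {i} {j} o with i Fin.≟ j
  ... | yes refl = inj₁ refl
  ... | no  i≢j  = inj₂ (∣-∣≡1⇒ (toℕ i) (toℕ j) (Equivalence.to (adjacent i≢j) o))

  near⇒overlap : ∀ {i j} → Near (toℕ i) (toℕ j) → Overlap (interval i) (interval j)
  near⇒overlap {i} {j} near with i Fin.≟ j
  ... | yes refl = start<finish I i , start<finish I i
  ... | no  i≢j  = Equivalence.from (adjacent i≢j) (Near⇒∣-∣≡1 (i≢j ∘ Fin.toℕ-injective) near)

  blocked⇒left : ∀ {i j} → BlockedBy i j → suc (toℕ j) ≡ toℕ i
  blocked⇒left {i} {j} (o , _ , fj<fi) with overlap⇒near o
  ... | inj₂ (inj₂ eq) = eq
  ... | inj₂ (inj₁ eq) = contradiction fj<fi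
    (<-asym {finish (interval i)} {finish (interval j)} (finish-ordered I (ℕ.≤-reflexive (sym eq))))
  ... | inj₁ eq with Fin.toℕ-injective eq
  ... | refl = contradiction fj<fi (<-irrefl {finish (interval i)})

  left⇒blocked : ∀ {i j} → suc (toℕ j) ≡ toℕ i → BlockedBy i j
  left⇒blocked eq = let o = near⇒overlap (inj₂ (inj₂ eq)) in
    o , proj₁ o , finish-ordered I (ℕ.≤-reflexive eq)

  blocked⇒selected : ∀ {i} S → Any (BlockedBy i) S → Selected (toℕ i) (map toℕ S)
  blocked⇒selected {i} S blocked = go (toℕ i) (Any.map blocked⇒left blocked)
    where
    go : ∀ {S} m → Any (λ j → suc (toℕ j) ≡ m) S → Selected m (map toℕ S)
    go zero    (there any) = go zero any
    go (suc k) any = Any.map⁺ (Any.map (sym ∘ ℕ.suc-injective) any)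

  selected⇒blocked : ∀ {i} S → Selected (toℕ i) (map toℕ S) → Any (BlockedBy i) S
  selected⇒blocked {i} S selected = Any.map left⇒blocked (go (toℕ i) selected)
    where
    go : ∀ m → Selected m (map toℕ S) → Any (λ j → suc (toℕ j) ≡ m) S
    go (suc k) k∈ = let j , j∈ , k≡j = ∈-map⁻ toℕ k∈ in
      Any.map (λ j≡j′ → cong suc (trans (cong toℕ (sym j≡j′)) (sym k≡j))) j∈

  map-filter-overlap : ∀ i S → map toℕ (filter (λ j → ¬? (overlap? I i j)) S) ≡
    filter (λ k → ¬? (near? (toℕ i) k)) (map toℕ S)
  map-filter-overlap i []      = refl
  map-filter-overlap i (j ∷ S) = go (near? (toℕ i) (toℕ j))
    where
    P? = λ j → ¬? (overlap? I i j)
    N? = λ k → ¬? (near? (toℕ i) k)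
    go : Dec (Near (toℕ i) (toℕ j)) → map toℕ (filter P? (j ∷ S)) ≡ filter N? (map toℕ (j ∷ S))
    go (yes near) = trans (cong (map toℕ) (List.filter-reject P? (λ ¬o → ¬o (near⇒overlap near))))
      (trans (map-filter-overlap i S) (sym (List.filter-reject N? (λ ¬near → ¬near near))))
    go (no ¬near) = trans (cong (map toℕ) (List.filter-accept P? (¬near ∘ overlap⇒near)))
      (trans (cong (toℕ j ∷_) (map-filter-overlap i S)) (sym (List.filter-accept N? ¬near)))

  -- Overlap and the order of finishing points depend only on the positions in the chain, so `toℕ`
  -- carries one algorithm to the other, for every chain alike.
  map-step : ∀ S i → map toℕ (revokeToTheLeft S i) ≡ step (map toℕ S) (toℕ i)
  map-step S i with any? (blockedBy? i) S | selected? (toℕ i) (map toℕ S)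
  ... | yes _ | yes _ = refl
  ... | no  _ | no  _ = cong (toℕ i ∷_) (map-filter-overlap i S)
  ... | yes b | no ¬s = contradiction (blocked⇒selected S b) ¬s
  ... | no ¬b | yes s = contradiction (selected⇒blocked S s) ¬b

  map-foldl : ∀ S σ → map toℕ (foldl revokeToTheLeft S σ) ≡ foldl step (map toℕ S) (map toℕ σ)
  map-foldl S []      = refl
  map-foldl S (i ∷ σ) = trans (map-foldl (revokeToTheLeft S i) σ)
    (cong (λ S′ → foldl step S′ (map toℕ σ)) (map-step S i))

  alg≡ : ∀ σ → alg σ ≡ length (final (map toℕ σ))
  alg≡ σ = trans (sym (List.length-map toℕ (foldl revokeToTheLeft [] σ))) (cong length (map-foldl [] σ))

  𝔼ALG≡ : 𝔼ALG I ≡ psum Q (suc n)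
  𝔼ALG≡ = ℚ.≤-antisym (*-cancelʳ-≤ (ι (n !)) 0<n! (ℚ.≤-reflexive eq))
    (*-cancelʳ-≤ (ι (n !)) 0<n! (ℚ.≤-reflexive (sym eq)))
    where
    open ≡-Reasoning
    0<n! = 0<ι (n !) {{n ℕ.!≢0}}
    eq : 𝔼ALG I ℚ.* ι (n !) ≡ psum Q (suc n) ℚ.* ι (n !)
    eq = begin
      𝔼ALG I ℚ.* ι (n !)
        ≡⟨ frac-ι (sum (map alg (permutations (allFin n)))) (n !) {{n ℕ.!≢0}} ⟩
      ι (sum (map alg (permutations (allFin n))))
        ≡⟨ ι-sum alg (permutations (allFin n)) ⟩
      ∑ (permutations (allFin n)) (ι ∘ alg)
        ≡⟨ ∑-cong (permutations (allFin n)) (λ {σ} _ → cong ι (alg≡ σ)) ⟩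
      ∑ (permutations (allFin n)) (λ σ → ι (length (final (map toℕ σ))))
        ≡⟨ ∑-permutations-map toℕ (allFin n) (λ σ → ι (length (final σ))) ⟨
      ∑ (permutations (map toℕ (allFin n))) (λ σ → ι (length (final σ)))
        ≡⟨ cong (λ xs → ∑ (permutations xs) (λ σ → ι (length (final σ)))) (map-toℕ-allFin n) ⟩
      ∑ (permutations (upTo n)) (λ σ → ι (length (final σ)))
        ≡⟨ ∑-length-final n ⟩
      ι (n !) ℚ.* psum Q (suc n)
        ≡⟨ ℚ.*-comm (ι (n !)) (psum Q (suc n)) ⟩
      psum Q (suc n) ℚ.* ι (n !) ∎

  -- The optimum of a chain

  Consecutive : List (Fin n) → Set
  Consecutive = Linked (λ i j → toℕ j ≡ suc (toℕ i))

  -- Neighbours overlap, so a compatible sublist that takes x skips y: each two entries of `xs`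
  -- yield at most one.
  compatible-length : ∀ {xs} → Consecutive xs → ∀ {ys} → ys ∈ sublists xs → Compatible ys →
    length ys ℕ.≤ ⌈ length xs /2⌉
  compatible-length []  (here refl) _ = ℕ.z≤n
  compatible-length [-] (here refl) _ = ℕ.z≤n
  compatible-length [-] (there (here refl)) _ = ℕ.≤-refl
  compatible-length {x ∷ y ∷ zs} (1+x≡y ∷ linked) ys∈ compat with ∈-++⁻ (sublists (y ∷ zs)) ys∈
  ... | inj₁ ys∈′ = ℕ.≤-trans (compatible-length linked ys∈′ compat)
    (ℕ.⌈n/2⌉-mono (ℕ.n≤1+n (suc (length zs))))
  ... | inj₂ ys∈′ with ∈-map⁻ (x ∷_) ys∈′
  ... | ys′ , ys′∈ , refl with ∈-++⁻ (sublists zs) ys′∈ | compat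
  ... | inj₁ ys′∈zs | _ ∷ compat′ = ℕ.s≤s (compatible-length (tail linked) ys′∈zs compat′)
    where
    tail : ∀ {y zs} → Consecutive (y ∷ zs) → Consecutive zs
    tail [-]      = []
    tail (_ ∷ zs) = zs
  ... | inj₂ ys′∈y | ¬o ∷ _ with ∈-map⁻ (y ∷_) ys′∈y
  ... | _ , _ , refl = contradiction (near⇒overlap (inj₂ (inj₁ 1+x≡y))) (All.head ¬o)

  alternate : List (Fin n) → List (Fin n)
  alternate (x ∷ _ ∷ zs) = x ∷ alternate zs
  alternate xs           = xs

  alternate∈sublists : ∀ xs → alternate xs ∈ sublists xs
  alternate∈sublists []           = here refl
  alternate∈sublists (x ∷ [])     = there (here refl)
  alternate∈sublists (x ∷ y ∷ zs) = ∈-++⁺ʳ (sublists (y ∷ zs))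
    (∈-map⁺ (x ∷_) (∈-++⁺ˡ (alternate∈sublists zs)))

  length-alternate : ∀ xs → length (alternate xs) ≡ ⌈ length xs /2⌉
  length-alternate []           = refl
  length-alternate (x ∷ [])     = refl
  length-alternate (x ∷ y ∷ zs) = cong suc (length-alternate zs)

  alternate-All : ∀ {P : Fin n → Set} {xs} → All P xs → All P (alternate xs)
  alternate-All []             = []
  alternate-All (px ∷ [])      = px ∷ []
  alternate-All (px ∷ _ ∷ pzs) = px ∷ alternate-All pzs

  alternate-compatible : ∀ {xs} → AllPairs Fin._<_ xs → Compatible (alternate xs)
  alternate-compatible []       = []
  alternate-compatible (_ ∷ []) = [] ∷ []
  alternate-compatible {x ∷ y ∷ zs} ((x<y ∷ _) ∷ y<zs ∷ zs<) =
    alternate-All (All.map apart y<zs) ∷ alternate-compatible zs<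
    where
    apart : ∀ {z} → y Fin.< z → ¬ Overlap (interval x) (interval z)
    apart {z} y<z o = [ (λ z≡x → far (ℕ.≤-trans (ℕ.≤-reflexive z≡x) (ℕ.n≤1+n (toℕ x)))) ,
      [ far ∘ ℕ.≤-reflexive , (λ 1+z≡x → far (ℕ.≤-trans (ℕ.n≤1+n (toℕ z))
        (ℕ.≤-trans (ℕ.≤-reflexive 1+z≡x) (ℕ.n≤1+n (toℕ x))))) ]′ ]′ (overlap⇒near o)
      where
      far : ¬ (toℕ z ℕ.≤ suc (toℕ x))
      far = ℕ.<⇒≱ (ℕ.≤-<-trans x<y y<z)

  OPT≡ : OPT I ≡ ⌈ n /2⌉
  OPT≡ = ℕ.≤-antisym
    (max≤v⁺ ℕ.z≤n (All.tabulate upper))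
    (ℕ.≤-trans (ℕ.≤-reflexive (sym (trans (length-alternate (allFin n)) (cong ⌈_/2⌉ length-allFin))))
      (All.lookup (xs≤max 0 (map length (filter compatible? (sublists (allFin n)))))
        (∈-map⁺ length (∈-filter⁺ compatible? (alternate∈sublists (allFin n))
          (alternate-compatible (AllPairs.tabulate⁺-< id))))))
    where
    length-allFin : length (allFin n) ≡ n
    length-allFin = List.length-tabulate id
    consecutive : Consecutive (allFin n)
    consecutive = Linked.map⁻ (subst (Linked (λ a b → b ≡ suc a)) (sym (map-toℕ-allFin n))
      (Linked.applyUpTo⁺₂ id n (λ _ → refl)))
    upper : ∀ {l} → l ∈ map length (filter compatible? (sublists (allFin n))) → l ℕ.≤ ⌈ n /2⌉
    upper l∈ with ∈-map⁻ length l∈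
    ... | ys , ys∈ , refl = let ys∈′ , compat = ∈-filter⁻ compatible? {xs = sublists (allFin n)} ys∈ in
      subst (λ m → length ys ℕ.≤ ⌈ m /2⌉) length-allFin (compatible-length consecutive ys∈′ compat)

-- Any distance in [½ , 1) between consecutive starts would do.
¾ : ℚ
¾ = + 3 / 4

-- A guarantee quantifies over chains, so it bounds ρ from above only if arbitrarily long chains
-- exist.
chain : ∀ n → SimpleChain n
chain n = record
  { interval = interval
  ; unit     = λ i → (λ ε 0<ε → 0 , λ k _ → ≤+ (x i ℚ.+ 1ℚ) (ℚ.<⇒≤ 0<ε)) ,
                     (λ ε 0<ε → 0 , λ k _ → ≤+ (x i ℚ.+ 1ℚ) (ℚ.<⇒≤ 0<ε))
  ; ordered  = λ {i} {j} i<j → ¾ , ℚ.positive⁻¹ ¾ , 0 , λ _ _ → begin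
      x i ℚ.+ ¾                 ≡⟨ solve 1 (λ a → a :* con ¾ :+ con ¾ := (a :+ con 1ℚ) :* con ¾) refl (ι (toℕ i)) ⟩
      (ι (toℕ i) ℚ.+ 1ℚ) ℚ.* ¾  ≡⟨ cong (ℚ._* ¾) (ι-suc (toℕ i)) ⟨
      ι (suc (toℕ i)) ℚ.* ¾     ≤⟨ ℚ.*-monoʳ-≤-nonNeg ¾ (ι-mono i<j) ⟩
      x j                       ∎
  ; adjacent = λ {i} {j} i≢j → mk⇔
      (λ (i<j+1 , j<i+1) → apart (i≢j ∘ Fin.toℕ-injective) (reach i<j+1) (reach j<i+1))
      (λ d → overlaps (∣-∣≡1⇒ (toℕ i) (toℕ j) d))
  }
  where
  open ℚ.≤-Reasoning hiding (start)
  x : Fin n → ℚ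
  x i = ι (toℕ i) ℚ.* ¾
  interval : Fin n → Interval
  interval i = record { start = fromℚ (x i) ; finish = fromℚ (x i) + 1ℝ }
  -- Two steps of ¾ exceed the unit length by ½, so intervals two apart are disjoint; one step falls
  -- short of it by ¼, which is the margin in `touch`.
  reach : ∀ {i j} → start (interval i) < finish (interval j) → toℕ i ℕ.≤ suc (toℕ j)
  reach {i} {j} (ε , 0<ε , N , near) = ℕ.≮⇒≥ λ 1+j<i → ℚ.<-irrefl refl (begin-strict
    x i                                    <⟨ x<x+ε ⟩
    x i ℚ.+ ε                              ≤⟨ near N ℕ.≤-refl ⟩
    x j ℚ.+ 1ℚ                             ≤⟨ ≤+ (x j ℚ.+ 1ℚ) (ℚ.nonNegative⁻¹ ½) ⟩
    x j ℚ.+ 1ℚ ℚ.+ ½                       ≡⟨ solve 1 (λ a → a :* con ¾ :+ con 1ℚ :+ con ½ :=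
                                                (a :+ con 1ℚ :+ con 1ℚ) :* con ¾) refl (ι (toℕ j)) ⟩
    (ι (toℕ j) ℚ.+ 1ℚ ℚ.+ 1ℚ) ℚ.* ¾        ≡⟨ cong (ℚ._* ¾) (trans (ι-suc (suc (toℕ j)))
                                                (cong (ℚ._+ 1ℚ) (ι-suc (toℕ j)))) ⟨
    ι (suc (suc (toℕ j))) ℚ.* ¾            ≤⟨ ℚ.*-monoʳ-≤-nonNeg ¾ (ι-mono 1+j<i) ⟩
    x i                                    ∎)
    where
    x<x+ε : x i ℚ.< x i ℚ.+ ε
    x<x+ε = subst (ℚ._< x i ℚ.+ ε) (ℚ.+-identityʳ (x i)) (ℚ.+-monoʳ-< (x i) 0<ε)
  apart : ∀ {a b} → a ≢ b → a ℕ.≤ suc b → b ℕ.≤ suc a → ℕ.∣ a - b ∣ ≡ 1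
  apart {a} {b} a≢b a≤1+b b≤1+a with ℕ.<-cmp a b
  ... | tri< a<b _ _ = Near⇒∣-∣≡1 a≢b (inj₂ (inj₁ (ℕ.≤-antisym b≤1+a a<b)))
  ... | tri≈ _ a≡b _ = contradiction a≡b a≢b
  ... | tri> _ _ b<a = Near⇒∣-∣≡1 a≢b (inj₂ (inj₂ (ℕ.≤-antisym b<a a≤1+b)))
  ¼ : ℚ
  ¼ = + 1 / 4
  touch : ∀ {i j} → toℕ i ℕ.≤ suc (toℕ j) → start (interval i) < finish (interval j)
  touch {i} {j} i≤1+j = ¼ , ℚ.positive⁻¹ ¼ , 0 , λ _ _ → begin
    x i ℚ.+ ¼                          ≤⟨ ℚ.+-monoˡ-≤ ¼ (ℚ.*-monoʳ-≤-nonNeg ¾ (ι-mono i≤1+j)) ⟩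
    ι (suc (toℕ j)) ℚ.* ¾ ℚ.+ ¼        ≡⟨ cong (λ a → a ℚ.* ¾ ℚ.+ ¼) (ι-suc (toℕ j)) ⟩
    (ι (toℕ j) ℚ.+ 1ℚ) ℚ.* ¾ ℚ.+ ¼     ≡⟨ solve 1 (λ a → (a :+ con 1ℚ) :* con ¾ :+ con ¼ := a :* con ¾ :+ con 1ℚ)
                                            refl (ι (toℕ j)) ⟩
    x j ℚ.+ 1ℚ                         ∎
  overlaps : ∀ {i j} → toℕ j ≡ suc (toℕ i) ⊎ suc (toℕ j) ≡ toℕ i → Overlap (interval i) (interval j)
  overlaps {i} {j} (inj₁ j≡1+i) =
    touch {i} {j} (ℕ.≤-trans (ℕ.n≤1+n (toℕ i)) (ℕ.≤-trans (ℕ.≤-reflexive (sym j≡1+i)) (ℕ.n≤1+n (toℕ j)))) ,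
    touch {j} {i} (ℕ.≤-reflexive j≡1+i)
  overlaps {i} {j} (inj₂ 1+j≡i) =
    touch {i} {j} (ℕ.≤-reflexive (sym 1+j≡i)) ,
    touch {j} {i} (ℕ.≤-trans (ℕ.n≤1+n (toℕ j)) (ℕ.≤-trans (ℕ.≤-reflexive 1+j≡i) (ℕ.n≤1+n (toℕ i))))

-- The competitive ratio

-- Twice this is, by computation, an approximation of the competitive ratio.
w : ℕ → ℚ
w k = 1ℚ ℚ.- v k

∣w∣≤1 : ∀ k → ∣ w k ∣ ℚ.≤ 1ℚ
∣w∣≤1 k = ∣-∣-intro (ℚ.+-monoˡ-≤ 1ℚ (0≤v k)) (v≤2 k)

twice-⌈n/2⌉ : ∀ n → ⌈ n /2⌉ ℕ.+ ⌈ n /2⌉ ≡ n ⊎ ⌈ n /2⌉ ℕ.+ ⌈ n /2⌉ ≡ suc n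
twice-⌈n/2⌉ zero          = inj₁ refl
twice-⌈n/2⌉ (suc zero)    = inj₂ refl
twice-⌈n/2⌉ (suc (suc n)) rewrite ℕ.+-suc ⌈ n /2⌉ ⌈ n /2⌉ with twice-⌈n/2⌉ n
... | inj₁ eq = inj₁ (cong (suc ∘ suc) eq)
... | inj₂ eq = inj₂ (cong (suc ∘ suc) eq)

*-⌈n/2⌉-near : ∀ n {r} → ∣ r ∣ ℚ.≤ 1ℚ → ∣ ι (suc n) ℚ.* r ℚ.- (ι 2 ℚ.* r) ℚ.* ι ⌈ n /2⌉ ∣ ℚ.≤ 1ℚ
*-⌈n/2⌉-near n {r} r≤1 = subst (λ z → ∣ ι (suc n) ℚ.* r ℚ.- z ∣ ℚ.≤ 1ℚ) (sym double)
  (close-to (twice-⌈n/2⌉ n))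
  where
  o = ⌈ n /2⌉
  double : (ι 2 ℚ.* r) ℚ.* ι o ≡ ι (o ℕ.+ o) ℚ.* r
  double = trans (solve 2 (λ r o → (con (ι 2) :* r) :* o := (o :+ o) :* r) refl r (ι o))
    (cong (ℚ._* r) (sym (ι-+ o o)))
  close-to : ∀ {m} → m ≡ n ⊎ m ≡ suc n → ∣ ι (suc n) ℚ.* r ℚ.- ι m ℚ.* r ∣ ℚ.≤ 1ℚ
  close-to (inj₁ refl) = subst (λ z → ∣ z ∣ ℚ.≤ 1ℚ) (sym (trans
    (cong (λ i → i ℚ.* r ℚ.- ι n ℚ.* r) (ι-suc n))
    (solve 2 (λ i r → (i :+ con 1ℚ) :* r :+ :- (i :* r) := r) refl (ι n) r))) r≤1
  close-to (inj₂ refl) = subst (λ z → ∣ z ∣ ℚ.≤ 1ℚ) (sym (ℚ.+-inverseʳ (ι (suc n) ℚ.* r))) (ℚ.<⇒≤ 0<1)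

*-Q-near : ∀ n ε → 0ℚ ℚ.< ε → ∃ λ N → ∀ k → N ℕ.≤ k →
  ∣ ι (suc n) ℚ.* Q n ℚ.- ι (suc n) ℚ.* w k ∣ ℚ.≤ ι 2 ℚ.+ ε
*-Q-near n ε 0<ε =
  -- The size is fixed before k grows, so the distance to the limit can be made small enough to
  -- survive the factor n + 1.
  let δ , 0<δ , δn≡ε = split (ι (suc n)) (0<ι (suc n)) ε 0<ε
      N , near = psum-c-near (suc n) δ 0<δ
      p = psum c (suc n)
  in N , λ k N≤k → begin
    ∣ ι (suc n) ℚ.* (1ℚ ℚ.- p) ℚ.- ι (suc n) ℚ.* w k ∣
      ≡⟨ cong ∣_∣ (solve 3 (λ i p v → i :* (con 1ℚ :+ :- p) :+ :- (i :* (con 1ℚ :+ :- v)) :=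
           :- (i :* (p :+ :- v))) refl (ι (suc n)) p (v k)) ⟩
    ∣ ℚ.- (ι (suc n) ℚ.* (p ℚ.- v k)) ∣
      ≡⟨ trans (ℚ.∣-p∣≡∣p∣ (ι (suc n) ℚ.* (p ℚ.- v k))) (ℚ.∣p*q∣≡∣p∣*∣q∣ (ι (suc n)) (p ℚ.- v k)) ⟩
    ∣ ι (suc n) ∣ ℚ.* ∣ p ℚ.- v k ∣
      ≡⟨ cong (ℚ._* ∣ p ℚ.- v k ∣) (ℚ.0≤p⇒∣p∣≡p (0≤ι (suc n))) ⟩
    ι (suc n) ℚ.* ∣ p ℚ.- v k ∣
      ≤⟨ ℚ.*-monoˡ-≤-nonNeg (ι (suc n)) {{ℚ.nonNegative (0≤ι (suc n))}} (near k N≤k) ⟩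
    ι (suc n) ℚ.* (T (suc n) ℚ.+ δ)
      ≡⟨ solve 3 (λ i t d → i :* (t :+ d) := i :* t :+ d :* i) refl (ι (suc n)) (T (suc n)) δ ⟩
    ∂ T n ℚ.+ δ ℚ.* ι (suc n)
      ≤⟨ ℚ.+-mono-≤ (∂-T≤2 n) (ℚ.≤-reflexive δn≡ε) ⟩
    ι 2 ℚ.+ ε ∎
  where open ℚ.≤-Reasoning

-- The constant is 4 = 1 + 2 + 1: the boundary term `c n` of the summation by parts, the tail of the
-- series times n + 2, and the rounding in ⌈(n + 1) / 2⌉.
𝔼ALG-near : ∀ {n} (I : SimpleChain (suc n)) ε → 0ℚ ℚ.< ε → ∃ λ N → ∀ k → N ℕ.≤ k →
  ∣ 𝔼ALG I ℚ.- (ι 2 ℚ.* w k) ℚ.* ι (OPT I) ∣ ℚ.≤ ι 4 ℚ.+ ε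
𝔼ALG-near {n} I ε 0<ε =
  let N , near = *-Q-near (suc n) ε 0<ε
      l = ι (suc (suc n))
  in N , λ k N≤k → let a = l ℚ.* Q (suc n) ; b = l ℚ.* w k in begin
    ∣ 𝔼ALG I ℚ.- (ι 2 ℚ.* w k) ℚ.* ι (OPT I) ∣
      ≡⟨ cong₂ (λ E O → ∣ E ℚ.- (ι 2 ℚ.* w k) ℚ.* ι O ∣) (trans (𝔼ALG≡ I) (psum-Q n)) (OPT≡ I) ⟩
    ∣ a ℚ.- c n ℚ.- z k ∣
      ≤⟨ ∣-∣-triangle (a ℚ.- c n) a (z k) ⟩
    ∣ a ℚ.- c n ℚ.- a ∣ ℚ.+ ∣ a ℚ.- z k ∣
      ≤⟨ ℚ.+-mono-≤ (drop a) (∣-∣-triangle a b (z k)) ⟩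
    1ℚ ℚ.+ (∣ a ℚ.- b ∣ ℚ.+ ∣ b ℚ.- z k ∣)
      ≤⟨ ℚ.+-monoʳ-≤ 1ℚ (ℚ.+-mono-≤ (near k N≤k) (*-⌈n/2⌉-near (suc n) (∣w∣≤1 k))) ⟩
    1ℚ ℚ.+ (ι 2 ℚ.+ ε ℚ.+ 1ℚ)
      ≡⟨ solve 1 (λ e → con 1ℚ :+ (con (ι 2) :+ e :+ con 1ℚ) := con (ι 4) :+ e) refl ε ⟩
    ι 4 ℚ.+ ε ∎
  where
  open ℚ.≤-Reasoning
  z : ℕ → ℚ
  z k = (ι 2 ℚ.* w k) ℚ.* ι ⌈ suc n /2⌉
  drop : ∀ a → ∣ a ℚ.- c n ℚ.- a ∣ ℚ.≤ 1ℚ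
  drop a = subst (ℚ._≤ 1ℚ) (sym (trans
    (cong ∣_∣ (solve 2 (λ a c → a :+ :- c :+ :- a := :- c) refl a (c n))) (ℚ.∣-p∣≡∣p∣ (c n)))) (∣c∣≤1 n)

ratio : ℝ
ratio = fromℕ 2 * (1ℝ - 1/√e)

ratio-guaranteed : Guarantees ratio
ratio-guaranteed = fromℕ 4 , λ { (suc n) _ I ε 0<ε →
  let N , near = 𝔼ALG-near I ε 0<ε
  in N , λ k N≤k → let r = (ι 2 ℚ.* w k) ℚ.* ι (OPT I) in begin
    r ℚ.- ι 4
      ≤⟨ ℚ.+-monoˡ-≤ (ℚ.- ι 4) (∣-∣-elim {r} {𝔼ALG I} {ι 4 ℚ.+ ε} (subst (ℚ._≤ ι 4 ℚ.+ ε) (∣-∣-sym (𝔼ALG I) r) (near k N≤k))) ⟩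
    𝔼ALG I ℚ.+ (ι 4 ℚ.+ ε) ℚ.- ι 4
      ≡⟨ solve 2 (λ E e → E :+ (con (ι 4) :+ e) :+ :- con (ι 4) := E :+ e) refl (𝔼ALG I) ε ⟩
    𝔼ALG I ℚ.+ ε ∎ }
  where open ℚ.≤-Reasoning

ratio-largest : ∀ ρ → Guarantees ρ → ρ ≤ ratio
ratio-largest ρ (b , guarantee) ε 0<ε =
  let B , 0<B , K , b≤B = bounded b
      -- The 6 collects the 4 of `𝔼ALG-near` and two tolerances of 1. These need not be small,
      -- because all of C is divided by the optimum m in the end.
      C = B ℚ.+ ι 6
      δ , 0<δ , δC≡ε = split C (ℚ.+-mono-< 0<B (0<ι 6)) ε 0<ε
      M , small = archimedean δ 0<δ
      m = suc M
      -- An even size makes the optimum exactly m, and m is large enough for C to be at most ε m.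
      I = chain (m ℕ.+ m)
      N₁ , lower = guarantee (m ℕ.+ m) (ℕ.s≤s ℕ.z≤n) I 1ℚ 0<1
      N₂ , near = 𝔼ALG-near I 1ℚ 0<1
      OPT≡m : OPT I ≡ m
      OPT≡m = trans (OPT≡ I) (sym (ℕ.n≡⌈n+n/2⌉ m))
      C≤εm : C ℚ.≤ ε ℚ.* ι m
      C≤εm = begin
        C                              ≡⟨ ι-/ C M ⟨
        ι m ℚ.* (C ℚ.* (+ 1 / m))      ≤⟨ ℚ.*-monoˡ-≤-nonNeg (ι m) {{ℚ.nonNegative (0≤ι m)}}
                                            (ℚ.*-monoˡ-≤-nonNeg C {{ℚ.nonNegative (ℚ.<⇒≤ (ℚ.+-mono-< 0<B (0<ι 6)))}}
                                              (small M ℕ.≤-refl)) ⟩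
        ι m ℚ.* (C ℚ.* δ)              ≡⟨ trans (cong (ι m ℚ.*_) (trans (ℚ.*-comm C δ) δC≡ε)) (ℚ.*-comm (ι m) ε) ⟩
        ε ℚ.* ι m                      ∎
  in (N₁ ℕ.⊔ N₂) ℕ.⊔ K , λ k ≤k →
    let ρ′ = approx ρ k
        b′ = approx b k
        r = ι 2 ℚ.* w k
        N≤k = ℕ.m⊔n≤o⇒m≤o (N₁ ℕ.⊔ N₂) K ≤k
    in *-cancelʳ-≤ (ι m) (0<ι m) (begin
      ρ′ ℚ.* ι m
        ≡⟨ solve 2 (λ x b → x := x :+ :- b :+ b) refl (ρ′ ℚ.* ι m) b′ ⟩
      ρ′ ℚ.* ι m ℚ.- b′ ℚ.+ b′
        ≤⟨ ℚ.+-mono-≤ (subst (λ o → ρ′ ℚ.* ι o ℚ.- b′ ℚ.≤ 𝔼ALG I ℚ.+ 1ℚ) OPT≡m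
             (lower k (ℕ.m⊔n≤o⇒m≤o N₁ N₂ N≤k)))
             (ℚ.≤-trans (p≤∣p∣ b′) (b≤B k (ℕ.m⊔n≤o⇒n≤o (N₁ ℕ.⊔ N₂) K ≤k))) ⟩
      𝔼ALG I ℚ.+ 1ℚ ℚ.+ B
        ≤⟨ ℚ.+-monoˡ-≤ B (ℚ.+-monoˡ-≤ 1ℚ (subst (λ o → 𝔼ALG I ℚ.≤ r ℚ.* ι o ℚ.+ (ι 4 ℚ.+ 1ℚ)) OPT≡m
             (∣-∣-elim {𝔼ALG I} {r ℚ.* ι (OPT I)} {ι 4 ℚ.+ 1ℚ} (near k (ℕ.m⊔n≤o⇒n≤o N₁ N₂ N≤k))))) ⟩
      r ℚ.* ι m ℚ.+ (ι 4 ℚ.+ 1ℚ) ℚ.+ 1ℚ ℚ.+ B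
        ≡⟨ solve 2 (λ x b → x :+ (con (ι 4) :+ con 1ℚ) :+ con 1ℚ :+ b := x :+ (b :+ con (ι 6))) refl (r ℚ.* ι m) B ⟩
      r ℚ.* ι m ℚ.+ C
        ≤⟨ ℚ.+-monoʳ-≤ (r ℚ.* ι m) C≤εm ⟩
      r ℚ.* ι m ℚ.+ ε ℚ.* ι m
        ≡⟨ ℚ.*-distribʳ-+ (ι m) r ε ⟨
      (r ℚ.+ ε) ℚ.* ι m ∎)
  where open ℚ.≤-Reasoning

theorem2 : Guarantees (fromℕ 2 * (1ℝ - 1/√e)) ×
    (∀ (ρ : ℝ) → Guarantees ρ → ρ ≤ fromℕ 2 * (1ℝ - 1/√e))
theorem2 = ratio-guaranteed , ratio-largest
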